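{- The Horn Superposition Calculus (with the inference rules Parallel Superposition and Equality Resolution on Horn clauses) together with the lifted redundancy criterion $(\mathrm{Red}_I^{\mathcal G},\mathrm{Red}_C^{\mathcal G})$ is refutationally complete: for every set $N$ of Horn clauses that is saturated, i.e. every Parallel Superposition or Equality Resolution inference whose premises are in $N$ belongs to $\mathrm{Red}_I^{\mathcal G}(N)$, if ${\mathcal G}(N)$ is unsatisfiable (equivalently, $N$ is unsatisfiable in first-order logic with equality), then $\bot\in N$.
   Context: Fix a signature and a reduction ordering $\succ$ on terms that is total on ground terms. A clause is a finite multiset of equational literals $s\approx t$ or $s\not\approx t$ ($\approx$ symmetric), written as a disjunction; $\bot$ is the empty clause; a Horn clause has at most one positive literal. The literal ordering $\succ_L$ maps $s\approx t$ to the multiset $\{s,t\}$ and $s\not\approx t$ to $\{s,s,t,t\}$ and compares these by the multiset extension of $\succ$; the clause ordering $\succ_C$ is the multiset extension of $\succ_L$. A literal $L$ is maximal in $C\lor L$ if no literal of $C$ is larger than $L$, strictly maximal if no literal of $C$ is larger than or equal to $L$. Most general unifiers are idempotent. General inference rules. Parallel Superposition: from $D'\lor t\approx t'$ and $C[u,\dots,u]_{p_1,\dots,p_k}$ (renamed apart) derive $(D'\lor C[t',\dots,t']_{p_1,\dots,p_k})\sigma$, where $u$ is not a variable; $\sigma=\mathrm{mgu}(t\doteq u)$; $p_1,\dots,p_k$ are all occurrences of $u$ in $C$; if one of the occurrences of $u$ in $C$ is in a negative literal or below the top in a positive literal then $C\sigma\not\preceq_C(D'\lor t\approx t')\sigma$;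 $(t\approx t')\sigma$ is strictly maximal in $(D'\lor t\approx t')\sigma$; either one occurrence of $u$ is in a positive literal $L[u]=s[u]\approx s'$ with $L[u]\sigma$ strictly maximal in $C\sigma$, or one occurrence is in a negative literal $L[u]=s[u]\not\approx s'$ with $L[u]\sigma$ maximal in $C\sigma$; $t\sigma\not\preceq t'\sigma$; $s\sigma\not\preceq s'\sigma$. Equality Resolution: from $C'\lor s\not\approx s'$ derive $C'\sigma$, where $\sigma=\mathrm{mgu}(s\doteq s')$ and $(s\not\approx s')\sigma$ is maximal in $(C'\lor s\not\approx s')\sigma$. Ground closures. A ground closure $(C\cdot\theta)$ is a clause $C$ with a substitution $\theta$ such that $C\theta$ is ground; $(C_1\cdot\theta_1)$ and $(C_2\cdot\theta_2)$ are identified when $C_1,C_2$ are equal up to bijective variable renaming and $C_1\theta_1=C_2\theta_2$; $(\bot\cdot\theta)=\bot$. A ground rewrite system $R$ is contained in $\succ$ if $u\succ v$ for all $u\to v\in R$, left-reduced if no left-hand side $u$ of $u\to v\in R$ is reducible by $R\setminus\{u\to v\}$; $t{\downarrow}_R$ is the $R$-normal form; $R\models(C\cdot\theta)$ means $C\theta$ is true in the equational interpretation generated by $R$. Normalization closure ordering. For a clause $C$: $\mathrm{ss}^-(C)$ is the set of all subterms (at any position, including the top) of sides of negative literals of $C$; $\mathrm{ss}^+_{>\epsilon}(C)$ the set of subterms at non-top positions of sides of positive literals; $\mathrm{ts}^-(C)$ the set of sides of negative literals; $\mathrm{ts}^+(C)$ the set of sides of positive literals. $\mathrm{lss}(C)=\{(t,2)\mid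 t\in\mathrm{ss}^-(C)\}\cup\{(t,1)\mid t\in\mathrm{ss}^+_{>\epsilon}(C)\setminus\mathrm{ss}^-(C)\}\cup\{(t,0)\mid t\in\mathrm{ts}^+(C)\setminus(\mathrm{ss}^+_{>\epsilon}(C)\cup\mathrm{ss}^-(C))\}$, $\mathrm{lts}(C)=\{(t,2)\mid t\in\mathrm{ts}^-(C)\}\cup\{(t,0)\mid t\in\mathrm{ts}^+(C)\setminus\mathrm{ts}^-(C)\}$. For $R$ left-reduced, ground, contained in $\succ$, a ground term $t$ and $m\in\{0,1,2\}$: $\mathrm{rm}_R(t,m)=\emptyset$ if $t$ is $R$-irreducible; $=\{(u,m)\}\cup\mathrm{rm}_R(t',m)$ if $t\to_R t'$ with rule $u\to v$ at position $p$ with $p=\epsilon$ or $m>0$; $=\{(u,1)\}\cup\mathrm{rm}_R(t',m)$ if $t\to_Rt'$ with $u\to v$ at $p>\epsilon$ and $m=0$ (independent of the reduction chosen). $\mathrm{nm}_R(C\cdot\theta)=\bigcup_{(f(t_1,\dots,t_n),m)\in\mathrm{lss}(C)}\mathrm{rm}_R(f(t_1\theta{\downarrow}_R,\dots,t_n\theta{\downarrow}_R),m)\cup\bigcup_{(x,m)\in\mathrm{lss}(C),\,x\text{ variable}}\mathrm{rm}_R(x\theta,m)\cup\bigcup_{(t,m)\in\mathrm{lts}(C)}\{(t\theta{\downarrow}_R,m)\}$ (multiset unions). Fix a well-founded ordering $\succ_{Clo}$ on ground closures, total on closures with equal ground instance, such that $(C\cdot\theta_1)\succ_{Clo}(D\cdot\theta_2)$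 whenever $C\theta_1=D\theta_2$ and $D$ is an instance of $C$ but not vice versa. $\succ\!\!\succ_R$ is the lexicographic combination of (1) the multiset extension of the lexicographic combination of $\succ$ (on terms) and $>$ (on labels), applied to the $\mathrm{nm}_R$ multisets; (2) $\succ_C$ on the ground instances; (3) $\succ_{Clo}$. $\prec\!\!\prec_R$ is its converse. Ground closure inferences (premises renamed apart, sharing one $\theta$). Parallel Superposition I: from $(D'\lor t\approx t'\cdot\theta)$ and $(C[u,\dots,u]_{p_1,\dots,p_k}\cdot\theta)$ derive $((D'\lor C[t',\dots,t']_{p_1,\dots,p_k})\sigma\cdot\theta)$ where $u$ is not a variable, $t\theta=u\theta$, $\sigma=\mathrm{mgu}(t\doteq u)$, $p_1,\dots,p_k$ all occurrences of $u$ in $C$; if one occurrence of $u$ is in a negative literal or below the top in a positive literal then $(D'\lor t\approx t')\theta\prec_C C\theta$; one occurrence of $u$ is in a positive literal $s[u]\approx s'$ with $(s[u]\approx s')\theta$ strictly maximal in $C\theta$ or in a negative literal $s[u]\not\approx s'$ with $(s[u]\not\approx s')\theta$ maximal in $C\theta$; $s[u]\theta\succ s'\theta$; $(t\approx t')\theta$ strictly maximal in $(D'\lor t\approx t')\theta$; $t\theta\succ t'\theta$. Parallel Superposition II: from $(D'\lor t\approx t'\cdot\theta)$ and $(C\cdot\theta)$ derive $(D'\lor C\cdot\theta[x\mapsto u[t'\theta]])$ where $x$ is a variable of $C$ with $x\theta=u[t\theta]$ ($t\theta$ occurs in $x\theta$, replaced by $t'\theta$ at that position), with the same conditions as Parallel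 Superposition I with $x$ in place of $u$. Equality Resolution: from $(C'\lor s\not\approx s'\cdot\theta)$ derive $(C'\sigma\cdot\theta)$ where $s\theta=s'\theta$, $\sigma=\mathrm{mgu}(s\doteq s')$, $(s\not\approx s')\theta$ maximal in $(C'\lor s\not\approx s')\theta$. The second (resp. only) premise is the right (resp. only) premise. Redundancy for a set $N$ of ground closures: $(C\cdot\theta)\in\mathrm{Red}_C(N)$ iff for every left-reduced ground rewrite system $R$ contained in $\succ$, $R\models(C\cdot\theta)$ or some $(D\cdot\theta')\in N$ has $(D\cdot\theta')\prec\!\!\prec_R(C\cdot\theta)$ and $R\not\models(D\cdot\theta')$. A ground inference $\iota$ with right/only premise $(C\cdot\theta)$ is in $\mathrm{Red}_I(N)$ iff for every such $R$: (i) $R\models\mathrm{concl}(\iota)$, or (ii) some $(C'\cdot\theta')\in N$ has $(C'\cdot\theta')\prec\!\!\prec_R(C\cdot\theta)$ and $R\not\models(C'\cdot\theta')$, or (iii) $\iota$ is a Parallel Superposition inference with left premise $(D'\lor t\approx t'\cdot\theta)$, $t\theta\succ t'\theta$, and $(t\theta\to t'\theta)\notin R$, or (iv) $\iota$ is a Parallel Superposition inference whose left premise is not the $\succ\!\!\succ_R$-minimal premise. Grounding and lifting. The ground instances ${\mathcal G}(C)$ of a clause $C$ are all ground closures $(C\cdot\theta)$. A ground instance of a general inference $C_n\dots C_1/C_0$ is any ground closure inference $(C_n\cdot\theta)\dots(C_1\cdot\theta)/(C_0\cdot\theta)$; ${\mathcal G}(\iota)$ is the set of these; ${\mathcal G}(N)=\bigcup_{C\in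 N}{\mathcal G}(C)$. $\iota\in\mathrm{Red}_I^{\mathcal G}(N)$ iff ${\mathcal G}(\iota)\subseteq\mathrm{Red}_I({\mathcal G}(N))$; $C\in\mathrm{Red}_C^{\mathcal G}(N)$ iff ${\mathcal G}(C)\subseteq\mathrm{Red}_C({\mathcal G}(N))$. -}

module Defs where

open import Level using (Level; 0ℓ)
open import Data.Nat using (ℕ; zero; suc; _≤_; _>_; _≟_)
open import Data.Fin using (Fin; toℕ)
open import Data.Vec using (Vec; []; _∷_; lookup; _[_]≔_)
import Data.Vec.Relation.Binary.Pointwise.Inductive as VP
open import Data.List using (List; []; _∷_; _++_; concat; map)
open import Data.List.Membership.Propositional using (_∈_)
open import Data.List.Relation.Unary.Any using (Any)
open import Data.List.Relation.Unary.All using (All)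
open import Data.List.Relation.Binary.Pointwise using (Pointwise)
open import Data.List.Relation.Binary.Permutation.Propositional using (_↭_)
open import Data.List.Relation.Unary.Unique.Propositional using (Unique)
open import Data.Product using (Σ; ∃; ∃₂; _×_; _,_; proj₁; proj₂)
open import Data.Sum using (_⊎_)
open import Data.Empty using (⊥)
open import Data.Unit using (⊤)
open import Function using (flip)
open import Relation.Nullary using (¬_; yes; no)
open import Relation.Binary.PropositionalEquality using (_≡_; _≢_)
open import Relation.Binary.Construct.Closure.ReflexiveTransitive using (Star)
open import Relation.Binary.Construct.Closure.Equivalence using (EqClosure)
open import Induction.WellFounded using (WellFounded)

module _ {a ℓ} {A : Set a} (_≈_ : A → A → Set ℓ) where

  MEq : List A → List A → Set _
  MEq xs ys = ∃ λ zs → (xs ↭ zs) × Pointwise _≈_ zs ys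

module _ {a ℓ ℓ'} {A : Set a} (_≈_ : A → A → Set ℓ) (_>_ : A → A → Set ℓ') where

  MulExt : List A → List A → Set _
  MulExt M N = ∃ λ Z → ∃ λ X → ∃ λ Y →
    MEq _≈_ M (Z ++ X) × MEq _≈_ N (Z ++ Y) × (X ≢ []) ×
    All (λ y → Any (λ x → x > y) X) Y

Enumerates : ∀ {a ℓ} {A : Set a} → (A → Set ℓ) → List A → Set _
Enumerates P xs = Unique xs × (∀ x → (x ∈ xs → P x) × (P x → x ∈ xs))

record Signature : Set₁ where
  field
    Fun   : Set
    arity : Fun → ℕ

data Term (sig : Signature) : Set where
  var : ℕ → Term sig
  fun : (f : Signature.Fun sig) → Vec (Term sig) (Signature.arity sig f) → Term sig

Subst : Signature → Set
Subst sig = ℕ → Term sig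

data Lit (sig : Signature) : Set where
  pos : Term sig → Term sig → Lit sig
  neg : Term sig → Term sig → Lit sig

-- a clause is a finite multiset of literals, represented as a list
Clause : Signature → Set
Clause sig = List (Lit sig)

Closure : Signature → Set
Closure sig = Clause sig × Subst sig

RSys : Signature → Set₁
RSys sig = Term sig → Term sig → Set

module _ {sig : Signature} where
  open Signature sig

  mutual
    _⟨_⟩ : Term sig → Subst sig → Term sig
    var x ⟨ θ ⟩ = θ x
    fun f ts ⟨ θ ⟩ = fun f (ts ⟨ θ ⟩*)

    _⟨_⟩* : ∀ {n} → Vec (Term sig) n → Subst sig → Vec (Term sig) n
    [] ⟨ θ ⟩* = []
    (t ∷ ts) ⟨ θ ⟩* = (t ⟨ θ ⟩) ∷ (ts ⟨ θ ⟩*)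

  data At : Term sig → List ℕ → Term sig → Set where
    here  : ∀ {t} → At t [] t
    there : ∀ {f ts p u} (i : Fin (arity f)) → At (lookup ts i) p u →
            At (fun f ts) (toℕ i ∷ p) u

  data Repl : Term sig → List ℕ → Term sig → Term sig → Set where
    here  : ∀ {t v} → Repl t [] v v
    there : ∀ {f ts p v s'} (i : Fin (arity f)) → Repl (lookup ts i) p v s' →
            Repl (fun f ts) (toℕ i ∷ p) v (fun f (ts [ i ]≔ s'))

  data ReplAll (u t' : Term sig) : Term sig → Term sig → Set where
    hit  : ReplAll u t' u t'
    rvar : ∀ {x} → var x ≢ u → ReplAll u t' (var x) (var x)
    rfun : ∀ {f ts ts'} → fun f ts ≢ u → VP.Pointwise (ReplAll u t') ts ts' →
           ReplAll u t' (fun f ts) (fun f ts')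

  data ReplAllLit (u t' : Term sig) : Lit sig → Lit sig → Set where
    rpos : ∀ {a b a' b'} → ReplAll u t' a a' → ReplAll u t' b b' → ReplAllLit u t' (pos a b) (pos a' b')
    rneg : ∀ {a b a' b'} → ReplAll u t' a a' → ReplAll u t' b b' → ReplAllLit u t' (neg a b) (neg a' b')

  ReplAllCl : Term sig → Term sig → Clause sig → Clause sig → Set
  ReplAllCl u t' = Pointwise (ReplAllLit u t')

  Occurs : ℕ → Term sig → Set
  Occurs x t = ∃ λ p → At t p (var x)

  Ground : Term sig → Set
  Ground t = ∀ x → ¬ Occurs x t

  IsVar : Term sig → Set
  IsVar t = ∃ λ x → t ≡ var x

  IsMGU : Subst sig → Term sig → Term sig → Set
  IsMGU σ s t =
    (s ⟨ σ ⟩ ≡ t ⟨ σ ⟩) ×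
    (∀ τ → s ⟨ τ ⟩ ≡ t ⟨ τ ⟩ → ∃ λ δ → ∀ x → τ x ≡ (σ x) ⟨ δ ⟩) ×
    (∀ x → (σ x) ⟨ σ ⟩ ≡ σ x)

  _[_↦_] : Subst sig → ℕ → Term sig → Subst sig
  (θ [ x ↦ w ]) y with y ≟ x
  ... | yes _ = w
  ... | no _  = θ y

  litSub : Subst sig → Lit sig → Lit sig
  litSub θ (pos s t) = pos (s ⟨ θ ⟩) (t ⟨ θ ⟩)
  litSub θ (neg s t) = neg (s ⟨ θ ⟩) (t ⟨ θ ⟩)

  _⟪_⟫ : Clause sig → Subst sig → Clause sig
  C ⟪ θ ⟫ = map (litSub θ) C

  -- the multiset encoding used by the literal ordering
  litMS : Lit sig → List (Term sig)
  litMS (pos s t) = s ∷ t ∷ []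
  litMS (neg s t) = s ∷ s ∷ t ∷ t ∷ []

  -- literal equality (≈ is symmetric): equal multiset encodings
  LitEq : Lit sig → Lit sig → Set
  LitEq L L' = MEq _≡_ (litMS L) (litMS L')

  _≅_ : Clause sig → Clause sig → Set
  C ≅ D = MEq LitEq C D

  OccursCl : ℕ → Clause sig → Set
  OccursCl x C = Any (λ L → Any (Occurs x) (litMS L)) C

  GroundCl : Clause sig → Set
  GroundCl C = All (λ L → All Ground (litMS L)) C

  GroundClo : Closure sig → Set
  GroundClo (C , θ) = GroundCl (C ⟪ θ ⟫)

  𝒢 : (Clause sig → Set) → Closure sig → Set
  𝒢 N (C , θ) = N C × GroundClo (C , θ)

  inst : Closure sig → Clause sig
  inst (C , θ) = C ⟪ θ ⟫

  Disjoint : Clause sig → Clause sig → Set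
  Disjoint C D = ∀ x → OccursCl x C → ¬ OccursCl x D

  posCount : Clause sig → ℕ
  posCount [] = 0
  posCount (pos _ _ ∷ C) = suc (posCount C)
  posCount (neg _ _ ∷ C) = posCount C

  Horn : Clause sig → Set
  Horn C = posCount C ≤ 1

  IsRenaming : Subst sig → Set
  IsRenaming ρ = ∃₂ λ (π π' : ℕ → ℕ) →
    (∀ x → ρ x ≡ var (π x)) × (∀ x → π' (π x) ≡ x) × (∀ x → π (π' x) ≡ x)

  Variant : Clause sig → Clause sig → Set
  Variant C D = ∃ λ ρ → IsRenaming ρ × (C ≅ (D ⟪ ρ ⟫))

  InstanceOf : Clause sig → Clause sig → Set
  InstanceOf D C = ∃ λ τ → D ≅ (C ⟪ τ ⟫)

  ClosId : Closure sig → Closure sig → Set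
  ClosId (C₁ , θ₁) (C₂ , θ₂) = Variant C₁ C₂ × ((C₁ ⟪ θ₁ ⟫) ≅ (C₂ ⟪ θ₂ ⟫))

  data NegSide : Lit sig → Term sig → Set where
    nl : ∀ {s t} → NegSide (neg s t) s
    nr : ∀ {s t} → NegSide (neg s t) t

  data PosSide : Lit sig → Term sig → Set where
    pl : ∀ {s t} → PosSide (pos s t) s
    pr : ∀ {s t} → PosSide (pos s t) t

  InSSneg : Clause sig → Term sig → Set
  InSSneg C t = Σ (Lit sig) λ L → L ∈ C × Σ (Term sig) λ s → NegSide L s × ∃ λ p → At s p t

  InSSposProper : Clause sig → Term sig → Set
  InSSposProper C t = Σ (Lit sig) λ L → L ∈ C × Σ (Term sig) λ s → PosSide L s ×
                      ∃ λ p → (p ≢ []) × At s p t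

  InTSneg : Clause sig → Term sig → Set
  InTSneg C t = Σ (Lit sig) λ L → L ∈ C × NegSide L t

  InTSpos : Clause sig → Term sig → Set
  InTSpos C t = Σ (Lit sig) λ L → L ∈ C × PosSide L t

  DeepOcc : Term sig → Clause sig → Set
  DeepOcc u C = InSSneg C u ⊎ InSSposProper C u

  data InLss (C : Clause sig) : Term sig × ℕ → Set where
    l2 : ∀ {t} → InSSneg C t → InLss C (t , 2)
    l1 : ∀ {t} → InSSposProper C t → ¬ InSSneg C t → InLss C (t , 1)
    l0 : ∀ {t} → InTSpos C t → ¬ InSSposProper C t → ¬ InSSneg C t → InLss C (t , 0)

  data InLts (C : Clause sig) : Term sig × ℕ → Set where
    t2 : ∀ {t} → InTSneg C t → InLts C (t , 2)
    t0 : ∀ {t} → InTSpos C t → ¬ InTSneg C t → InLts C (t , 0)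

  Step : RSys sig → Term sig → Term sig → Set
  Step R t t' = ∃ λ p → ∃₂ λ u v → R u v × At t p u × Repl t p v t'

  Irreducible : RSys sig → Term sig → Set
  Irreducible R t = ∀ t' → ¬ Step R t t'

  NF : RSys sig → Term sig → Term sig → Set
  NF R t n = Star (Step R) t n × Irreducible R n

  GroundRS : RSys sig → Set
  GroundRS R = ∀ u v → R u v → Ground u × Ground v

  LeftReduced : RSys sig → Set
  LeftReduced R = ∀ u v u' v' p → R u v → R u' v' → At u p u' → (u' ≡ u × v' ≡ v)

  TrueLit : RSys sig → Lit sig → Set
  TrueLit R (pos s t) = EqClosure (Step R) s t
  TrueLit R (neg s t) = ¬ EqClosure (Step R) s t

  _⊨_ : RSys sig → Closure sig → Set
  R ⊨ (C , θ) = Any (TrueLit R) (C ⟪ θ ⟫)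

  label : List ℕ → ℕ → ℕ
  label [] m = m
  label (_ ∷ _) zero = 1
  label (_ ∷ _) (suc m) = suc m

  data Rm (R : RSys sig) : Term sig → ℕ → List (Term sig × ℕ) → Set where
    rm-irr  : ∀ {t m} → Irreducible R t → Rm R t m []
    rm-step : ∀ {t t' m p u v M} → R u v → At t p u → Repl t p v t' → Rm R t' m M →
              Rm R t m ((u , label p m) ∷ M)

  data LssContrib (R : RSys sig) (θ : Subst sig) : Term sig × ℕ → List (Term sig × ℕ) → Set where
    c-var : ∀ {x m M} → Rm R (θ x) m M → LssContrib R θ (var x , m) M
    c-fun : ∀ {f ts ts' m M} → VP.Pointwise (λ s s' → NF R (s ⟨ θ ⟩) s') ts ts' →
            Rm R (fun f ts') m M → LssContrib R θ (fun f ts , m) M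

  data LtsContrib (R : RSys sig) (θ : Subst sig) : Term sig × ℕ → Term sig × ℕ → Set where
    c-lts : ∀ {t n m} → NF R (t ⟨ θ ⟩) n → LtsContrib R θ (t , m) (n , m)

  NM : RSys sig → Closure sig → List (Term sig × ℕ) → Set
  NM R (C , θ) M =
    ∃ λ ls → Enumerates (InLss C) ls ×
    ∃ λ Ms → Pointwise (LssContrib R θ) ls Ms ×
    ∃ λ ts → Enumerates (InLts C) ts ×
    ∃ λ ns → Pointwise (LtsContrib R θ) ts ns ×
    (M ↭ (concat Ms ++ ns))

record ReductionOrdering (sig : Signature) : Set₁ where
  field
    _≻_     : Term sig → Term sig → Set
    irrefl  : ∀ {t} → ¬ (t ≻ t)
    trans   : ∀ {s t u} → s ≻ t → t ≻ u → s ≻ u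
    wf      : WellFounded (flip _≻_)
    compat  : ∀ {s t c p c₁ c₂} → s ≻ t → Repl c p s c₁ → Repl c p t c₂ → c₁ ≻ c₂
    stable  : ∀ {s t} (σ : Subst sig) → s ≻ t → (s ⟨ σ ⟩) ≻ (t ⟨ σ ⟩)
    total   : ∀ {s t} → Ground s → Ground t → s ≻ t ⊎ s ≡ t ⊎ t ≻ s

record ClosureOrdering (sig : Signature) : Set₁ where
  field
    _≻Clo_   : Closure sig → Closure sig → Set
    irrefl   : ∀ {c} → ¬ (c ≻Clo c)
    trans    : ∀ {c d e} → c ≻Clo d → d ≻Clo e → c ≻Clo e
    wf       : WellFounded (flip _≻Clo_)
    onGround : ∀ {c d} → c ≻Clo d → GroundClo c × GroundClo d
    -- ≻Clo is an ordering on closures modulo identification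
    respects : ∀ {c c' d d'} → ClosId c c' → ClosId d d' → c ≻Clo d → c' ≻Clo d'
    total    : ∀ {c d} → GroundClo c → GroundClo d → inst c ≅ inst d →
               ClosId c d ⊎ c ≻Clo d ⊎ d ≻Clo c
    general  : ∀ {C θ₁ D θ₂} → GroundClo (C , θ₁) → (C ⟪ θ₁ ⟫) ≅ (D ⟪ θ₂ ⟫) →
               InstanceOf D C → ¬ InstanceOf C D → (C , θ₁) ≻Clo (D , θ₂)

module _ {sig : Signature} (ord : ReductionOrdering sig) where
  open ReductionOrdering ord

  _≻L_ : Lit sig → Lit sig → Set
  L ≻L L' = MulExt _≡_ _≻_ (litMS L) (litMS L')

  _≻C_ : Clause sig → Clause sig → Set
  C ≻C D = MulExt LitEq _≻L_ C D

  NotPrecEq : Term sig → Term sig → Set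
  NotPrecEq s t = ¬ (t ≻ s ⊎ s ≡ t)

  NotPrecEqC : Clause sig → Clause sig → Set
  NotPrecEqC C D = ¬ (D ≻C C ⊎ C ≅ D)

  Maximal : Lit sig → Clause sig → Set
  Maximal L rest = All (λ L' → ¬ (L' ≻L L)) rest

  StrictlyMaximal : Lit sig → Clause sig → Set
  StrictlyMaximal L rest = All (λ L' → ¬ (L' ≻L L ⊎ LitEq L' L)) rest

  _≻TL_ : Term sig × ℕ → Term sig × ℕ → Set
  (t , m) ≻TL (t' , m') = t ≻ t' ⊎ (t ≡ t' × m > m')

  Admissible : RSys sig → Set
  Admissible R = LeftReduced R × GroundRS R × (∀ u v → R u v → u ≻ v)

  module _ (clo : ClosureOrdering sig) where
    open ClosureOrdering clo

    NMGt : RSys sig → Closure sig → Closure sig → Set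
    NMGt R c d = ∃₂ λ M₁ M₂ → NM R c M₁ × NM R d M₂ ×
      (MulExt _≡_ _≻TL_ M₁ M₂ ⊎
       (MEq _≡_ M₁ M₂ × (inst c ≻C inst d ⊎ ((inst c ≅ inst d) × c ≻Clo d))))

  -- General inferences (premises listed left to right; the last is the right premise)

  data GenInf : List (Clause sig) → Clause sig → Set where
    psup : ∀ {t t' D' L Crest u σ C'} →
      let Left  = pos t t' ∷ D'
          Right = L ∷ Crest in
      Disjoint Left Right →
      ¬ IsVar u →
      IsMGU σ t u →
      ReplAllCl u t' Right C' →
      (DeepOcc u Right → NotPrecEqC (Right ⟪ σ ⟫) (Left ⟪ σ ⟫)) →
      StrictlyMaximal (litSub σ (pos t t')) (D' ⟪ σ ⟫) →
      (Σ (Term sig) λ s → Σ (Term sig) λ s' → (∃ λ p → At s p u) ×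
         NotPrecEq (s ⟨ σ ⟩) (s' ⟨ σ ⟩) ×
         ((L ≡ pos s s' × StrictlyMaximal (litSub σ L) (Crest ⟪ σ ⟫)) ⊎
          (L ≡ neg s s' × Maximal (litSub σ L) (Crest ⟪ σ ⟫)))) →
      NotPrecEq (t ⟨ σ ⟩) (t' ⟨ σ ⟩) →
      GenInf (Left ∷ Right ∷ []) ((D' ++ C') ⟪ σ ⟫)
    eres : ∀ {s s' C' σ} →
      IsMGU σ s s' →
      Maximal (litSub σ (neg s s')) (C' ⟪ σ ⟫) →
      GenInf ((neg s s' ∷ C') ∷ []) (C' ⟪ σ ⟫)

  -- Ground closure inferences (all premises share θ; last premise is the right one)

  data GInf : List (Closure sig) → Closure sig → Set where
    psupI : ∀ {t t' D' L Crest u σ C' θ} →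
      let Left  = pos t t' ∷ D'
          Right = L ∷ Crest in
      GroundClo (Left , θ) → GroundClo (Right , θ) →
      Disjoint Left Right →
      ¬ IsVar u →
      (t ⟨ θ ⟩) ≡ (u ⟨ θ ⟩) →
      IsMGU σ t u →
      ReplAllCl u t' Right C' →
      (DeepOcc u Right → (Right ⟪ θ ⟫) ≻C (Left ⟪ θ ⟫)) →
      (Σ (Term sig) λ s → Σ (Term sig) λ s' → (∃ λ p → At s p u) ×
         (s ⟨ θ ⟩) ≻ (s' ⟨ θ ⟩) ×
         ((L ≡ pos s s' × StrictlyMaximal (litSub θ L) (Crest ⟪ θ ⟫)) ⊎
          (L ≡ neg s s' × Maximal (litSub θ L) (Crest ⟪ θ ⟫)))) →
      StrictlyMaximal (litSub θ (pos t t')) (D' ⟪ θ ⟫) →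
      (t ⟨ θ ⟩) ≻ (t' ⟨ θ ⟩) →
      GInf ((Left , θ) ∷ (Right , θ) ∷ []) ((D' ++ C') ⟪ σ ⟫ , θ)
    psupII : ∀ {t t' D' L Crest x p w θ} →
      let Left  = pos t t' ∷ D'
          Right = L ∷ Crest in
      GroundClo (Left , θ) → GroundClo (Right , θ) →
      Disjoint Left Right →
      OccursCl x Right →
      At (θ x) p (t ⟨ θ ⟩) →
      Repl (θ x) p (t' ⟨ θ ⟩) w →
      (DeepOcc (var x) Right → (Right ⟪ θ ⟫) ≻C (Left ⟪ θ ⟫)) →
      (Σ (Term sig) λ s → Σ (Term sig) λ s' → (∃ λ q → At s q (var x)) ×
         (s ⟨ θ ⟩) ≻ (s' ⟨ θ ⟩) ×
         ((L ≡ pos s s' × StrictlyMaximal (litSub θ L) (Crest ⟪ θ ⟫)) ⊎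
          (L ≡ neg s s' × Maximal (litSub θ L) (Crest ⟪ θ ⟫)))) →
      StrictlyMaximal (litSub θ (pos t t')) (D' ⟪ θ ⟫) →
      (t ⟨ θ ⟩) ≻ (t' ⟨ θ ⟩) →
      GInf ((Left , θ) ∷ (Right , θ) ∷ []) (D' ++ Right , θ [ x ↦ w ])
    eresG : ∀ {s s' C' σ θ} →
      GroundClo (neg s s' ∷ C' , θ) →
      (s ⟨ θ ⟩) ≡ (s' ⟨ θ ⟩) →
      IsMGU σ s s' →
      Maximal (litSub θ (neg s s')) (C' ⟪ θ ⟫) →
      GInf ((neg s s' ∷ C' , θ) ∷ []) (C' ⟪ σ ⟫ , θ)

  rightPremise : ∀ {ps c} → GInf ps c → Closure sig
  rightPremise (psupI {L = L} {Crest} {θ = θ} _ _ _ _ _ _ _ _ _ _ _) = (L ∷ Crest , θ)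
  rightPremise (psupII {L = L} {Crest} {θ = θ} _ _ _ _ _ _ _ _ _ _) = (L ∷ Crest , θ)
  rightPremise (eresG {s} {s'} {C'} {θ = θ} _ _ _ _) = (neg s s' ∷ C' , θ)

  RuleNotInR : RSys sig → ∀ {ps c} → GInf ps c → Set
  RuleNotInR R (psupI {t} {t'} {θ = θ} _ _ _ _ _ _ _ _ _ _ _) =
    (t ⟨ θ ⟩) ≻ (t' ⟨ θ ⟩) × ¬ R (t ⟨ θ ⟩) (t' ⟨ θ ⟩)
  RuleNotInR R (psupII {t} {t'} {θ = θ} _ _ _ _ _ _ _ _ _ _) =
    (t ⟨ θ ⟩) ≻ (t' ⟨ θ ⟩) × ¬ R (t ⟨ θ ⟩) (t' ⟨ θ ⟩)
  RuleNotInR R (eresG _ _ _ _) = ⊥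

  module _ (clo : ClosureOrdering sig) where

    LeftNotMinimal : RSys sig → ∀ {ps c} → GInf ps c → Set
    LeftNotMinimal R (psupI {t} {t'} {D'} {L} {Crest} {θ = θ} _ _ _ _ _ _ _ _ _ _ _) =
      NMGt clo R (pos t t' ∷ D' , θ) (L ∷ Crest , θ)
    LeftNotMinimal R (psupII {t} {t'} {D'} {L} {Crest} {θ = θ} _ _ _ _ _ _ _ _ _ _) =
      NMGt clo R (pos t t' ∷ D' , θ) (L ∷ Crest , θ)
    LeftNotMinimal R (eresG _ _ _ _) = ⊥

    RedI : (Closure sig → Set) → ∀ {ps c} → GInf ps c → Set₁
    RedI NG {c = c} ι = ∀ (R : RSys sig) → Admissible R →
      (R ⊨ c) ⊎
      (∃ λ c' → NG c' × NMGt clo R (rightPremise ι) c' × ¬ (R ⊨ c')) ⊎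
      RuleNotInR R ι ⊎
      LeftNotMinimal R ι

    GroundInstanceOf : ∀ {ps c gps gc} → GInf gps gc → GenInf ps c → Set
    GroundInstanceOf {ps} {c} {gps} {gc} _ _ =
      ∃ λ θ → (gps ≡ map (λ C → (C , θ)) ps) × ClosId gc (c , θ)

    RedIG : (Clause sig → Set) → ∀ {ps c} → GenInf ps c → Set₁
    RedIG N ι = ∀ {gps gc} (ι' : GInf gps gc) → GroundInstanceOf ι' ι → RedI (𝒢 N) ι'

    Saturated : (Clause sig → Set) → Set₁
    Saturated N = ∀ {ps c} (ι : GenInf ps c) →
      All (λ C → ∃ λ D → N D × Variant C D) ps → RedIG N ι

record Model (sig : Signature) : Set₁ where
  open Signature sig
  field
    Carrier : Set
    _≈_     : Carrier → Carrier → Set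
    refl    : ∀ {a} → a ≈ a
    sym     : ∀ {a b} → a ≈ b → b ≈ a
    trans   : ∀ {a b c} → a ≈ b → b ≈ c → a ≈ c
    op      : (f : Fun) → Vec Carrier (arity f) → Carrier
    op-cong : ∀ f {as bs} → VP.Pointwise _≈_ as bs → op f as ≈ op f bs

module _ {sig : Signature} (M : Model sig) where
  open Model M

  mutual
    eval : (ℕ → Carrier) → Term sig → Carrier
    eval v (var x) = v x
    eval v (fun f ts) = op f (eval* v ts)

    eval* : ∀ {n} → (ℕ → Carrier) → Vec (Term sig) n → Vec Carrier n
    eval* v [] = []
    eval* v (t ∷ ts) = eval v t ∷ eval* v ts

  TrueLitM : (ℕ → Carrier) → Lit sig → Set
  TrueLitM v (pos s t) = eval v s ≈ eval v t
  TrueLitM v (neg s t) = ¬ (eval v s ≈ eval v t)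

  SatClo : Closure sig → Set
  SatClo (C , θ) = ∀ v → Any (TrueLitM v) (C ⟪ θ ⟫)

Unsatisfiable : ∀ {sig} → (Closure sig → Set) → Set₁
Unsatisfiable {sig} NG = ¬ (Σ (Model sig) λ M → ∀ c → NG c → SatClo M c)

{-# OPTIONS --safe #-}

-- Model construction. Going up the ground terms s, let R< s be the rules produced so far. If s is
-- R< s-irreducible, consider the closures of 𝒢 N whose instance is s ≈ s′ ∨ (negative literals with
-- sides below s, all refuted by R< s), and let one of them that is minimal for the closure ordering
-- of R< s produce s → s′. If the limit R∞ refutes some closure of 𝒢 N, take a minimal one, (C · θ).
-- Its variables have R∞-irreducible values, since rewriting a value gives a smaller false closure.
-- Hence the maximal literal of Cθ admits Equality Resolution or Parallel Superposition with the
-- producing closure of a rule of R∞. The conclusion is false in R∞, so redundancy of the inference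
-- can only mean that the left premise is larger than (C · θ). This is impossible: if the overlapped
-- term occurs in a negative literal or below the top, the labels of the normalization multiset make
-- (C · θ) larger; otherwise (C · θ) was itself a candidate for the same rule, and passing from R< s
-- to R∞ changes the multisets of all candidates (having a single positive literal) by the same
-- entries, so that minimality of the left premise carries over.
module Submission where

-- The usual model construction recurses over clauses, from small to large. Here the ordering on
-- closures is itself relative to a rewrite system, so it cannot guide the construction of that
-- system. The recursion therefore runs over left-hand sides, and `R< s` suffices to compare the
-- closures that compete for `s`. The price is a mismatch: producers are minimal with respect to
-- `R< s`, while saturation is exploited with respect to `R∞`. The labels decide which overlaps are
-- harmless. A producer contributes its left-hand side `s` with label 0 only, so a clause that
-- contains `s` in a negative literal or below the top records `s` with a larger label and outweighs
-- the producer, whatever else the two contain. Only overlaps confined to the top of a positive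
-- literal are left, and there the two premises have the same shape, which is what makes their
-- measures comparable across the two systems.

open import Axiom.ExcludedMiddle using (ExcludedMiddle)
open import Data.Empty using (⊥; ⊥-elim)
open import Data.Fin using (zero; suc; toℕ)
open import Data.Fin.Properties using (toℕ-injective) renaming (_≟_ to _≟ᶠ_)
open import Data.List using (List; []; _∷_; _++_; concat; map)
open import Data.List.Membership.Propositional using (_∈_; lose; find)
open import Data.List.Membership.Propositional.Properties using (∈-∃++; ∈-++⁺ˡ; ∈-++⁺ʳ; ∈-++⁻; ∈-map⁺; ∈-map⁻)
open import Data.List.Membership.Propositional.Properties.WithK using (unique∧set⇒bag)
open import Data.List.Properties using (∷-injectiveˡ; ∷-injectiveʳ; ++-assoc; ++-identityʳ; map-++)
open import Data.List.Relation.Binary.BagAndSetEquality using (∼bag⇒↭)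
open import Data.List.Relation.Binary.Permutation.Propositional using (_↭_; refl; prep; swap; ↭-sym; ↭-trans; ↭-reflexive) renaming (trans to ↭-step)
open import Data.List.Relation.Binary.Permutation.Propositional.Properties using (∈-resp-↭; All-resp-↭; Any-resp-↭; ++⁺; ++⁺ˡ; ++⁺ʳ; ++-comm; shift; shifts; drop-∷; ↭-length; ↭-empty-inv)
open import Data.List.Relation.Binary.Pointwise using (Pointwise; []; _∷_; Pointwise-≡⇒≡)
open import Data.List.Relation.Unary.All using (All; []; _∷_)
open import Data.List.Relation.Unary.AllPairs using ([]; _∷_)
open import Data.List.Relation.Unary.Any using (Any; here; there)
open import Data.List.Relation.Unary.Unique.Propositional using (Unique)
open import Data.Nat using (_≟_; _<?_; ℕ; zero; suc; _+_; _∸_; _≤_; _<_; _>_; z≤n; s≤s)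
open import Data.Nat.Induction using (<-wellFounded)
open import Data.Product using (Σ; ∃; ∃₂; _×_; _,_; proj₁; proj₂)
open import Data.Sum using (_⊎_; inj₁; inj₂; [_,_]′)
open import Data.Unit using (⊤; tt)
open import Data.Vec using (Vec; []; _∷_; lookup; _[_]≔_)
open import Defs
open import Function using (flip; _∘_; id)
open import Function.Bundles using (mk⇔)
open import Induction.WellFounded using (WellFounded; Acc; acc; wf⇒asym)
open import Level using (Level; 0ℓ)
open import Relation.Binary.Construct.Closure.Equivalence using (EqClosure)
open import Relation.Binary.Construct.Closure.ReflexiveTransitive using (Star; ε; _◅_; _◅◅_)
open import Relation.Binary.Construct.Closure.Symmetric using (SymClosure; fwd; bwd)
open import Relation.Binary.Construct.Closure.Transitive using (TransClosure)
open import Relation.Binary.PropositionalEquality using (isEquivalence; _≡_; _≢_; refl; sym; trans; cong; cong₂; subst; subst₂)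
open import Relation.Binary.Structures using (IsEquivalence)
open import Relation.Nullary using (¬_; Dec; yes; no; contradiction)
import Data.List.Relation.Binary.Permutation.Propositional.Properties as PermP
import Data.List.Relation.Binary.Pointwise as PW
import Data.List.Relation.Unary.All as All′
import Data.List.Relation.Unary.All.Properties as AllP
import Data.List.Relation.Unary.Any as Any′
import Data.List.Relation.Unary.Any.Properties as AnyP
import Data.List.Relation.Unary.Unique.Propositional.Properties as UniqueP
import Data.Nat.Properties as ℕₚ
import Data.Vec.Properties as VecP
import Data.Vec.Relation.Binary.Pointwise.Inductive as VPW
import Relation.Binary.Construct.Closure.Equivalence as EqC
import Relation.Binary.Construct.Closure.ReflexiveTransitive as St
import Relation.Binary.Construct.Closure.Transitive as TC
import Relation.Binary.Construct.On as On

-- Multiset extensions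

pointwise-↭ : ∀ {A B : Set} {R : A → B → Set} {xs ys zs} → Pointwise R xs ys → ys ↭ zs →
  ∃ λ ws → xs ↭ ws × Pointwise R ws zs
pointwise-↭ pw refl = _ , refl , pw
pointwise-↭ (r ∷ pw) (prep y p) with pointwise-↭ pw p
... | ws , q , pw′ = _ , prep _ q , r ∷ pw′
pointwise-↭ (r ∷ s ∷ pw) (swap y z p) with pointwise-↭ pw p
... | ws , q , pw′ = _ , swap _ _ q , s ∷ r ∷ pw′
pointwise-↭ pw (↭-step p p′) with pointwise-↭ pw p
... | ws , q , pw′ with pointwise-↭ pw′ p′
... | ws′ , q′ , pw″ = ws′ , ↭-step q q′ , pw″

↭-pointwise : ∀ {A B : Set} {R : A → B → Set} {xs ys zs} → xs ↭ ys → Pointwise R xs zs →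
  ∃ λ ws → Pointwise R ys ws × zs ↭ ws
↭-pointwise p pw with pointwise-↭ (PW.symmetric {S = flip _} (λ r → r) pw) p
... | ws , q , pw′ = ws , PW.symmetric (λ r → r) pw′ , q

↭-∷-++ : ∀ {A : Set} {x : A} {M} Z X → x ∷ M ↭ Z ++ X →
  (∃ λ Z′ → Z ↭ x ∷ Z′ × M ↭ Z′ ++ X) ⊎ (∃ λ X′ → X ↭ x ∷ X′ × M ↭ Z ++ X′)
↭-∷-++ {x = x} {M} Z X p with ∈-++⁻ Z (∈-resp-↭ p (here refl))
... | inj₁ x∈Z with ∈-∃++ x∈Z
...   | Z₁ , Z₂ , refl = inj₁ (Z₁ ++ Z₂ , shift x Z₁ Z₂ ,
        drop-∷ (↭-trans p (++⁺ʳ X (shift x Z₁ Z₂))))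
↭-∷-++ {x = x} {M} Z X p | inj₂ x∈X with ∈-∃++ x∈X
...   | X₁ , X₂ , refl = inj₂ (X₁ ++ X₂ , shift x X₁ X₂ ,
        drop-∷ (↭-trans p (↭-trans (++⁺ˡ Z (shift x X₁ X₂)) (shift x Z (X₁ ++ X₂)))))

All-⊎-partition : ∀ {A : Set} {P Q : A → Set} {xs} → All (λ x → P x ⊎ Q x) xs →
  ∃₂ λ ys zs → xs ↭ ys ++ zs × All P ys × All Q zs
All-⊎-partition [] = [] , [] , refl , [] , []
All-⊎-partition {xs = x ∷ _} (pq ∷ pqs) with All-⊎-partition pqs | pq
... | ys , zs , e , ps , qs | inj₁ p = x ∷ ys , zs , prep x e , p ∷ ps , qs
... | ys , zs , e , ps , qs | inj₂ q =
      ys , x ∷ zs , ↭-trans (prep x e) (↭-sym (shift x ys zs)) , ps , q ∷ qs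

MEq-≡⇒↭ : ∀ {A : Set} {M N : List A} → MEq _≡_ M N → M ↭ N
MEq-≡⇒↭ (zs , p , pw) with Pointwise-≡⇒≡ pw
... | refl = p

module MEqProperties {A : Set} {_≈_ : A → A → Set} (≈-equiv : IsEquivalence _≈_) where
  private module E = IsEquivalence ≈-equiv

  _≋_ : List A → List A → Set
  _≋_ = MEq _≈_

  ↭⇒≋ : ∀ {M N} → M ↭ N → M ≋ N
  ↭⇒≋ p = _ , p , PW.refl E.refl

  ≋-refl : ∀ {M} → M ≋ M
  ≋-refl = ↭⇒≋ refl

  ≋-sym : ∀ {M N} → M ≋ N → N ≋ M
  ≋-sym (zs , p , pw) with pointwise-↭ (PW.symmetric E.sym pw) (↭-sym p)
  ... | ws , q , pw′ = ws , q , pw′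

  ≋-trans : ∀ {M N K} → M ≋ N → N ≋ K → M ≋ K
  ≋-trans (zs , p , pw) (zs′ , p′ , pw′) with pointwise-↭ pw p′
  ... | ws , q , pw″ = ws , ↭-trans p q , PW.transitive E.trans pw″ pw′

  ≋-∷ : ∀ {x y M N} → x ≈ y → M ≋ N → (x ∷ M) ≋ (y ∷ N)
  ≋-∷ e (zs , p , pw) = _ , prep _ p , e ∷ pw

  ≋-uncons : ∀ {x M N} → (x ∷ M) ≋ N → ∃₂ λ x′ M′ → x ≈ x′ × M ≋ M′ × (x′ ∷ M′) ↭ N
  ≋-uncons e with ≋-sym e
  ... | x′ ∷ M′ , p , x′≈x ∷ pw = x′ , M′ , E.sym x′≈x , ≋-sym (M′ , refl , pw) , ↭-sym p

  ≋-∈ : ∀ {M N x} → M ≋ N → x ∈ M → ∃ λ y → y ∈ N × x ≈ y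
  ≋-∈ (zs , p , pw) x∈M = match pw (∈-resp-↭ p x∈M)
    where
    match : ∀ {xs ys x} → Pointwise _≈_ xs ys → x ∈ xs → ∃ λ y → y ∈ ys × x ≈ y
    match (e ∷ _) (here refl) = _ , here refl , e
    match (_ ∷ pw) (there i) with match pw i
    ... | y , j , e = y , there j , e

module MulExtProperties {A : Set} {_≈_ _≻_ : A → A → Set} (≈-equiv : IsEquivalence _≈_) where
  open MEqProperties ≈-equiv
  private module E = IsEquivalence ≈-equiv

  _≻≻_ : List A → List A → Set
  _≻≻_ = MulExt _≈_ _≻_

  ≻≻-respˡ : ∀ {M M′ N} → M ≋ M′ → M ≻≻ N → M′ ≻≻ N
  ≻≻-respˡ e (Z , X , Y , eM , eN , X≢[] , dom) = Z , X , Y , ≋-trans (≋-sym e) eM , eN , X≢[] , dom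

  ≻≻-respʳ : ∀ {M N N′} → N ≋ N′ → M ≻≻ N → M ≻≻ N′
  ≻≻-respʳ e (Z , X , Y , eM , eN , X≢[] , dom) = Z , X , Y , eM , ≋-trans (≋-sym e) eN , X≢[] , dom

  ≻≻-dominate : ∀ {M N x} → x ∈ M → All (λ y → Any (_≻ y) M) N → M ≻≻ N
  ≻≻-dominate x∈M dom = [] , _ , _ , ≋-refl , ≋-refl , (λ { refl → contradiction x∈M λ () }) , dom

  module _ (resp : ∀ {x x′ y} → x ≈ x′ → x′ ≻ y → x ≻ y) (wf : WellFounded (flip _≻_)) where
    private
      Acc≻≻ = Acc (flip _≻≻_)

      Acc-resp : ∀ {M N} → M ≋ N → Acc≻≻ M → Acc≻≻ N
      Acc-resp e (acc rs) = acc λ gt → rs (≻≻-respˡ (≋-sym e) gt)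

      module _ {x : A} (ih : ∀ {y} → x ≻ y → ∀ {M} → Acc≻≻ M → Acc≻≻ (y ∷ M)) where

        Acc-++ : ∀ {Y M} → All (x ≻_) Y → Acc≻≻ M → Acc≻≻ (Y ++ M)
        Acc-++ [] a = a
        Acc-++ (p ∷ ps) a = ih p (Acc-++ ps a)

        Acc-∷ : ∀ {M} → Acc≻≻ M → Acc≻≻ (x ∷ M)
        -- If the copy of `x` survives in the common part `Z`, the rest has already dropped below
        -- `M` and `rs` applies. If it is consumed, the new elements split into those below `x`,
        -- which the outer induction on `x` adds one by one, and those below `X′`, which together
        -- with `Z` give a multiset at most `M`.
        Acc-below : ∀ {M N} → (∀ {K} → M ≻≻ K → Acc≻≻ K) → (x ∷ M) ≻≻ N → Acc≻≻ N

        Acc-∷ (acc rs) = acc λ gt → Acc-below rs gt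

        Acc-below {M} rs (Z , X , Y , eM , eN , X≢[] , dom) with ≋-uncons eM
        ... | x′ , M′ , x≈x′ , M≋M′ , p with ↭-∷-++ Z X p
        ... | inj₁ (Z′ , Z↭ , M′↭) =
              Acc-resp (≋-trans (≋-∷ x≈x′ ≋-refl) (≋-trans (↭⇒≋ (↭-sym (++⁺ʳ Y Z↭))) (≋-sym eN)))
                (Acc-∷ (rs (Z′ , X , Y , ≋-trans M≋M′ (↭⇒≋ M′↭) , ≋-refl , X≢[] , dom)))
        ... | inj₂ (X′ , X↭ , M′↭) with All-⊎-partition (All′.map split dom)
          where
          split : ∀ {y} → Any (_≻ y) X → x ≻ y ⊎ Any (_≻ y) X′
          split a with Any-resp-↭ X↭ a
          ... | here g = inj₁ (resp x≈x′ g)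
          ... | there g = inj₂ g
        ...   | Y₁ , Y₂ , Y↭ , d₁ , d₂ =
                Acc-resp (≋-trans (↭⇒≋ (↭-trans (shifts Y₁ Z) (++⁺ˡ Z (↭-sym Y↭)))) (≋-sym eN))
                  (Acc-++ d₁ (rest X′ Y₂ (≋-trans M≋M′ (↭⇒≋ M′↭)) d₂))
          where
          rest : ∀ X′ Y₂ → M ≋ (Z ++ X′) → All (λ y → Any (_≻ y) X′) Y₂ → Acc≻≻ (Z ++ Y₂)
          -- Only `x` was consumed, so what remains is `M` itself.
          rest [] [] e d = Acc-resp e (acc rs)
          rest [] (_ ∷ _) e (() ∷ _)
          rest (w ∷ X′) Y₂ e d = rs (Z , w ∷ X′ , Y₂ , e , ≋-refl , (λ ()) , d)

      Acc-∷′ : ∀ {x} → Acc (flip _≻_) x → ∀ {M} → Acc≻≻ M → Acc≻≻ (x ∷ M)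
      Acc-∷′ (acc rx) = Acc-∷ (λ g → Acc-∷′ (rx g))

    ≻≻-wellFounded : WellFounded (flip _≻≻_)
    ≻≻-wellFounded [] = acc λ { (Z , X , Y , eM , _ , X≢[] , _) → ⊥-elim (empty Z X eM X≢[]) }
      where
      empty : ∀ Z X → [] ≋ (Z ++ X) → X ≢ [] → ⊥
      empty [] [] _ ne = ne refl
      empty [] (x ∷ X) (zs , p , pw) _ with ↭-empty-inv (↭-sym p) | pw
      ... | refl | ()
      empty (z ∷ Z) X (zs , p , pw) _ with ↭-empty-inv (↭-sym p) | pw
      ... | refl | ()
    ≻≻-wellFounded (x ∷ M) = Acc-∷′ (wf x) (≻≻-wellFounded M)

-- The delicate case removes `k` on the left and creates it again on the right. By irreflexivity the
-- new `k` is dominated by some entry of `X′`, and by transitivity that entry takes over everything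
-- that the removed `k` dominated.
MulExt-cancel-∷ : ∀ {A : Set} {_≻_ : A → A → Set} → (∀ {x} → ¬ (x ≻ x)) →
  (∀ {x y z} → x ≻ y → y ≻ z → x ≻ z) →
  ∀ {k M N} → MulExt _≡_ _≻_ (k ∷ M) (k ∷ N) → MulExt _≡_ _≻_ M N
MulExt-cancel-∷ {A} {_≻_} irr tr {k} {M} {N} (Z , X , Y , eM , eN , X≢[] , dom)
  with ↭-∷-++ Z X (MEq-≡⇒↭ eM) | ↭-∷-++ Z Y (MEq-≡⇒↭ eN)
... | inj₁ (Z′ , Z↭ , M↭) | _ = Z′ , X , Y , ↭⇒≋ M↭ ,
        ↭⇒≋ (drop-∷ (↭-trans (MEq-≡⇒↭ eN) (++⁺ʳ Y Z↭))) , X≢[] , dom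
  where open MEqProperties {A} {_≡_} isEquivalence
... | inj₂ _ | inj₁ (Z′ , Z↭ , N↭) = Z′ , X , Y ,
        ↭⇒≋ (drop-∷ (↭-trans (MEq-≡⇒↭ eM) (++⁺ʳ X Z↭))) , ↭⇒≋ N↭ , X≢[] , dom
  where open MEqProperties {A} {_≡_} isEquivalence
... | inj₂ (X′ , X↭ , M↭) | inj₂ (Y′ , Y↭ , N↭) with All-resp-↭ Y↭ dom
...   | k-dom ∷ dom′ = Z , X′ , Y′ , ↭⇒≋ M↭ , ↭⇒≋ N↭ , nonempty above-k , All′.map improve dom′
  where
  open MEqProperties {A} {_≡_} isEquivalence
  above-k : Any (_≻ k) X′
  above-k with Any-resp-↭ X↭ k-dom
  ... | here g = ⊥-elim (irr g)
  ... | there g = g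
  nonempty : ∀ {P : A → Set} {xs} → Any P xs → xs ≢ []
  nonempty (here _) ()
  nonempty (there _) ()
  improve : ∀ {y} → Any (_≻ y) X → Any (_≻ y) X′
  improve a with Any-resp-↭ X↭ a
  ... | here g = Any′.map (λ h → tr h g) above-k
  ... | there g = g

MulExt-cancel-++ : ∀ {A : Set} {_≻_ : A → A → Set} → (∀ {x} → ¬ (x ≻ x)) →
  (∀ {x y z} → x ≻ y → y ≻ z → x ≻ z) →
  ∀ K {M N} → MulExt _≡_ _≻_ (K ++ M) (K ++ N) → MulExt _≡_ _≻_ M N
MulExt-cancel-++ irr tr [] g = g
MulExt-cancel-++ irr tr (k ∷ K) g = MulExt-cancel-++ irr tr K (MulExt-cancel-∷ irr tr g)

MulExt-∷ : ∀ {A : Set} {_≻_ : A → A → Set} k {M N} →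
  MulExt _≡_ _≻_ M N → MulExt _≡_ _≻_ (k ∷ M) (k ∷ N)
MulExt-∷ k (Z , X , Y , (_ , p , pw) , (_ , p′ , pw′) , ne , dom) =
  k ∷ Z , X , Y , (_ , prep k p , refl ∷ pw) , (_ , prep k p′ , refl ∷ pw′) , ne , dom

↭-cancel-++ : ∀ {A : Set} (K : List A) {M N} → K ++ M ↭ K ++ N → M ↭ N
↭-cancel-++ [] p = p
↭-cancel-++ (k ∷ K) p = ↭-cancel-++ K (drop-∷ p)

-- Terms, positions and replacement

module _ {sig : Signature} where
  open Signature sig

  lookup-sub : ∀ {n} (ts : Vec (Term sig) n) i σ → lookup (ts ⟨ σ ⟩*) i ≡ lookup ts i ⟨ σ ⟩
  lookup-sub (t ∷ ts) zero σ = refl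
  lookup-sub (t ∷ ts) (suc i) σ = lookup-sub ts i σ

  mutual
    sub-∘ : ∀ (t : Term sig) σ τ → t ⟨ σ ⟩ ⟨ τ ⟩ ≡ t ⟨ (λ x → σ x ⟨ τ ⟩) ⟩
    sub-∘ (var x) σ τ = refl
    sub-∘ (fun f ts) σ τ = cong (fun f) (sub-∘* ts σ τ)

    sub-∘* : ∀ {n} (ts : Vec (Term sig) n) σ τ → ts ⟨ σ ⟩* ⟨ τ ⟩* ≡ ts ⟨ (λ x → σ x ⟨ τ ⟩) ⟩*
    sub-∘* [] σ τ = refl
    sub-∘* (t ∷ ts) σ τ = cong₂ _∷_ (sub-∘ t σ τ) (sub-∘* ts σ τ)

  mutual
    sub-cong : ∀ (t : Term sig) {σ τ} → (∀ x → Occurs x t → σ x ≡ τ x) → t ⟨ σ ⟩ ≡ t ⟨ τ ⟩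
    sub-cong (var x) e = e x ([] , here)
    sub-cong (fun f ts) e = cong (fun f) (sub-cong* ts λ { i x (p , a) → e x (_ , there i a) })

    sub-cong* : ∀ {n} (ts : Vec (Term sig) n) {σ τ} →
      (∀ i x → Occurs x (lookup ts i) → σ x ≡ τ x) → ts ⟨ σ ⟩* ≡ ts ⟨ τ ⟩*
    sub-cong* [] e = refl
    sub-cong* (t ∷ ts) e = cong₂ _∷_ (sub-cong t (e zero)) (sub-cong* ts λ i → e (suc i))

  mutual
    sub-id : ∀ (t : Term sig) → t ⟨ var ⟩ ≡ t
    sub-id (var x) = refl
    sub-id (fun f ts) = cong (fun f) (sub-id* ts)

    sub-id* : ∀ {n} (ts : Vec (Term sig) n) → ts ⟨ var ⟩* ≡ ts
    sub-id* [] = refl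
    sub-id* (t ∷ ts) = cong₂ _∷_ (sub-id t) (sub-id* ts)

  mutual
    size : Term sig → ℕ
    size (var x) = 1
    size (fun f ts) = suc (size* ts)

    size* : ∀ {n} → Vec (Term sig) n → ℕ
    size* [] = 0
    size* (t ∷ ts) = size t + size* ts

  size-lookup : ∀ {n} (ts : Vec (Term sig) n) i → size (lookup ts i) ≤ size* ts
  size-lookup (t ∷ ts) zero = ℕₚ.m≤m+n _ _
  size-lookup (t ∷ ts) (suc i) = ℕₚ.≤-trans (size-lookup ts i) (ℕₚ.m≤n+m _ _)

  size-At : ∀ {t : Term sig} {p u} → At t p u → size u ≤ size t
  size-At here = ℕₚ.≤-refl
  size-At (there {ts = ts} i a) = ℕₚ.≤-trans (size-At a) (ℕₚ.≤-trans (size-lookup ts i) (ℕₚ.n≤1+n _))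

  size-At-< : ∀ {t : Term sig} {p u} → p ≢ [] → At t p u → size u < size t
  size-At-< ne here = ⊥-elim (ne refl)
  size-At-< _ (there {ts = ts} i a) = s≤s (ℕₚ.≤-trans (size-At a) (size-lookup ts i))

  At-self : ∀ {t : Term sig} {p} → At t p t → p ≡ []
  At-self {p = []} a = refl
  At-self {p = _ ∷ _} a = ⊥-elim (ℕₚ.<-irrefl refl (size-At-< (λ ()) a))

  At-++ : ∀ {t : Term sig} {p u q v} → At t p u → At u q v → At t (p ++ q) v
  At-++ here b = b
  At-++ (there i a) b = there i (At-++ a b)

  At-sub : ∀ {t : Term sig} {p u} σ → At t p u → At (t ⟨ σ ⟩) p (u ⟨ σ ⟩)
  At-sub σ here = here
  At-sub σ (there {ts = ts} i a) =
    there i (subst (λ w → At w _ _) (sym (lookup-sub ts i σ)) (At-sub σ a))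

  At-sub⁻ : ∀ (t : Term sig) {σ p u} → At (t ⟨ σ ⟩) p u →
    (∃ λ w → At t p w × ¬ IsVar w × w ⟨ σ ⟩ ≡ u) ⊎ (∃₂ λ x q → Occurs x t × At (σ x) q u)
  At-sub⁻ (var x) a = inj₂ (x , _ , ([] , here) , a)
  At-sub⁻ (fun f ts) here = inj₁ (_ , here , (λ { (_ , ()) }) , refl)
  At-sub⁻ (fun f ts) {σ} (there i a)
    with At-sub⁻ (lookup ts i) (subst (λ w → At w _ _) (lookup-sub ts i σ) a)
  ... | inj₁ (w , b , nv , e) = inj₁ (w , there i b , nv , e)
  ... | inj₂ (x , q , (r , o) , b) = inj₂ (x , q , (_ , there i o) , b)

  -- Positions contain `toℕ i`, on which matching cannot unify. Equality of positions is therefore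
  -- passed as an equation, and injectivity of `toℕ` is applied by hand; `compare` uses the same
  -- device.
  At-functional : ∀ {t : Term sig} {p q u v} → p ≡ q → At t p u → At t q v → u ≡ v
  At-functional e here here = refl
  At-functional () here (there i b)
  At-functional () (there i a) here
  At-functional {p = _ ∷ p} {q = _ ∷ q} e (there i a) (there j b)
    with toℕ-injective (∷-injectiveˡ e)
  ... | refl = At-functional (∷-injectiveʳ e) a b

  Ground-At : ∀ {t : Term sig} {p u} → Ground t → At t p u → Ground u
  Ground-At g a x (q , b) = g x (_ , At-++ a b)

  ground-sub : ∀ (t : Term sig) σ → Ground t → t ⟨ σ ⟩ ≡ t
  ground-sub t σ g = trans (sub-cong t (λ x o → ⊥-elim (g x o))) (sub-id t)

  Repl-exists : ∀ {t : Term sig} {p u} → At t p u → ∀ v → ∃ λ t′ → Repl t p v t′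
  Repl-exists here v = v , here
  Repl-exists (there i a) v with Repl-exists a v
  ... | s , r = _ , there i r

  Repl-refl : ∀ {t : Term sig} {p u} → At t p u → Repl t p u t
  Repl-refl here = here
  Repl-refl {t = fun f ts} (there i a) =
    subst (λ ts′ → Repl (fun f ts) _ _ (fun f ts′)) (VecP.[]≔-lookup ts i) (there i (Repl-refl a))

  Repl-At : ∀ {t : Term sig} {p v t′} → Repl t p v t′ → At t′ p v
  Repl-At here = here
  Repl-At (there {ts = ts} {s' = s} i r) =
    there i (subst (λ w → At w _ _) (sym (VecP.lookup∘update i ts s)) (Repl-At r))

  Repl-functional : ∀ {t : Term sig} {p q v t₁ t₂} → p ≡ q → Repl t p v t₁ → Repl t q v t₂ → t₁ ≡ t₂
  Repl-functional e here here = refl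
  Repl-functional () here (there i b)
  Repl-functional () (there i a) here
  Repl-functional {p = _ ∷ p} {q = _ ∷ q} e (there i a) (there j b)
    with toℕ-injective (∷-injectiveˡ e)
  ... | refl with Repl-functional (∷-injectiveʳ e) a b
  ... | refl = refl

  Ground-args : ∀ {f} {ts : Vec (Term sig) _} → (∀ i → Ground (lookup ts i)) → Ground (fun f ts)
  Ground-args g x (_ , there i a) = g i x (_ , a)

  Ground-Repl : ∀ {t : Term sig} {p v t′} → Ground t → Ground v → Repl t p v t′ → Ground t′
  Ground-Repl gt gv here = gv
  Ground-Repl {t = fun f ts} gt gv (there {s' = s} i r) = Ground-args arg
    where
    arg : ∀ j → Ground (lookup (ts [ i ]≔ s) j)
    arg j with j ≟ᶠ i
    ... | yes refl = subst Ground (sym (VecP.lookup∘update i ts s)) (Ground-Repl (Ground-At gt (there i here)) gv r)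
    ... | no j≢i = subst Ground (sym (VecP.lookup∘update′ j≢i ts s)) (Ground-At gt (there j here))

  -- The case distinction behind local confluence: nested positions carry the occurrence of one
  -- redex inside the other, parallel positions carry the common reduct.
  data Overlap (t : Term sig) (p q : List ℕ) (u v t₁ u′ v′ t₂ : Term sig) : Set where
    below : ∀ r → q ≡ p ++ r → At u r u′ → Overlap t p q u v t₁ u′ v′ t₂
    above : ∀ r → p ≡ q ++ r → At u′ r u → Overlap t p q u v t₁ u′ v′ t₂
    parallel : ∀ t₃ → At t₁ q u′ → Repl t₁ q v′ t₃ → At t₂ p u → Repl t₂ p v t₃ →
      Overlap t p q u v t₁ u′ v′ t₂

  compare : ∀ {t : Term sig} {p q u v t₁ u′ v′ t₂} → At t p u → Repl t p v t₁ → At t q u′ → Repl t q v′ t₂ →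
    Overlap t p q u v t₁ u′ v′ t₂
  compare here here b rb = below _ refl b
  compare a@(there i _) ra here here = above _ refl a
  compare {fun f ts} {_ ∷ p} {_ ∷ q} {u} {v} {t₁} {u′} {v′} {t₂} (there i a) ra (there j b) rb = go i j a b ra rb refl refl
    where
    go : ∀ {m n} i j → At (lookup ts i) p u → At (lookup ts j) q u′ →
         Repl (fun f ts) (m ∷ p) v t₁ → Repl (fun f ts) (n ∷ q) v′ t₂ →
         m ≡ toℕ i → n ≡ toℕ j →
         Overlap (fun f ts) (toℕ i ∷ p) (toℕ j ∷ q) u v t₁ u′ v′ t₂
    go i j a b (there {s' = s₁} i′ ra) (there {s' = s₂} j′ rb) ei ej
      with toℕ-injective ei | toℕ-injective ej
    ... | refl | refl with i ≟ᶠ j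
    ...   | no i≢j = parallel (fun f ((ts [ i ]≔ s₁) [ j ]≔ s₂))
              (there j (subst (λ w → At w _ _) (sym l₁) b))
              (there j (subst (λ w → Repl w _ _ _) (sym l₁) rb))
              (there i (subst (λ w → At w _ _) (sym l₂) a))
              (subst (λ ws → Repl _ _ _ (fun f ws)) (VecP.[]≔-commutes ts j i (λ e → i≢j (sym e)))
                (there i (subst (λ w → Repl w _ _ _) (sym l₂) ra)))
          where
          l₁ = VecP.lookup∘update′ (λ e → i≢j (sym e)) ts s₁
          l₂ = VecP.lookup∘update′ i≢j ts s₂
    ...   | yes refl with compare a ra b rb
    ...     | below r e c = below r (cong (toℕ i ∷_) e) c
    ...     | above r e c = above r (cong (toℕ i ∷_) e) c
    ...     | parallel s₃ a₁ r₁ a₂ r₂ = parallel (fun f (ts [ i ]≔ s₃))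
              (there i (subst (λ w → At w _ _) (sym (VecP.lookup∘update i ts s₁)) a₁))
              (subst (λ ws → Repl _ _ _ (fun f ws)) (VecP.[]≔-idempotent ts i)
                (there i (subst (λ w → Repl w _ _ _) (sym (VecP.lookup∘update i ts s₁)) r₁)))
              (there i (subst (λ w → At w _ _) (sym (VecP.lookup∘update i ts s₂)) a₂))
              (subst (λ ws → Repl _ _ _ (fun f ws)) (VecP.[]≔-idempotent ts i)
                (there i (subst (λ w → Repl w _ _ _) (sym (VecP.lookup∘update i ts s₂)) r₂)))

-- The subterm property on ground terms

module GroundOrder {sig : Signature} (ord : ReductionOrdering sig) where
  open ReductionOrdering ord renaming (trans to ≻-trans; irrefl to ≻-irrefl)

  _≽_ : Term sig → Term sig → Set
  t ≽ u = t ≡ u ⊎ t ≻ u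

  ≽-≻ : ∀ {s t u} → s ≽ t → t ≻ u → s ≻ u
  ≽-≻ (inj₁ refl) q = q
  ≽-≻ (inj₂ p) q = ≻-trans p q

  ≻-≽ : ∀ {s t u} → s ≻ t → t ≽ u → s ≻ u
  ≻-≽ p (inj₁ refl) = p
  ≻-≽ p (inj₂ q) = ≻-trans p q

  -- If `u` exceeded a term `t` containing it, replacing `u` by `t` inside `t` would give a smaller
  -- `t′` that contains `t`, and so on: an infinite descent.
  ¬subterm-≻ : ∀ {t : Term sig} {p u} → At t p u → ¬ (u ≻ t)
  ¬subterm-≻ {u = u} = go (wf u)
    where
    go : ∀ {t : Term sig} {p u} → Acc (flip _≻_) u → At t p u → ¬ (u ≻ t)
    go {t} (acc rs) a g = go (rs g) (Repl-At r) (compat g (Repl-refl a) r)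
      where r = proj₂ (Repl-exists a t)

  subterm-≽ : ∀ {t : Term sig} {p u} → Ground t → At t p u → t ≽ u
  subterm-≽ gt a with total gt (Ground-At gt a)
  ... | inj₁ g = inj₂ g
  ... | inj₂ (inj₁ e) = inj₁ e
  ... | inj₂ (inj₂ l) = ⊥-elim (¬subterm-≻ a l)

  subterm-≻ : ∀ {t : Term sig} {p u} → p ≢ [] → Ground t → At t p u → t ≻ u
  subterm-≻ ne gt a with subterm-≽ gt a
  ... | inj₁ refl = ⊥-elim (ne (At-self a))
  ... | inj₂ g = g

-- Unification

module _ {sig : Signature} where
  open Signature sig

  Eqns : Set
  Eqns = List (Term sig × Term sig)

  Unifies : Subst sig → Eqns → Set
  Unifies τ = All λ { (a , b) → a ⟨ τ ⟩ ≡ b ⟨ τ ⟩ }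

  instSize : Subst sig → Eqns → ℕ
  instSize θ [] = 0
  instSize θ ((a , _) ∷ E) = size (a ⟨ θ ⟩) + instSize θ E

  -- Substituting τ into σ gives τ back: most general and (for τ = σ) idempotent at once.
  Absorbs : Subst sig → Subst sig → Set
  Absorbs σ τ = ∀ x → (σ x) ⟨ τ ⟩ ≡ τ x

  MGU : Eqns → Set
  MGU E = ∃ λ σ → Unifies σ E × (∀ τ → Unifies τ E → Absorbs σ τ)

  absorb : ∀ (t : Term sig) {σ τ} → Absorbs σ τ → t ⟨ σ ⟩ ⟨ τ ⟩ ≡ t ⟨ τ ⟩
  absorb t {σ} {τ} ab = trans (sub-∘ t σ τ) (sub-cong t λ x _ → ab x)

  ↦-hit : ∀ (θ : Subst sig) x w → (θ [ x ↦ w ]) x ≡ w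
  ↦-hit θ x w with x ≟ x
  ... | yes _ = refl
  ... | no ne = ⊥-elim (ne refl)

  ↦-miss : ∀ (θ : Subst sig) {x y} w → y ≢ x → (θ [ x ↦ w ]) y ≡ θ y
  ↦-miss θ {x} {y} w ne with y ≟ x
  ... | yes e = ⊥-elim (ne e)
  ... | no _ = refl

  ↦-absorbs : ∀ {x b} {τ : Subst sig} → τ x ≡ b ⟨ τ ⟩ → Absorbs (var [ x ↦ b ]) τ
  ↦-absorbs {x} e y with y ≟ x
  ... | yes refl = sym e
  ... | no _ = refl

  subEqns : Subst sig → Eqns → Eqns
  subEqns s = map λ { (a , b) → a ⟨ s ⟩ , b ⟨ s ⟩ }

  unifies-sub : ∀ {s τ} E → Absorbs s τ → Unifies τ E → Unifies τ (subEqns s E)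
  unifies-sub [] ab [] = []
  unifies-sub ((a , b) ∷ E) ab (u ∷ us) =
    trans (absorb a ab) (trans u (sym (absorb b ab))) ∷ unifies-sub E ab us

  instSize-sub : ∀ {s τ} E → Absorbs s τ → instSize τ (subEqns s E) ≡ instSize τ E
  instSize-sub [] ab = refl
  instSize-sub ((a , b) ∷ E) ab = cong₂ _+_ (cong size (absorb a ab)) (instSize-sub E ab)

  unifies-∘ : ∀ {s σ} E → Unifies σ (subEqns s E) → Unifies (λ y → s y ⟨ σ ⟩) E
  unifies-∘ [] [] = []
  unifies-∘ {s} {σ} ((a , b) ∷ E) (u ∷ us) =
    trans (sym (sub-∘ a s σ)) (trans u (sub-∘ b s σ)) ∷ unifies-∘ E us

  zipEqns : ∀ {n} → Vec (Term sig) n → Vec (Term sig) n → Eqns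
  zipEqns [] [] = []
  zipEqns (a ∷ as) (b ∷ bs) = (a , b) ∷ zipEqns as bs

  unifies-zip : ∀ {n τ} (as bs : Vec (Term sig) n) {E} → as ⟨ τ ⟩* ≡ bs ⟨ τ ⟩* → Unifies τ E →
    Unifies τ (zipEqns as bs ++ E)
  unifies-zip [] [] _ us = us
  unifies-zip (a ∷ as) (b ∷ bs) e us = VecP.∷-injectiveˡ e ∷ unifies-zip as bs (VecP.∷-injectiveʳ e) us

  unifies-unzip : ∀ {n τ} (as bs : Vec (Term sig) n) {E} → Unifies τ (zipEqns as bs ++ E) →
    as ⟨ τ ⟩* ≡ bs ⟨ τ ⟩* × Unifies τ E
  unifies-unzip [] [] us = refl , us
  unifies-unzip (a ∷ as) (b ∷ bs) (u ∷ us) with unifies-unzip as bs us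
  ... | e , us′ = cong₂ _∷_ u e , us′

  instSize-zip : ∀ {n τ} (as bs : Vec (Term sig) n) E →
    instSize τ (zipEqns as bs ++ E) ≡ size* (as ⟨ τ ⟩*) + instSize τ E
  instSize-zip [] [] E = refl
  instSize-zip {τ = τ} (a ∷ as) (b ∷ bs) E =
    trans (cong (size (a ⟨ τ ⟩) +_) (instSize-zip as bs E)) (sym (ℕₚ.+-assoc (size (a ⟨ τ ⟩)) _ _))

  fun-injective : ∀ {f g} {ts : Vec (Term sig) (arity f)} {ss} → fun f ts ≡ fun g ss →
    Σ (f ≡ g) λ e → subst (λ h → Vec (Term sig) (arity h)) e ts ≡ ss
  fun-injective refl = refl , refl

  -- The occurs check cannot fail when a unifier is known, since an instance would be as large as a
  -- proper superterm of it.
  no-occurs : ∀ {x} b {θ : Subst sig} → var x ≢ b → θ x ≡ b ⟨ θ ⟩ → ¬ Occurs x b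
  no-occurs b ne e ([] , here) = ne refl
  no-occurs b {θ} ne e (i ∷ p , a) =
    ℕₚ.<-irrefl (cong size e) (size-At-< (λ ()) (At-sub θ a))

  mgu-eliminate : ∀ {x b E} → ¬ Occurs x b → MGU (subEqns (var [ x ↦ b ]) E) →
    ∃ λ σ → σ x ≡ b ⟨ σ ⟩ × Unifies σ E × (∀ τ → τ x ≡ b ⟨ τ ⟩ → Unifies τ E → Absorbs σ τ)
  mgu-eliminate {x} {b} {E} x∉b (σ , u , mg) = σ′ ,
    trans (cong (_⟨ σ ⟩) (↦-hit var x b)) (trans (cong (_⟨ σ ⟩) (sym b-fixed)) (sub-∘ b s σ)) ,
    unifies-∘ E u ,
    λ τ e us y → trans (absorb (s y) (mg τ (unifies-sub E (↦-absorbs e) us))) (↦-absorbs e y)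
    where
    s = var [ x ↦ b ]
    σ′ = λ y → s y ⟨ σ ⟩
    b-fixed : b ⟨ s ⟩ ≡ b
    b-fixed = trans (sub-cong b λ y o → ↦-miss var b (λ { refl → x∉b o })) (sub-id b)

  size-pos : ∀ (t : Term sig) → 0 < size t
  size-pos (var x) = s≤s z≤n
  size-pos (fun f ts) = s≤s z≤n

  -- Because a unifier `θ` is given, clashes cannot arise, and the size of the left sides under `θ`
  -- bounds the run: eliminating a variable keeps the instances of the remaining equations,
  -- decomposition removes a root symbol, and a solved equation takes a positive amount with it. The
  -- bound `n` serves as fuel.
  mgu-eqns : ∀ n E θ → Unifies θ E → instSize θ E < n → MGU E
  mgu-eqns (suc n) [] θ us lt = var , [] , λ τ _ x → refl
  mgu-eqns (suc n) ((var x , var y) ∷ E) θ (u ∷ us) (s≤s lt) with x ≟ y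
  ... | yes refl with mgu-eqns n E θ us (ℕₚ.<-≤-trans (ℕₚ.m<n+m _ (size-pos (θ x))) lt)
  ...   | σ , v , mg = σ , refl ∷ v , λ { τ (_ ∷ w) → mg τ w }
  mgu-eqns (suc n) ((var x , var y) ∷ E) θ (u ∷ us) (s≤s lt) | no x≢y
    with mgu-eliminate (no-occurs (var y) (λ { refl → x≢y refl }) u)
           (mgu-eqns n (subEqns (var [ x ↦ var y ]) E) θ (unifies-sub E (↦-absorbs u) us)
             (subst (_< n) (sym (instSize-sub E (↦-absorbs u))) (ℕₚ.<-≤-trans (ℕₚ.m<n+m _ (size-pos (θ x))) lt)))
  ... | σ , e , v , mg = σ , e ∷ v , λ { τ (e ∷ w) → mg τ e w }
  mgu-eqns (suc n) ((var x , b@(fun g bs)) ∷ E) θ (u ∷ us) (s≤s lt)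
    with mgu-eliminate (no-occurs b (λ ()) u)
           (mgu-eqns n (subEqns (var [ x ↦ b ]) E) θ (unifies-sub E (↦-absorbs u) us)
             (subst (_< n) (sym (instSize-sub E (↦-absorbs u)))
               (ℕₚ.<-≤-trans (ℕₚ.m<n+m _ (subst (λ w → 0 < size w) (sym u) (s≤s z≤n))) lt)))
  ... | σ , e , v , mg = σ , e ∷ v , λ { τ (e ∷ w) → mg τ e w }
  mgu-eqns (suc n) ((b@(fun g bs) , var x) ∷ E) θ (u ∷ us) (s≤s lt)
    with mgu-eliminate (no-occurs b (λ ()) (sym u))
           (mgu-eqns n (subEqns (var [ x ↦ b ]) E) θ (unifies-sub E (↦-absorbs (sym u)) us)
             (subst (_< n) (sym (instSize-sub E (↦-absorbs (sym u))))
               (ℕₚ.<-≤-trans (ℕₚ.m<n+m _ (s≤s z≤n)) lt)))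
  ... | σ , e , v , mg = σ , sym e ∷ v , λ { τ (e ∷ w) → mg τ (sym e) w }
  mgu-eqns (suc n) ((fun f as , fun g bs) ∷ E) θ (u ∷ us) (s≤s lt) with fun-injective u
  ... | refl , e with mgu-eqns n (zipEqns as bs ++ E) θ (unifies-zip as bs e us)
                       (subst (_< n) (sym (instSize-zip as bs E)) lt)
  ...   | σ , v , mg with unifies-unzip as bs v
  ...     | e′ , v′ = σ , cong (fun f) e′ ∷ v′ , λ { τ (d ∷ w) → mg τ (unifies-zip as bs (args d) w) }
    where
    args : ∀ {ts ss : Vec (Term sig) (arity f)} → fun f ts ≡ fun f ss → ts ≡ ss
    args refl = refl

  mgu-exists : ∀ s t θ → s ⟨ θ ⟩ ≡ t ⟨ θ ⟩ → ∃ λ (σ : Subst sig) → IsMGU σ s t × Absorbs σ θ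
  mgu-exists s t θ e with mgu-eqns _ ((s , t) ∷ []) θ (e ∷ []) (ℕₚ.n<1+n _)
  ... | σ , (u ∷ []) , mg = σ ,
        (u , (λ τ e′ → τ , λ x → sym (mg τ (e′ ∷ []) x)) , mg σ (u ∷ [])) , mg θ (e ∷ [])

-- Rewriting

module _ {sig : Signature} where
  open Signature sig

  -- One argument moves at a time, so that derivations of the arguments can be chained into a
  -- derivation of the whole term.
  data VecLift (Q : Term sig → Term sig → Set) : ∀ {n} → Vec (Term sig) n → Vec (Term sig) n → Set where
    head : ∀ {n t t′} {ts : Vec (Term sig) n} → Q t t′ → VecLift Q (t ∷ ts) (t′ ∷ ts)
    tail : ∀ {n t} {ts ts′ : Vec (Term sig) n} → VecLift Q ts ts′ → VecLift Q (t ∷ ts) (t ∷ ts′)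

  Star-vec : ∀ {Q : Term sig → Term sig → Set} {n} {ts ts′ : Vec (Term sig) n} →
    VPW.Pointwise (Star Q) ts ts′ → Star (VecLift Q) ts ts′
  Star-vec VPW.[] = ε
  Star-vec (r VPW.∷ rs) = St.gmap (_∷ _) head r ◅◅ St.gmap (_ ∷_) tail (Star-vec rs)

  Step-vec : ∀ {R : RSys sig} {f} {ts ts′ : Vec (Term sig) (arity f)} → VecLift (Step R) ts ts′ →
    Step R (fun f ts) (fun f ts′)
  Step-vec {R} {f} l with index l
    where
    index : ∀ {n} {ts ts′ : Vec (Term sig) n} → VecLift (Step R) ts ts′ →
      ∃₂ λ i s → Step R (lookup ts i) s × ts′ ≡ ts [ i ]≔ s
    index (head st) = zero , _ , st , refl
    index (tail l) with index l
    ... | i , s , st , e = suc i , s , st , cong (_ ∷_) e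
  ... | i , s , (p , u , v , r , a , rp) , refl = toℕ i ∷ p , u , v , r , there i a , there i rp

  EqStep-vec : ∀ {R : RSys sig} {f} {ts ts′ : Vec (Term sig) (arity f)} →
    VPW.Pointwise (EqClosure (Step R)) ts ts′ → EqClosure (Step R) (fun f ts) (fun f ts′)
  EqStep-vec {R} {f} pw = St.gmap (fun f) sym-step (Star-vec pw)
    where
    forward : ∀ {n} {ts ts′ : Vec (Term sig) n} → VecLift (SymClosure (Step R)) ts ts′ →
      SymClosure (VecLift (Step R)) ts ts′
    forward (head (fwd s)) = fwd (head s)
    forward (head (bwd s)) = bwd (head s)
    forward (tail l) with forward l
    ... | fwd m = fwd (tail m)
    ... | bwd m = bwd (tail m)
    sym-step : ∀ {ts ts′} → VecLift (SymClosure (Step R)) ts ts′ → SymClosure (Step R) (fun f ts) (fun f ts′)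
    sym-step l with forward l
    ... | fwd m = fwd (Step-vec m)
    ... | bwd m = bwd (Step-vec m)

  ReplAll-EqStep : ∀ {R : RSys sig} {u t′ a a′ θ} → EqClosure (Step R) (u ⟨ θ ⟩) (t′ ⟨ θ ⟩) →
    ReplAll u t′ a a′ → EqClosure (Step R) (a ⟨ θ ⟩) (a′ ⟨ θ ⟩)
  ReplAll-EqStep e hit = e
  ReplAll-EqStep e (rvar _) = ε
  ReplAll-EqStep {R} {u} {t′} {θ = θ} e (rfun _ rs) = EqStep-vec (go rs)
    where
    go : ∀ {n} {ts ts′ : Vec (Term sig) n} → VPW.Pointwise (ReplAll u t′) ts ts′ →
      VPW.Pointwise (EqClosure (Step R)) (ts ⟨ θ ⟩*) (ts′ ⟨ θ ⟩*)
    go VPW.[] = VPW.[]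
    go (r VPW.∷ rs) = ReplAll-EqStep e r VPW.∷ go rs

  module _ (em : ExcludedMiddle 0ℓ) (u t′ : Term sig) where
    mutual
      ReplAll-exists : ∀ a → ∃ λ a′ → ReplAll u t′ a a′
      ReplAll-exists (var x) with em {P = var x ≡ u}
      ... | yes refl = t′ , hit
      ... | no ne = var x , rvar ne
      ReplAll-exists (fun f ts) with em {P = fun f ts ≡ u}
      ... | yes refl = t′ , hit
      ... | no ne with ReplAll-exists* ts
      ...   | ts′ , rs = fun f ts′ , rfun ne rs

      ReplAll-exists* : ∀ {n} (ts : Vec (Term sig) n) →
        ∃ λ (ts′ : Vec (Term sig) n) → VPW.Pointwise (ReplAll u t′) ts ts′
      ReplAll-exists* [] = [] , VPW.[]
      ReplAll-exists* (t ∷ ts) with ReplAll-exists t | ReplAll-exists* ts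
      ... | t′ , r | ts′ , rs = t′ ∷ ts′ , r VPW.∷ rs

    ReplAllCl-exists : ∀ C → ∃ λ C′ → ReplAllCl u t′ C C′
    ReplAllCl-exists [] = [] , []
    ReplAllCl-exists (pos a b ∷ C) with ReplAll-exists a | ReplAll-exists b | ReplAllCl-exists C
    ... | _ , r | _ , s | _ , rs = _ , rpos r s ∷ rs
    ReplAllCl-exists (neg a b ∷ C) with ReplAll-exists a | ReplAll-exists b | ReplAllCl-exists C
    ... | _ , r | _ , s | _ , rs = _ , rneg r s ∷ rs

  EqStep-sym : ∀ {R : RSys sig} {a b} → EqClosure (Step R) a b → EqClosure (Step R) b a
  EqStep-sym = EqC.symmetric _

  -- Used contrapositively: superposing with a rule of the system keeps a false right premise false.
  ReplAllCl-true : ∀ {R : RSys sig} {u t′ C C′ θ} → EqClosure (Step R) (u ⟨ θ ⟩) (t′ ⟨ θ ⟩) →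
    ReplAllCl u t′ C C′ → Any (TrueLit R) (C′ ⟪ θ ⟫) → Any (TrueLit R) (C ⟪ θ ⟫)
  ReplAllCl-true e (rpos r s ∷ rs) (here p) =
    here (ReplAll-EqStep e r ◅◅ p ◅◅ EqStep-sym (ReplAll-EqStep e s))
  ReplAllCl-true e (rneg r s ∷ rs) (here n) =
    here λ q → n (EqStep-sym (ReplAll-EqStep e r) ◅◅ q ◅◅ ReplAll-EqStep e s)
  ReplAllCl-true e (_ ∷ rs) (there a) = there (ReplAllCl-true e rs a)

  NF-irreducible : ∀ {R : RSys sig} {t n} → Irreducible R t → NF R t n → t ≡ n
  NF-irreducible irr (ε , _) = refl
  NF-irreducible irr (s ◅ _ , _) = ⊥-elim (irr _ s)

  NF-args-irreducible : ∀ {R : RSys sig} {θ n} {ts ts′ : Vec (Term sig) n} →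
    (∀ i → Irreducible R (lookup ts i ⟨ θ ⟩)) → VPW.Pointwise (λ s s′ → NF R (s ⟨ θ ⟩) s′) ts ts′ →
    ts ⟨ θ ⟩* ≡ ts′
  NF-args-irreducible irr VPW.[] = refl
  NF-args-irreducible irr (n VPW.∷ ns) =
    cong₂ _∷_ (NF-irreducible (irr zero) n) (NF-args-irreducible (λ i → irr (suc i)) ns)

  NF-args-Star : ∀ {R : RSys sig} {θ f} {ts ts′ : Vec (Term sig) (arity f)} →
    VPW.Pointwise (λ s s′ → NF R (s ⟨ θ ⟩) s′) ts ts′ → Star (Step R) (fun f (ts ⟨ θ ⟩*)) (fun f ts′)
  NF-args-Star {R} {θ} {f} ns = St.gmap (fun f) Step-vec (Star-vec (go ns))
    where
    go : ∀ {n} {ts ts′ : Vec (Term sig) n} → VPW.Pointwise (λ s s′ → NF R (s ⟨ θ ⟩) s′) ts ts′ →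
      VPW.Pointwise (Star (Step R)) (ts ⟨ θ ⟩*) ts′
    go VPW.[] = VPW.[]
    go (n VPW.∷ ns) = proj₁ n VPW.∷ go ns

  -- Normal forms and redex multisets depend only on the rules applicable along a derivation. With
  -- all terms for `P` this transports along mutual inclusion of systems; with the ground terms
  -- below `s` it compares `R∞` with `R< s`.
  module Locality {R R′ : RSys sig} (P : Term sig → Set)
    (closed : ∀ {t t′} → P t → Step R t t′ → P t′)
    (agree : ∀ {t p u v} → P t → At t p u → (R u v → R′ u v) × (R′ u v → R u v)) where

    Step-local : ∀ {t t′} → P t → Step R t t′ → Step R′ t t′
    Step-local pt (p , u , v , r , a , rp) = p , u , v , proj₁ (agree pt a) r , a , rp

    Irreducible-local : ∀ {t} → P t → Irreducible R t → Irreducible R′ t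
    Irreducible-local pt irr t′ (p , u , v , r , a , rp) =
      irr t′ (p , u , v , proj₂ (agree pt a) r , a , rp)

    NF-local : ∀ {t n} → P t → NF R t n → NF R′ t n
    NF-local pt (ε , irr) = ε , Irreducible-local pt irr
    NF-local pt (s ◅ ss , irr) with NF-local (closed pt s) (ss , irr)
    ... | ss′ , irr′ = Step-local pt s ◅ ss′ , irr′

    Rm-local : ∀ {t m M} → P t → Rm R t m M → Rm R′ t m M
    Rm-local pt (rm-irr irr) = rm-irr (Irreducible-local pt irr)
    Rm-local pt (rm-step r a rp rm) =
      rm-step (proj₁ (agree pt a) r) a rp (Rm-local (closed pt (_ , _ , _ , r , a , rp)) rm)

-- Confluence of left-reduced systems and redex multisets

module Rewriting {sig : Signature} (em : ExcludedMiddle 0ℓ) (ord : ReductionOrdering sig)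
  {R : RSys sig} (adm : Admissible ord R) where
  open Signature sig
  open ReductionOrdering ord renaming (trans to ≻-trans; irrefl to ≻-irrefl)
  open GroundOrder ord

  left-reduced : LeftReduced R
  left-reduced = proj₁ adm

  Step-≻ : ∀ {t t′} → Step R t t′ → t ≻ t′
  Step-≻ (p , u , v , r , a , rp) = compat (proj₂ (proj₂ adm) u v r) (Repl-refl a) rp

  Star-≽ : ∀ {t t′} → Star (Step R) t t′ → t ≽ t′
  Star-≽ ε = inj₁ refl
  Star-≽ (s ◅ ss) = inj₂ (≻-≽ (Step-≻ s) (Star-≽ ss))

  -- Left-reducedness makes nested redexes coincide, so a genuine peak is parallel and closes with
  -- exactly one step per side. The residuals keep their positions, which the labelled multisets
  -- require beyond mere confluence.
  diamond : ∀ {t p u v t₁ q u′ v′ t₂} → R u v → At t p u → Repl t p v t₁ →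
    R u′ v′ → At t q u′ → Repl t q v′ t₂ →
    (u ≡ u′ × p ≡ q × t₁ ≡ t₂) ⊎
    (∃ λ t₃ → At t₁ q u′ × Repl t₁ q v′ t₃ × At t₂ p u × Repl t₂ p v t₃)
  diamond {p = p} {q = q} r a rp r′ b rq with compare a rp b rq
  ... | parallel t₃ a₁ r₁ a₂ r₂ = inj₂ (t₃ , a₁ , r₁ , a₂ , r₂)
  ... | below s e c with left-reduced _ _ _ _ s r r′ c
  ...   | refl , refl with At-self c
  ...     | refl = inj₁ (refl , p≡q , Repl-functional p≡q rp rq)
    where p≡q = sym (trans e (++-identityʳ p))
  diamond {p = p} {q = q} r a rp r′ b rq | above s e c with left-reduced _ _ _ _ s r′ r c
  ...   | refl , refl with At-self c
  ...     | refl = inj₁ (refl , p≡q , Repl-functional p≡q rp rq)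
    where p≡q = trans e (++-identityʳ q)

  -- As every peak closes with single steps, the given step can be pushed along the derivation to
  -- `n`. It must be absorbed on the way, because `n` is irreducible.
  Star-step : ∀ {t t₁ n} → Irreducible R n → Step R t t₁ → Star (Step R) t n → Star (Step R) t₁ n
  Star-step irr s ε = ⊥-elim (irr _ s)
  Star-step irr s@(p , u , v , r , a , rp) ((q , u′ , v′ , r′ , b , rq) ◅ ss) with diamond r a rp r′ b rq
  ... | inj₁ (_ , _ , refl) = ss
  ... | inj₂ (t₃ , a₁ , r₁ , a₂ , r₂) =
        (q , u′ , v′ , r′ , a₁ , r₁) ◅ Star-step irr (p , u , v , r , a₂ , r₂) ss

  NF-step : ∀ {t t₁ n} → Step R t t₁ → NF R t n → NF R t₁ n
  NF-step s (ss , irr) = Star-step irr s ss , irr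

  NF-EqStep : ∀ {a b n} → EqClosure (Step R) a b → NF R a n → NF R b n
  NF-EqStep ε nf = nf
  NF-EqStep (fwd s ◅ e) nf = NF-EqStep e (NF-step s nf)
  NF-EqStep (bwd s ◅ e) (ss , irr) = NF-EqStep e (s ◅ ss , irr)

  Star⇒EqStep : ∀ {a b} → Star (Step R) a b → EqClosure (Step R) a b
  Star⇒EqStep = St.map fwd

  NF-unique : ∀ {t n n′} → NF R t n → NF R t n′ → n ≡ n′
  NF-unique (ss , irr) nf = NF-irreducible irr (NF-EqStep (Star⇒EqStep ss) nf)

  reducible? : ∀ t → (∃ λ t′ → Step R t t′) ⊎ Irreducible R t
  reducible? t with em {P = ∃ λ t′ → Step R t t′}
  ... | yes st = inj₁ st
  ... | no irr = inj₂ λ t′ s → irr (t′ , s)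

  NF-exists : ∀ t → ∃ λ n → NF R t n
  NF-exists t = go (wf t)
    where
    go : ∀ {t} → Acc (flip _≻_) t → ∃ λ n → NF R t n
    go {t} (acc rs) with reducible? t
    ... | inj₂ irr = t , ε , irr
    ... | inj₁ (t′ , s) with go (rs (Step-≻ s))
    ...   | n , ss , irr = n , s ◅ ss , irr

  Rm-exists : ∀ t m → ∃ λ M → Rm R t m M
  Rm-exists t m = go (wf t)
    where
    go : ∀ {t} → Acc (flip _≻_) t → ∃ λ M → Rm R t m M
    go {t} (acc rs) with reducible? t
    ... | inj₂ irr = [] , rm-irr irr
    ... | inj₁ (t′ , s@(p , u , v , r , a , rp)) with go (rs (Step-≻ s))
    ...   | M , rm = _ , rm-step r a rp rm

  -- Any available step can be brought to the front of a recorded derivation: its residuals stay at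
  -- position `p` and so keep the label. This is why the multiset does not depend on the chosen
  -- reduction.
  Rm-step⁻ : ∀ {t p u v t₁ m M} → R u v → At t p u → Repl t p v t₁ → Rm R t m M →
    ∃ λ M₁ → M ↭ ((u , label {sig} p m) ∷ M₁) × Rm R t₁ m M₁
  Rm-step⁻ r a rp (rm-irr irr) = ⊥-elim (irr _ (_ , _ , _ , r , a , rp))
  Rm-step⁻ r a rp (rm-step r′ b rq rm) with diamond r a rp r′ b rq
  ... | inj₁ (refl , refl , refl) = _ , refl , rm
  ... | inj₂ (t₃ , a₁ , r₁ , a₂ , r₂) with Rm-step⁻ r a₂ r₂ rm
  ...   | M₁ , e , rm′ = _ , ↭-step (prep _ e) (swap _ _ refl) , rm-step r′ a₁ r₁ rm′

  Rm-unique : ∀ {t m M M′} → Rm R t m M → Rm R t m M′ → M ↭ M′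
  Rm-unique (rm-irr irr) (rm-irr _) = refl
  Rm-unique (rm-irr irr) (rm-step r a rp _) = ⊥-elim (irr _ (_ , _ , _ , r , a , rp))
  Rm-unique (rm-step r a rp rm) rm′ with Rm-step⁻ r a rp rm′
  ... | M₁ , e , rm″ = ↭-trans (prep _ (Rm-unique rm rm″)) (↭-sym e)

  lhs-subterm-irreducible : ∀ {u v p w} → R u v → p ≢ [] → At u p w → Irreducible R w
  lhs-subterm-irreducible {p = []} r ne a _ _ = ne refl
  lhs-subterm-irreducible {p = _ ∷ _} r ne a t′ (q , u′ , v′ , r′ , b , _)
    with left-reduced _ _ _ _ _ r r′ (At-++ a b)
  ... | refl , _ with At-self (At-++ a b)
  ...   | ()

  Rm-lhs : ∀ {u v m M} → R u v → Rm R u m M → ∃ λ M′ → M ≡ (u , m) ∷ M′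
  Rm-lhs r (rm-irr irr) = ⊥-elim (irr _ ([] , _ , _ , r , here , here))
  Rm-lhs r (rm-step r′ a rp rm) with left-reduced _ _ _ _ _ r r′ a
  ... | refl , refl with At-self a
  ...   | refl = _ , refl

  Rm-below : ∀ {s t m M} → Ground t → s ≻ t → Rm R t m M → All (λ e → s ≻ proj₁ e) M
  Rm-below gt g (rm-irr _) = []
  Rm-below gt g (rm-step {u = u} {v} r a rp rm) = ≻-≽ g (subterm-≽ gt a) ∷
    Rm-below (Ground-Repl gt (proj₂ (proj₁ (proj₂ adm) u v r)) rp)
      (≻-trans g (Step-≻ (_ , _ , _ , r , a , rp))) rm

  -- Only the first step can contract all of `s`, and it does so at the root, where label 0 is kept.
  -- A step below the root contracts a proper subterm, and all later terms are smaller than `s`.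
  Rm-top : ∀ {s t M} → Ground t → s ≽ t → Rm R t 0 M →
    All (λ e → s ≻ proj₁ e ⊎ e ≡ (s , 0)) M
  Rm-top gt g (rm-irr _) = []
  Rm-top gt g (rm-step {p = p} {u} {v} r a rp rm) = first p gt a g ∷
    All′.map inj₁ (Rm-below (Ground-Repl gt (proj₂ (proj₁ (proj₂ adm) u v r)) rp)
      (≽-≻ g (Step-≻ (_ , _ , _ , r , a , rp))) rm)
    where
    first : ∀ {t s} p → Ground t → At t p u → s ≽ t → s ≻ u ⊎ (u , label {sig} p 0) ≡ (s , 0)
    first [] _ here (inj₁ refl) = inj₂ refl
    first [] _ here (inj₂ g) = inj₁ g
    first (_ ∷ _) gt a g = inj₁ (≽-≻ g (subterm-≻ (λ ()) gt a))

-- Clauses and literals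

MulExt-map : ∀ {A B : Set} {_≈₁_ _>₁_ : A → A → Set} {_≈₂_ _>₂_ : B → B → Set} (f : A → B) →
  (∀ {x y} → x ≈₁ y → f x ≈₂ f y) → (∀ {x y} → x >₁ y → f x >₂ f y) →
  ∀ {M N} → MulExt _≈₁_ _>₁_ M N → MulExt _≈₂_ _>₂_ (map f M) (map f N)
MulExt-map {B = B} {_>₁_ = _>₁_} {_>₂_ = _>₂_} f ≈-pres >-pres (Z , X , Y , (M′ , p , pw) , (N′ , q , qw) , ne , dom) =
  map f Z , map f X , map f Y ,
  (_ , PermP.map⁺ f p , subst (Pointwise _ _) (map-++ f Z X) (PW.map⁺ f f (PW.map ≈-pres pw))) ,
  (_ , PermP.map⁺ f q , subst (Pointwise _ _) (map-++ f Z Y) (PW.map⁺ f f (PW.map ≈-pres qw))) ,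
  nonempty X ne , AllP.map⁺ (All′.map (λ a → AnyP.map⁺ (Any′.map >-pres a)) dom)
  where
  nonempty : ∀ X → X ≢ [] → map f X ≢ []
  nonempty [] ne _ = ne refl
  nonempty (_ ∷ _) _ ()

MEq-map : ∀ {A B : Set} {_≈₁_ : A → A → Set} {_≈₂_ : B → B → Set} (f : A → B) →
  (∀ {x y} → x ≈₁ y → f x ≈₂ f y) → ∀ {M N} → MEq _≈₁_ M N → MEq _≈₂_ (map f M) (map f N)
MEq-map f ≈-pres (_ , p , pw) = _ , PermP.map⁺ f p , PW.map⁺ f f (PW.map ≈-pres pw)

module TermMEq {sig : Signature} = MEqProperties {Term sig} isEquivalence

module _ {sig : Signature} where
  swapLit : Lit sig → Lit sig
  swapLit (pos s t) = pos t s
  swapLit (neg s t) = neg t s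

  LitEq-isEquivalence : IsEquivalence (LitEq {sig})
  LitEq-isEquivalence = record
    { refl = TermMEq.≋-refl ; sym = TermMEq.≋-sym ; trans = TermMEq.≋-trans }

  LitEq-swapLit : ∀ L → LitEq L (swapLit L)
  LitEq-swapLit (pos s t) = TermMEq.↭⇒≋ (swap s t refl)
  LitEq-swapLit (neg s t) = TermMEq.↭⇒≋ (++-comm (s ∷ s ∷ []) (t ∷ t ∷ []))

  ↭-pair : ∀ {s t a b : Term sig} → s ∷ t ∷ [] ↭ a ∷ b ∷ [] → (s ≡ a × t ≡ b) ⊎ (s ≡ b × t ≡ a)
  ↭-pair p with ∈-resp-↭ p (here refl)
  ... | here refl with PermP.↭-singleton-inv (drop-∷ p)
  ...   | refl = inj₁ (refl , refl)
  ↭-pair p | there (here refl) with PermP.↭-singleton-inv (drop-∷ (↭-trans p (swap _ _ refl)))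
  ...   | refl = inj₂ (refl , refl)

  ↭-twice : ∀ {t b : Term sig} → t ∷ t ∷ [] ↭ b ∷ b ∷ [] → t ≡ b
  ↭-twice p with ↭-pair p
  ... | inj₁ (e , _) = e
  ... | inj₂ (e , _) = e

  ↭-double-pair : ∀ {s t a b : Term sig} → s ∷ s ∷ t ∷ t ∷ [] ↭ a ∷ a ∷ b ∷ b ∷ [] →
    (s ≡ a × t ≡ b) ⊎ (s ≡ b × t ≡ a)
  ↭-double-pair {b = b} p with ∈-resp-↭ p (here refl)
  ... | here refl = inj₁ (refl , ↭-twice (drop-∷ (drop-∷ p)))
  ... | there (here refl) = inj₁ (refl , ↭-twice (drop-∷ (drop-∷ p)))
  ... | there (there i) = inj₂ (bs i , ↭-twice (drop-∷ (drop-∷ (↭-trans (subst (λ w → w ∷ w ∷ _ ↭ _) (bs i) p) (++-comm (_ ∷ _ ∷ []) (b ∷ b ∷ []))))))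
    where
    bs : ∀ {s : Term sig} → s ∈ b ∷ b ∷ [] → s ≡ b
    bs (here e) = e
    bs (there (here e)) = e

  LitEq⁻ : ∀ {L L′ : Lit sig} → LitEq L L′ → L ≡ L′ ⊎ L ≡ swapLit L′
  LitEq⁻ {pos s t} {pos a b} e with ↭-pair (MEq-≡⇒↭ e)
  ... | inj₁ (refl , refl) = inj₁ refl
  ... | inj₂ (refl , refl) = inj₂ refl
  LitEq⁻ {neg s t} {neg a b} e with ↭-double-pair (MEq-≡⇒↭ e)
  ... | inj₁ (refl , refl) = inj₁ refl
  ... | inj₂ (refl , refl) = inj₂ refl
  -- Opposite signs are told apart by the lengths two and four of the encodings.
  LitEq⁻ {pos s t} {neg a b} e with ↭-length (MEq-≡⇒↭ e)
  ... | ()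
  LitEq⁻ {neg s t} {pos a b} e with ↭-length (MEq-≡⇒↭ e)
  ... | ()

  litMS-sub : ∀ θ (L : Lit sig) → litMS (litSub θ L) ≡ map (_⟨ θ ⟩) (litMS L)
  litMS-sub θ (pos s t) = refl
  litMS-sub θ (neg s t) = refl

  LitEq-sub : ∀ {L L′ : Lit sig} θ → LitEq L L′ → LitEq (litSub θ L) (litSub θ L′)
  LitEq-sub {L} {L′} θ e =
    subst₂ (MEq _≡_) (sym (litMS-sub θ L)) (sym (litMS-sub θ L′)) (MEq-map (_⟨ θ ⟩) (cong (_⟨ θ ⟩)) e)

module ClauseMEq {sig : Signature} = MEqProperties (LitEq-isEquivalence {sig})
open ClauseMEq using () renaming (≋-refl to ≅-refl; ≋-sym to ≅-sym; ≋-trans to ≅-trans; ↭⇒≋ to ↭⇒≅)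

module _ {sig : Signature} where
  ≅-sub : ∀ {C D : Clause sig} θ → C ≅ D → (C ⟪ θ ⟫) ≅ (D ⟪ θ ⟫)
  ≅-sub θ = MEq-map (litSub θ) (λ {L} {L′} → LitEq-sub {L = L} {L′} θ)

  litSub-∘ : ∀ (L : Lit sig) σ τ → litSub τ (litSub σ L) ≡ litSub (λ x → σ x ⟨ τ ⟩) L
  litSub-∘ (pos s t) σ τ = cong₂ pos (sub-∘ s σ τ) (sub-∘ t σ τ)
  litSub-∘ (neg s t) σ τ = cong₂ neg (sub-∘ s σ τ) (sub-∘ t σ τ)

  clauseSub-∘ : ∀ (C : Clause sig) σ τ → C ⟪ σ ⟫ ⟪ τ ⟫ ≡ C ⟪ (λ x → σ x ⟨ τ ⟩) ⟫
  clauseSub-∘ [] σ τ = refl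
  clauseSub-∘ (L ∷ C) σ τ = cong₂ _∷_ (litSub-∘ L σ τ) (clauseSub-∘ C σ τ)

  clauseSub-cong : ∀ (C : Clause sig) {σ τ} → (∀ x → OccursCl x C → σ x ≡ τ x) → C ⟪ σ ⟫ ≡ C ⟪ τ ⟫
  clauseSub-cong [] e = refl
  clauseSub-cong (pos s t ∷ C) e = cong₂ _∷_
    (cong₂ pos (sub-cong s λ x o → e x (here (here o))) (sub-cong t λ x o → e x (here (there (here o)))))
    (clauseSub-cong C λ x o → e x (there o))
  clauseSub-cong (neg s t ∷ C) e = cong₂ _∷_
    (cong₂ neg (sub-cong s λ x o → e x (here (here o))) (sub-cong t λ x o → e x (here (there (there (here o))))))
    (clauseSub-cong C λ x o → e x (there o))

  clauseSub-id : ∀ (C : Clause sig) → C ⟪ var ⟫ ≡ C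
  clauseSub-id [] = refl
  clauseSub-id (pos s t ∷ C) = cong₂ _∷_ (cong₂ pos (sub-id s) (sub-id t)) (clauseSub-id C)
  clauseSub-id (neg s t ∷ C) = cong₂ _∷_ (cong₂ neg (sub-id s) (sub-id t)) (clauseSub-id C)

  clauseSub-absorb : ∀ (C : Clause sig) {σ θ} → Absorbs σ θ → C ⟪ σ ⟫ ⟪ θ ⟫ ≡ C ⟪ θ ⟫
  clauseSub-absorb C {σ} {θ} ab = trans (clauseSub-∘ C σ θ) (clauseSub-cong C λ x _ → ab x)

  TrueLit-LitEq : ∀ {R : RSys sig} {L L′} → LitEq L L′ → TrueLit R L → TrueLit R L′
  TrueLit-LitEq {L = L} {L′} e tr with LitEq⁻ {L = L} {L′} e
  ... | inj₁ refl = tr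
  TrueLit-LitEq {L′ = pos s t} e tr | inj₂ refl = EqStep-sym tr
  TrueLit-LitEq {L′ = neg s t} e tr | inj₂ refl = λ q → tr (EqStep-sym q)

  true-≅ : ∀ {R : RSys sig} {C D} → C ≅ D → Any (TrueLit R) C → Any (TrueLit R) D
  true-≅ {R} (_ , p , pw) a =
    PW.Any-resp-Pointwise (λ {L} {L′} → TrueLit-LitEq {R = R} {L} {L′}) pw (Any-resp-↭ p a)

  GroundLit : Lit sig → Set
  GroundLit L = All Ground (litMS L)

  GroundLit-LitEq : ∀ {L L′} → LitEq L L′ → GroundLit L → GroundLit L′
  GroundLit-LitEq e g = All-resp-↭ (MEq-≡⇒↭ e) g

  GroundCl-≅ : ∀ {C D : Clause sig} → C ≅ D → GroundCl C → GroundCl D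
  GroundCl-≅ (_ , p , pw) g =
    PW.All-resp-Pointwise (λ {L} {L′} → GroundLit-LitEq {L} {L′}) pw (All-resp-↭ p g)

  -- The common interface of `NegSide` and `PosSide`, so that closure under `≅`, substitution and
  -- groundness are treated once for both signs.
  record SideNotion (Side : Lit sig → Term sig → Set) : Set where
    field
      side-swap  : ∀ {L s} → Side L s → Side (swapLit L) s
      side-sub   : ∀ {L s} ρ → Side L s → Side (litSub ρ L) (s ⟨ ρ ⟩)
      side-sub⁻  : ∀ {L s} ρ → Side (litSub ρ L) s → ∃ λ s₀ → s ≡ s₀ ⟨ ρ ⟩ × Side L s₀
      side-litMS : ∀ {L s} → Side L s → s ∈ litMS L

  negSide : SideNotion NegSide
  negSide = record
    { side-swap = λ { nl → nr ; nr → nl } ; side-sub = λ { ρ nl → nl ; ρ nr → nr }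
    ; side-sub⁻ = λ { {neg s t} ρ nl → _ , refl , nl ; {neg s t} ρ nr → _ , refl , nr }
    ; side-litMS = λ { nl → here refl ; nr → there (there (here refl)) } }

  posSide : SideNotion PosSide
  posSide = record
    { side-swap = λ { pl → pr ; pr → pl } ; side-sub = λ { ρ pl → pl ; ρ pr → pr }
    ; side-sub⁻ = λ { {pos s t} ρ pl → _ , refl , pl ; {pos s t} ρ pr → _ , refl , pr }
    ; side-litMS = λ { pl → here refl ; pr → there (here refl) } }

  occurs-side : ∀ {C : Clause sig} {x} → OccursCl x C → ∃ λ s → Occurs x s × (InTSneg C s ⊎ InTSpos C s)
  occurs-side (here {pos s t} (here o)) = s , o , inj₂ (_ , here refl , pl)
  occurs-side (here {pos s t} (there (here o))) = t , o , inj₂ (_ , here refl , pr)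
  occurs-side (here {neg s t} (here o)) = s , o , inj₁ (_ , here refl , nl)
  occurs-side (here {neg s t} (there (here o))) = s , o , inj₁ (_ , here refl , nl)
  occurs-side (here {neg s t} (there (there (here o)))) = t , o , inj₁ (_ , here refl , nr)
  occurs-side (here {neg s t} (there (there (there (here o))))) = t , o , inj₁ (_ , here refl , nr)
  occurs-side (there o) with occurs-side o
  ... | s , o′ , inj₁ (L , i , sd) = s , o′ , inj₁ (L , there i , sd)
  ... | s , o′ , inj₂ (L , i , sd) = s , o′ , inj₂ (L , there i , sd)

  module _ {Side : Lit sig → Term sig → Set} (sn : SideNotion Side) where
    open SideNotion sn

    InSide : Clause sig → Term sig → Set
    InSide C s = Σ (Lit sig) λ L → L ∈ C × Side L s

    InSide-≅ : ∀ {C D s} → C ≅ D → InSide C s → InSide D s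
    InSide-≅ e (L , i , sd) with ClauseMEq.≋-∈ e i
    ... | L′ , j , eq with LitEq⁻ {L = L} {L′} eq
    ...   | inj₁ refl = _ , j , sd
    ...   | inj₂ refl = _ , j , subst (λ K → Side K _) (swap-swap L′) (side-swap sd)
      where
      swap-swap : ∀ L → swapLit (swapLit L) ≡ L
      swap-swap (pos _ _) = refl
      swap-swap (neg _ _) = refl

    InSide-sub : ∀ {C s} ρ → InSide C s → InSide (C ⟪ ρ ⟫) (s ⟨ ρ ⟩)
    InSide-sub ρ (L , i , sd) = _ , ∈-map⁺ (litSub ρ) i , side-sub ρ sd

    InSide-sub⁻ : ∀ C {s} ρ → InSide (C ⟪ ρ ⟫) s → ∃ λ s₀ → s ≡ s₀ ⟨ ρ ⟩ × InSide C s₀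
    InSide-sub⁻ C ρ (L , i , sd) with ∈-map⁻ (litSub ρ) i
    ... | L₀ , j , refl with side-sub⁻ ρ sd
    ...   | s₀ , e , sd₀ = s₀ , e , L₀ , j , sd₀

    InSide-occurs : ∀ {C s x} → InSide C s → Occurs x s → OccursCl x C
    InSide-occurs (L , i , sd) o = lose i (lose (side-litMS sd) o)

    InSide-ground : ∀ {C s θ} → GroundCl (C ⟪ θ ⟫) → InSide C s → Ground (s ⟨ θ ⟩)
    InSide-ground {θ = θ} g (L , i , sd) =
      All′.lookup (All′.lookup g (∈-map⁺ (litSub θ) i)) (side-litMS (side-sub θ sd))

-- The labelled subterm sets and normalization multisets

Pointwise-map-∈ : ∀ {A B C : Set} {R : A → B → Set} {S : C → B → Set} (f : A → C) {xs ys} →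
  (∀ {x y} → x ∈ xs → R x y → S (f x) y) → Pointwise R xs ys → Pointwise S (map f xs) ys
Pointwise-map-∈ f g [] = []
Pointwise-map-∈ f g (r ∷ rs) = g (here refl) r ∷ Pointwise-map-∈ f (λ i → g (there i)) rs

Enumerates-map : ∀ {A B : Set} {P : A → Set} {Q : B → Set} (f : A → B) →
  (∀ {x y} → f x ≡ f y → x ≡ y) → (∀ {x} → P x → Q (f x)) → (∀ {y} → Q y → ∃ λ x → y ≡ f x × P x) →
  ∀ {xs} → Enumerates P xs → Enumerates Q (map f xs)
Enumerates-map {Q = Q} f inj to from {xs} (uniq , mem) = UniqueP.map⁺ inj uniq , λ y → sound y , complete y
  where
  sound : ∀ y → y ∈ map f xs → Q y
  sound y i with ∈-map⁻ f i
  ... | x , j , refl = to (proj₁ (mem x) j)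
  complete : ∀ y → Q y → y ∈ map f xs
  complete y q with from q
  ... | x , refl , p = ∈-map⁺ f (proj₂ (mem x) p)

Enumerates-unique : ∀ {A : Set} {P : A → Set} {xs ys} → Enumerates P xs → Enumerates P ys → xs ↭ ys
Enumerates-unique (u , m) (u′ , m′) = ∼bag⇒↭ (unique∧set⇒bag u u′
  (λ {x} → mk⇔ (λ i → proj₂ (m′ x) (proj₁ (m x) i)) (λ i → proj₂ (m x) (proj₁ (m′ x) i))))

Enumerates-∷ : ExcludedMiddle 0ℓ → ∀ {A : Set} {P : A → Set} {x xs} → P x →
  Enumerates (λ y → P y × y ≢ x) xs → Enumerates P (x ∷ xs)
Enumerates-∷ em {A} {P} {x} {xs} px (u , m) = All′.tabulate (λ {y} i e → proj₂ (proj₁ (m y) i) (sym e)) ∷ u ,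
  λ y → (λ { (here refl) → px ; (there i) → proj₁ (proj₁ (m y) i) }) , complete y
  where
  complete : ∀ y → P y → y ∈ x ∷ xs
  complete y p with em {P = y ≡ x}
  ... | yes e = here e
  ... | no ne = there (proj₂ (m y) (p , ne))

-- Excluded middle filters the covering list by `P`; strengthening the predicate by `y ≢ x` in the
-- recursion prevents repetitions.
Enumerates-exists : ∀ (em : ExcludedMiddle 0ℓ) {A : Set} {P : A → Set} xs → (∀ x → P x → x ∈ xs) →
  ∃ λ ys → Enumerates P ys
Enumerates-exists em [] sub = [] , [] , λ x → (λ ()) , sub x
Enumerates-exists em {A} {P} (x ∷ xs) sub with Enumerates-exists em {P = λ y → P y × y ≢ x} xs tail-sub | em {P = P x}
  where
  tail-sub : ∀ y → P y × y ≢ x → y ∈ xs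
  tail-sub y (p , ne) with sub y p
  ... | here e = ⊥-elim (ne e)
  ... | there i = i
... | ys , enum | yes px = x ∷ ys , Enumerates-∷ em px enum
... | ys , u , m | no ¬px = ys , u , λ y → (λ i → proj₁ (proj₁ (m y) i)) ,
        λ p → proj₂ (m y) (p , λ { refl → ¬px p })

concat-↭ : ∀ {A : Set} {xss yss : List (List A)} → xss ↭ yss → concat xss ↭ concat yss
concat-↭ refl = refl
concat-↭ (prep xs p) = ++⁺ˡ xs (concat-↭ p)
concat-↭ (swap xs ys p) = ↭-trans (shifts xs ys) (++⁺ˡ ys (++⁺ˡ xs (concat-↭ p)))
concat-↭ (↭-step p q) = ↭-trans (concat-↭ p) (concat-↭ q)

concat-pointwise-↭ : ∀ {A : Set} {xss yss : List (List A)} → Pointwise _↭_ xss yss → concat xss ↭ concat yss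
concat-pointwise-↭ [] = refl
concat-pointwise-↭ (p ∷ ps) = ++⁺ p (concat-pointwise-↭ ps)

Pointwise-functional : ∀ {A B : Set} {R : A → B → Set} {S : B → B → Set} →
  (∀ {x y z} → R x y → R x z → S y z) →
  ∀ {xs ys zs} → Pointwise R xs ys → Pointwise R xs zs → Pointwise S ys zs
Pointwise-functional f [] [] = []
Pointwise-functional f (r ∷ rs) (r′ ∷ rs′) = f r r′ ∷ Pointwise-functional f rs rs′

Pointwise-exists : ∀ {A B : Set} {R : A → B → Set} → (∀ x → ∃ λ y → R x y) → ∀ xs → ∃ λ ys → Pointwise R xs ys
Pointwise-exists f [] = [] , []
Pointwise-exists f (x ∷ xs) with f x | Pointwise-exists f xs
... | y , r | ys , rs = y ∷ ys , r ∷ rs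

module _ {sig : Signature} where
  open Signature sig

  At-rename⁻ : ∀ {ρ : Subst sig} → IsRenaming ρ → ∀ s {p t′} → At (s ⟨ ρ ⟩) p t′ →
    ∃ λ t → t′ ≡ t ⟨ ρ ⟩ × At s p t
  At-rename⁻ {ρ} (π , π′ , e , _) (var x) {p} a with ρ x | e x
  At-rename⁻ {ρ} (π , π′ , e , _) (var x) here | _ | refl = var x , sym (e x) , here
  At-rename⁻ ren (fun f ts) here = _ , refl , here
  At-rename⁻ {ρ} ren (fun f ts) (there i a)
    with At-rename⁻ ren (lookup ts i) (subst (λ w → At w _ _) (lookup-sub ts i ρ) a)
  ... | t , e , b = t , e , there i b

  rename-cancel : ∀ {ρ : Subst sig} (ren : IsRenaming ρ) t → t ⟨ ρ ⟩ ⟨ var ∘ proj₁ (proj₂ ren) ⟩ ≡ t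
  rename-cancel {ρ} (π , π′ , e , inv , _) t =
    trans (sub-∘ t ρ _) (trans (sub-cong t λ x _ → trans (cong (_⟨ var ∘ π′ ⟩) (e x)) (cong var (inv x))) (sub-id t))

  rename-injective : ∀ {ρ : Subst sig} → IsRenaming ρ → ∀ {s t} → s ⟨ ρ ⟩ ≡ t ⟨ ρ ⟩ → s ≡ t
  rename-injective ren {s} {t} e =
    trans (sym (rename-cancel ren s)) (trans (cong (_⟨ _ ⟩) e) (rename-cancel ren t))

  module _ {ρ : Subst sig} (ren : IsRenaming ρ) {C D : Clause sig} (C≅ : C ≅ (D ⟪ ρ ⟫)) where
    private
      module _ {Side : Lit sig → Term sig → Set} (sn : SideNotion Side) where
        side-fwd : ∀ {s} → InSide sn D s → InSide sn C (s ⟨ ρ ⟩)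
        side-fwd i = InSide-≅ sn (≅-sym C≅) (InSide-sub sn ρ i)

        side-bwd : ∀ {s} → InSide sn C s → ∃ λ s₀ → s ≡ s₀ ⟨ ρ ⟩ × InSide sn D s₀
        side-bwd i = InSide-sub⁻ sn D ρ (InSide-≅ sn C≅ i)

      ssneg-fwd : ∀ {t} → InSSneg D t → InSSneg C (t ⟨ ρ ⟩)
      ssneg-fwd (L , i , s , sd , p , a) with side-fwd negSide (L , i , sd)
      ... | L′ , i′ , sd′ = L′ , i′ , s ⟨ ρ ⟩ , sd′ , p , At-sub ρ a

      ssneg-bwd : ∀ {t} → InSSneg C t → ∃ λ t₀ → t ≡ t₀ ⟨ ρ ⟩ × InSSneg D t₀
      ssneg-bwd (L , i , s , sd , p , a) with side-bwd negSide (L , i , sd)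
      ... | s₀ , refl , L′ , i′ , sd′ with At-rename⁻ ren s₀ a
      ...   | t₀ , e , b = t₀ , e , L′ , i′ , s₀ , sd′ , p , b

      sspos-fwd : ∀ {t} → InSSposProper D t → InSSposProper C (t ⟨ ρ ⟩)
      sspos-fwd (L , i , s , sd , p , ne , a) with side-fwd posSide (L , i , sd)
      ... | L′ , i′ , sd′ = L′ , i′ , s ⟨ ρ ⟩ , sd′ , p , ne , At-sub ρ a

      sspos-bwd : ∀ {t} → InSSposProper C t → ∃ λ t₀ → t ≡ t₀ ⟨ ρ ⟩ × InSSposProper D t₀
      sspos-bwd (L , i , s , sd , p , ne , a) with side-bwd posSide (L , i , sd)
      ... | s₀ , refl , L′ , i′ , sd′ with At-rename⁻ ren s₀ a
      ...   | t₀ , e , b = t₀ , e , L′ , i′ , s₀ , sd′ , p , ne , b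

      reflect : ∀ {P : Term sig → Set} {t} → (∃ λ t₀ → t ⟨ ρ ⟩ ≡ t₀ ⟨ ρ ⟩ × P t₀) → P t
      reflect {P} (t₀ , e , p) = subst P (sym (rename-injective ren e)) p

    -- Labels 1 and 0 are assigned by absence from other sets, so membership must be reflected as
    -- well as preserved. Injectivity of renamings, through `reflect`, provides this.
    InLss-rename : ∀ {e} → InLss D e → InLss C (proj₁ e ⟨ ρ ⟩ , proj₂ e)
    InLss-rename (l2 a) = l2 (ssneg-fwd a)
    InLss-rename (l1 a n) = l1 (sspos-fwd a) (λ b → n (reflect (ssneg-bwd b)))
    InLss-rename (l0 a n n′) = l0 (side-fwd posSide a)
      (λ b → n (reflect (sspos-bwd b))) (λ b → n′ (reflect (ssneg-bwd b)))

    InLss-rename⁻ : ∀ {e} → InLss C e → ∃ λ e₀ → e ≡ (proj₁ e₀ ⟨ ρ ⟩ , proj₂ e₀) × InLss D e₀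
    InLss-rename⁻ (l2 a) with ssneg-bwd a
    ... | t₀ , refl , b = _ , refl , l2 b
    InLss-rename⁻ (l1 a n) with sspos-bwd a
    ... | t₀ , refl , b = _ , refl , l1 b (λ c → n (ssneg-fwd c))
    InLss-rename⁻ (l0 a n n′) with side-bwd posSide a
    ... | t₀ , refl , b = _ , refl , l0 b (λ c → n (sspos-fwd c)) (λ c → n′ (ssneg-fwd c))

    InLts-rename : ∀ {e} → InLts D e → InLts C (proj₁ e ⟨ ρ ⟩ , proj₂ e)
    InLts-rename (t2 a) = t2 (side-fwd negSide a)
    InLts-rename (t0 a n) = t0 (side-fwd posSide a) (λ b → n (reflect (side-bwd negSide b)))

    InLts-rename⁻ : ∀ {e} → InLts C e → ∃ λ e₀ → e ≡ (proj₁ e₀ ⟨ ρ ⟩ , proj₂ e₀) × InLts D e₀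
    InLts-rename⁻ (t2 a) with side-bwd negSide a
    ... | t₀ , refl , b = _ , refl , t2 b
    InLts-rename⁻ (t0 a n) with side-bwd posSide a
    ... | t₀ , refl , b = _ , refl , t0 b (λ c → n (side-fwd negSide c))

  InLss-side : ∀ {C : Clause sig} {t m} → InLss C (t , m) →
    ∃₂ λ s p → At s p t × (InTSneg C s ⊎ InTSpos C s)
  InLss-side (l2 (L , i , s , sd , p , a)) = s , p , a , inj₁ (L , i , sd)
  InLss-side (l1 (L , i , s , sd , p , _ , a) _) = s , p , a , inj₂ (L , i , sd)
  InLss-side (l0 i _ _) = _ , [] , here , inj₂ i

  InLts-side : ∀ {C : Clause sig} {t m} → InLts C (t , m) → InTSneg C t ⊎ InTSpos C t
  InLts-side (t2 i) = inj₁ i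
  InLts-side (t0 i _) = inj₂ i

  side-occurs : ∀ {C : Clause sig} {s x} → InTSneg C s ⊎ InTSpos C s → Occurs x s → OccursCl x C
  side-occurs (inj₁ i) = InSide-occurs negSide i
  side-occurs (inj₂ i) = InSide-occurs posSide i

  side-ground : ∀ {C : Clause sig} {s θ} → GroundClo (C , θ) → InTSneg C s ⊎ InTSpos C s → Ground (s ⟨ θ ⟩)
  side-ground g (inj₁ i) = InSide-ground negSide g i
  side-ground g (inj₂ i) = InSide-ground posSide g i

  InLss-occurs : ∀ {C : Clause sig} {t m x} → InLss C (t , m) → Occurs x t → OccursCl x C
  InLss-occurs l (q , b) with InLss-side l
  ... | s , p , a , sd = side-occurs sd (_ , At-++ a b)

  InLss-ground : ∀ {C : Clause sig} {t m θ} → GroundClo (C , θ) → InLss C (t , m) → Ground (t ⟨ θ ⟩)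
  InLss-ground {θ = θ} g l with InLss-side l
  ... | s , p , a , sd = Ground-At (side-ground g sd) (At-sub θ a)

  occurs-InLss : ExcludedMiddle 0ℓ → ∀ {C : Clause sig} {x} → OccursCl x C → ∃ λ m → InLss C (var x , m)
  occurs-InLss em {C} {x} o with em {P = InSSneg C (var x)}
  ... | yes a = 2 , l2 a
  ... | no n with em {P = InSSposProper C (var x)}
  ...   | yes a = 1 , l1 a n
  ...   | no n′ with occurs-side o
  ...     | s , (p , a) , inj₁ (L , i , sd) = ⊥-elim (n (L , i , s , sd , p , a))
  ...     | _ , ([] , here) , inj₂ i = 0 , l0 i n′ n
  ...     | s , (p@(_ ∷ _) , a) , inj₂ (L , i , sd) = ⊥-elim (n′ (L , i , s , sd , p , (λ ()) , a))

  mutual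
    subterms : Term sig → List (Term sig)
    subterms (var x) = var x ∷ []
    subterms (fun f ts) = fun f ts ∷ subterms* ts

    subterms* : ∀ {n} → Vec (Term sig) n → List (Term sig)
    subterms* [] = []
    subterms* (t ∷ ts) = subterms t ++ subterms* ts

  mutual
    At-∈-subterms : ∀ {t : Term sig} {p u} → At t p u → u ∈ subterms t
    At-∈-subterms {t = var x} here = here refl
    At-∈-subterms {t = fun f ts} here = here refl
    At-∈-subterms (there {ts = ts} i a) = there (At-∈-subterms* ts i a)

    At-∈-subterms* : ∀ {n} (ts : Vec (Term sig) n) i {p u} → At (lookup ts i) p u → u ∈ subterms* ts
    At-∈-subterms* (t ∷ ts) zero a = ∈-++⁺ˡ (At-∈-subterms a)
    At-∈-subterms* (t ∷ ts) (suc i) a = ∈-++⁺ʳ (subterms t) (At-∈-subterms* ts i a)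

  clauseSubterms : Clause sig → List (Term sig)
  clauseSubterms [] = []
  clauseSubterms (pos s t ∷ C) = (subterms s ++ subterms t) ++ clauseSubterms C
  clauseSubterms (neg s t ∷ C) = (subterms s ++ subterms t) ++ clauseSubterms C

  side-∈-subterms : ∀ {C : Clause sig} {s p t} → InTSneg C s ⊎ InTSpos C s → At s p t → t ∈ clauseSubterms C
  side-∈-subterms (inj₁ (_ , here refl , nl)) a = ∈-++⁺ˡ (∈-++⁺ˡ (At-∈-subterms a))
  side-∈-subterms (inj₁ (neg s _ , here refl , nr)) a = ∈-++⁺ˡ (∈-++⁺ʳ (subterms s) (At-∈-subterms a))
  side-∈-subterms (inj₂ (_ , here refl , pl)) a = ∈-++⁺ˡ (∈-++⁺ˡ (At-∈-subterms a))
  side-∈-subterms (inj₂ (pos s _ , here refl , pr)) a = ∈-++⁺ˡ (∈-++⁺ʳ (subterms s) (At-∈-subterms a))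
  side-∈-subterms {pos s t ∷ C} (inj₁ (L , there i , sd)) a =
    ∈-++⁺ʳ (subterms s ++ subterms t) (side-∈-subterms (inj₁ (L , i , sd)) a)
  side-∈-subterms {neg s t ∷ C} (inj₁ (L , there i , sd)) a =
    ∈-++⁺ʳ (subterms s ++ subterms t) (side-∈-subterms (inj₁ (L , i , sd)) a)
  side-∈-subterms {pos s t ∷ C} (inj₂ (L , there i , sd)) a =
    ∈-++⁺ʳ (subterms s ++ subterms t) (side-∈-subterms (inj₂ (L , i , sd)) a)
  side-∈-subterms {neg s t ∷ C} (inj₂ (L , there i , sd)) a =
    ∈-++⁺ʳ (subterms s ++ subterms t) (side-∈-subterms (inj₂ (L , i , sd)) a)

  labelled : List (Term sig) → List (Term sig × ℕ)
  labelled ts = map (_, 0) ts ++ map (_, 1) ts ++ map (_, 2) ts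

  labelled-0 : ∀ {t} ts → t ∈ ts → (t , 0) ∈ labelled ts
  labelled-0 ts i = ∈-++⁺ˡ (∈-map⁺ (_, 0) i)

  labelled-1 : ∀ {t} ts → t ∈ ts → (t , 1) ∈ labelled ts
  labelled-1 ts i = ∈-++⁺ʳ (map (_, 0) ts) (∈-++⁺ˡ (∈-map⁺ (_, 1) i))

  labelled-2 : ∀ {t} ts → t ∈ ts → (t , 2) ∈ labelled ts
  labelled-2 ts i = ∈-++⁺ʳ (map (_, 0) ts) (∈-++⁺ʳ (map (_, 1) ts) (∈-map⁺ (_, 2) i))

  InLss-enumerable : ExcludedMiddle 0ℓ → ∀ C → ∃ λ ls → Enumerates (InLss C) ls
  InLss-enumerable em C = Enumerates-exists em (labelled (clauseSubterms C)) inside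
    where
    inside : ∀ e → InLss C e → e ∈ labelled (clauseSubterms C)
    inside (t , _) l with InLss-side l
    inside (t , _) (l2 _) | s , p , a , sd = labelled-2 (clauseSubterms C) (side-∈-subterms sd a)
    inside (t , _) (l1 _ _) | s , p , a , sd = labelled-1 (clauseSubterms C) (side-∈-subterms sd a)
    inside (t , _) (l0 _ _ _) | s , p , a , sd = labelled-0 (clauseSubterms C) (side-∈-subterms sd a)

  InLts-enumerable : ExcludedMiddle 0ℓ → ∀ C → ∃ λ ts → Enumerates (InLts C) ts
  InLts-enumerable em C = Enumerates-exists em (labelled (clauseSubterms C)) inside
    where
    inside : ∀ e → InLts C e → e ∈ labelled (clauseSubterms C)
    inside (t , _) l with InLts-side l
    inside (t , _) (t2 _) | sd = labelled-2 (clauseSubterms C) (side-∈-subterms sd here)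
    inside (t , _) (t0 _ _) | sd = labelled-0 (clauseSubterms C) (side-∈-subterms sd here)

  id-renaming : IsRenaming {sig} var
  id-renaming = id , id , (λ _ → refl) , (λ _ → refl) , (λ _ → refl)

  ≅-id : ∀ {C D : Clause sig} → C ≅ D → C ≅ (D ⟪ var ⟫)
  ≅-id {C} {D} = subst (C ≅_) (sym (clauseSub-id D))

  ClosId-refl : ∀ {c : Closure sig} → ClosId c c
  ClosId-refl = (var , id-renaming , ≅-id ≅-refl) , ≅-refl

  -- Stronger than ClosId, which only relates the ground instances up to ≅: here the values of the
  -- variables correspond, which is what preserves the normalization multisets.
  record RenamedFrom (c₁ c₂ : Closure sig) : Set where
    field
      ρ        : Subst sig
      renaming-ρ : IsRenaming ρ
      clause-≅ : proj₁ c₁ ≅ (proj₁ c₂ ⟪ ρ ⟫)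
      values   : ∀ x → OccursCl x (proj₁ c₂) → (ρ x) ⟨ proj₂ c₁ ⟩ ≡ proj₂ c₂ x

    inst-≅ : inst c₁ ≅ inst c₂
    inst-≅ = subst (inst c₁ ≅_) (trans (clauseSub-∘ (proj₁ c₂) ρ (proj₂ c₁)) (clauseSub-cong (proj₁ c₂) values))
      (≅-sub (proj₂ c₁) clause-≅)

    closId : ClosId c₁ c₂
    closId = (ρ , renaming-ρ , clause-≅) , inst-≅

    NM-rename : ∀ {R M} → NM R c₂ M → NM R c₁ M
    NM-rename {R} {M} (ls , els , Ms , pls , ts , ets , ns , pts , e) =
      map f ls , Enumerates-map f f-inj (InLss-rename renaming-ρ clause-≅) (InLss-rename⁻ renaming-ρ clause-≅) els ,
      Ms , Pointwise-map-∈ f (λ {e} i → contrib e (proj₁ (proj₂ els _) i)) pls ,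
      map f ts , Enumerates-map f f-inj (InLts-rename renaming-ρ clause-≅) (InLts-rename⁻ renaming-ρ clause-≅) ets ,
      ns , Pointwise-map-∈ f (λ i → contrib′ (proj₁ (proj₂ ets _) i)) pts , e
      where
      f : Term sig × ℕ → Term sig × ℕ
      f (t , m) = t ⟨ ρ ⟩ , m
      f-inj : ∀ {x y} → f x ≡ f y → x ≡ y
      f-inj e = cong₂ _,_ (rename-injective renaming-ρ (cong proj₁ e)) (cong proj₂ e)
      values* : ∀ t → (∀ x → Occurs x t → OccursCl x (proj₁ c₂)) → t ⟨ proj₂ c₂ ⟩ ≡ t ⟨ ρ ⟩ ⟨ proj₂ c₁ ⟩
      values* t occ = sym (trans (sub-∘ t ρ _) (sub-cong t λ x o → values x (occ x o)))
      contrib : ∀ e {K} → InLss (proj₁ c₂) e → LssContrib R (proj₂ c₂) e K → LssContrib R (proj₂ c₁) (f e) K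
      contrib (var x , m) l (c-var rm) with ρ x | proj₁ (proj₂ (proj₂ renaming-ρ)) x | values x (InLss-occurs l ([] , here))
      ... | _ | refl | v = c-var (subst (λ w → Rm R w _ _) (sym v) rm)
      contrib (fun g ts , m) l (c-fun nfs rm) =
        c-fun (go ts (λ i x o → InLss-occurs l (_ , there i (proj₂ o))) nfs) rm
        where
        go : ∀ {n} (ts : Vec (Term sig) n) {ts′ : Vec (Term sig) n} → (∀ i x → Occurs x (lookup ts i) → OccursCl x (proj₁ c₂)) →
          VPW.Pointwise (λ s s′ → NF R (s ⟨ proj₂ c₂ ⟩) s′) ts ts′ →
          VPW.Pointwise (λ s s′ → NF R (s ⟨ proj₂ c₁ ⟩) s′) (ts ⟨ ρ ⟩*) ts′
        go [] occ VPW.[] = VPW.[]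
        go (t ∷ ts) occ (nf VPW.∷ nfs) =
          subst (λ w → NF R w _) (values* t (occ zero)) nf VPW.∷ go ts (λ i → occ (suc i)) nfs
      contrib′ : ∀ {e k} → InLts (proj₁ c₂) e → LtsContrib R (proj₂ c₂) e k → LtsContrib R (proj₂ c₁) (f e) k
      contrib′ {t , _} l (c-lts nf) =
        c-lts (subst (λ w → NF R w _) (values* t λ x o → side-occurs (InLts-side l) o) nf)

  NM-resp-↭ : ∀ {R : RSys sig} {c M M′} → M ↭ M′ → NM R c M → NM R c M′
  NM-resp-↭ p (ls , els , Ms , pls , ts , ets , ns , pts , e) =
    ls , els , Ms , pls , ts , ets , ns , pts , ↭-trans (↭-sym p) e

-- Well-foundedness of the orderings

module Orders {sig : Signature} (ord : ReductionOrdering sig) where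
  open ReductionOrdering ord renaming (trans to ≻-trans; irrefl to ≻-irrefl)
  open GroundOrder ord

  private
    _≻L′_ = _≻L_ ord
    _≻C′_ = _≻C_ ord
    _≻TL′_ = _≻TL_ ord

  module TermExt = MulExtProperties {Term sig} {_≡_} {_≻_} isEquivalence
  module ClauseExt = MulExtProperties {Lit sig} {LitEq} {_≻L′_} LitEq-isEquivalence
  module LabelExt = MulExtProperties {Term sig × ℕ} {_≡_} {_≻TL′_} isEquivalence

  ≻L-wellFounded : WellFounded (flip _≻L′_)
  ≻L-wellFounded = On.wellFounded litMS
    (TermExt.≻≻-wellFounded (λ { refl g → g }) wf)

  ≻L-respˡ : ∀ {L L′ K} → LitEq L L′ → L ≻L′ K → L′ ≻L′ K
  ≻L-respˡ = TermExt.≻≻-respˡ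

  ≻L-respʳ : ∀ {L K K′} → LitEq K K′ → L ≻L′ K → L ≻L′ K′
  ≻L-respʳ = TermExt.≻≻-respʳ

  ≻C-wellFounded : WellFounded (flip _≻C′_)
  ≻C-wellFounded = ClauseExt.≻≻-wellFounded
    (λ {L} {L′} {K} e → ≻L-respˡ {L′} {L} {K} (TermMEq.≋-sym e)) ≻L-wellFounded

  ≻C-asym : ∀ {C D} → C ≻C′ D → ¬ (D ≻C′ C)
  ≻C-asym g h = wf⇒asym ≻C-wellFounded g h

  ≻-asym : ∀ {s t} → s ≻ t → ¬ (t ≻ s)
  ≻-asym g h = ≻-irrefl (≻-trans g h)

  ≻TL-wellFounded : WellFounded (flip _≻TL′_)
  ≻TL-wellFounded (t , m) = go (wf t) (<-wellFounded m)
    where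
    go : ∀ {t m} → Acc (flip _≻_) t → Acc _<_ m → Acc (flip _≻TL′_) (t , m)
    descend : ∀ {t m e} → Acc (flip _≻_) t → Acc _<_ m → (t , m) ≻TL′ e → Acc (flip _≻TL′_) e
    go at am = acc (descend at am)
    descend (acc rt) _ (inj₁ g) = go (rt g) (<-wellFounded _)
    descend at (acc rm) (inj₂ (refl , lt)) = go at (rm lt)

  ≻TL-irrefl : ∀ {e} → ¬ (e ≻TL′ e)
  ≻TL-irrefl (inj₁ g) = ≻-irrefl g
  ≻TL-irrefl (inj₂ (_ , lt)) = ℕₚ.<-irrefl refl lt

  ≻TL-trans : ∀ {d e f} → d ≻TL′ e → e ≻TL′ f → d ≻TL′ f
  ≻TL-trans (inj₁ g) (inj₁ h) = inj₁ (≻-trans g h)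
  ≻TL-trans (inj₁ g) (inj₂ (refl , _)) = inj₁ g
  ≻TL-trans (inj₂ (refl , _)) (inj₁ h) = inj₁ h
  ≻TL-trans (inj₂ (refl , lt)) (inj₂ (refl , lt′)) = inj₂ (refl , ℕₚ.<-trans lt′ lt)

  ≻L-sub : ∀ {L K} θ → L ≻L′ K → litSub θ L ≻L′ litSub θ K
  ≻L-sub {L} {K} θ g = subst₂ (MulExt _≡_ _≻_) (sym (litMS-sub θ L)) (sym (litMS-sub θ K))
    (MulExt-map (_⟨ θ ⟩) (cong (_⟨ θ ⟩)) (stable θ) g)

  ≻C-sub : ∀ {C D} θ → C ≻C′ D → (C ⟪ θ ⟫) ≻C′ (D ⟪ θ ⟫)
  ≻C-sub θ = MulExt-map (litSub θ) (λ {L} {L′} → LitEq-sub {L = L} {L′} θ) (λ {L} {K} → ≻L-sub {L} {K} θ)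

  ≻L-dominate : ∀ {L K s} → s ∈ litMS L → All (s ≻_) (litMS K) → L ≻L′ K
  ≻L-dominate i g = TermExt.≻≻-dominate i (All′.map (lose i) g)

  -- The entry `s` of `K` would be either shared with `L` or dominated by an entry of `L`, but all
  -- entries of `L` are below `s`.
  ¬≻L-of-smaller : ∀ {L K s} → s ∈ litMS K → All (s ≻_) (litMS L) → ¬ (L ≻L′ K)
  ¬≻L-of-smaller {L} {K} {s} i small (Z , X , Y , eM , eN , _ , dom)
    with ∈-++⁻ Z (∈-resp-↭ (MEq-≡⇒↭ eN) i)
  ... | inj₁ z = ≻-irrefl (All′.lookup small (∈-resp-↭ (↭-sym (MEq-≡⇒↭ eM)) (∈-++⁺ˡ z)))
  ... | inj₂ y with find (All′.lookup dom y)
  ...   | x , x∈X , x≻s =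
          ≻-asym x≻s (All′.lookup small (∈-resp-↭ (↭-sym (MEq-≡⇒↭ eM)) (∈-++⁺ʳ Z x∈X)))

  ¬LitEq-of-smaller : ∀ {L K s} → s ∈ litMS K → All (s ≻_) (litMS L) → ¬ LitEq L K
  ¬LitEq-of-smaller i small e = ≻-irrefl (All′.lookup small (∈-resp-↭ (↭-sym (MEq-≡⇒↭ e)) i))

module ClosureOrder {sig : Signature} (em : ExcludedMiddle 0ℓ) (ord : ReductionOrdering sig)
  (clo : ClosureOrdering sig) {R : RSys sig} (adm : Admissible ord R) where
  open Signature sig
  open Orders ord
  open Rewriting em ord adm
  open ClosureOrdering clo using (_≻Clo_; respects) renaming (wf to Clo-wellFounded)

  LssContrib-exists : ∀ θ e → ∃ λ M → LssContrib R θ e M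
  LssContrib-exists θ (var x , m) with Rm-exists (θ x) m
  ... | M , rm = M , c-var rm
  LssContrib-exists θ (fun f ts , m) with args ts
    where
    args : ∀ {n} (ts : Vec (Term sig) n) → ∃ λ (ts′ : Vec (Term sig) n) →
      VPW.Pointwise (λ s s′ → NF R (s ⟨ θ ⟩) s′) ts ts′
    args [] = [] , VPW.[]
    args (t ∷ ts) with NF-exists (t ⟨ θ ⟩) | args ts
    ... | n , nf | ns , nfs = n ∷ ns , nf VPW.∷ nfs
  ... | ts′ , nfs with Rm-exists (fun f ts′) m
  ...   | M , rm = M , c-fun nfs rm

  LssContrib-unique : ∀ {θ e M M′} → LssContrib R θ e M → LssContrib R θ e M′ → M ↭ M′
  LssContrib-unique (c-var rm) (c-var rm′) = Rm-unique rm rm′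
  LssContrib-unique {θ} (c-fun nfs rm) (c-fun nfs′ rm′) with args nfs nfs′
    where
    args : ∀ {n} {ts ts′ ts″ : Vec (Term sig) n} → VPW.Pointwise (λ s s′ → NF R (s ⟨ θ ⟩) s′) ts ts′ →
      VPW.Pointwise (λ s s′ → NF R (s ⟨ θ ⟩) s′) ts ts″ → ts′ ≡ ts″
    args VPW.[] VPW.[] = refl
    args (n VPW.∷ ns) (n′ VPW.∷ ns′) = cong₂ _∷_ (NF-unique n n′) (args ns ns′)
  ... | refl = Rm-unique rm rm′

  LtsContrib-exists : ∀ θ e → ∃ λ n → LtsContrib R θ e n
  LtsContrib-exists θ (t , m) with NF-exists (t ⟨ θ ⟩)
  ... | n , nf = (n , m) , c-lts nf

  LtsContrib-unique : ∀ {θ e n n′} → LtsContrib R θ e n → LtsContrib R θ e n′ → n ≡ n′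
  LtsContrib-unique (c-lts nf) (c-lts nf′) = cong (_, _) (NF-unique nf nf′)

  NM-from : ∀ {C θ ls ts} → Enumerates (InLss C) ls → Enumerates (InLts C) ts → ∃ λ M → NM R (C , θ) M
  NM-from {C} {θ} {ls} {ts} els ets
    with Pointwise-exists (LssContrib-exists θ) ls | Pointwise-exists (LtsContrib-exists θ) ts
  ... | Ms , pls | ns , pts = _ , ls , els , Ms , pls , ts , ets , ns , pts , refl

  NM-exists : ∀ c → ∃ λ M → NM R c M
  NM-exists (C , θ) = NM-from (proj₂ (InLss-enumerable em C)) (proj₂ (InLts-enumerable em C))

  -- Makes the relation `NM` a function up to order: duplicate-free enumerations are permutations of
  -- each other, and neither the reductions nor the normal forms leave a choice.
  NM-unique : ∀ {c M M′} → NM R c M → NM R c M′ → M ↭ M′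
  NM-unique (ls , els , Ms , pls , ts , ets , ns , pts , e) (ls′ , els′ , Ms′ , pls′ , ts′ , ets′ , ns′ , pts′ , e′)
    with ↭-pointwise (Enumerates-unique els els′) pls | ↭-pointwise (Enumerates-unique ets ets′) pts
  ... | Ms″ , pls″ , p | ns″ , pts″ , q =
        ↭-trans e (↭-trans (++⁺
          (↭-trans (concat-↭ p) (concat-pointwise-↭ (Pointwise-functional LssContrib-unique pls″ pls′)))
          (↭-trans q (↭-reflexive (Pointwise-≡⇒≡ (Pointwise-functional LtsContrib-unique pts″ pts′)))))
          (↭-sym e′))

  NM-rename⁻ : ∀ {c₁ c₂ M} → RenamedFrom c₁ c₂ → NM R c₁ M → NM R c₂ M
  NM-rename⁻ {c₂ = c₂} r nm with NM-exists c₂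
  ... | M′ , nm′ = NM-resp-↭ (NM-unique (RenamedFrom.NM-rename r nm′) nm) nm′

  private
    _≻≻_ = NMGt ord clo R

  NMGt-renameˡ : ∀ {c₁ c₂ d} → RenamedFrom c₁ c₂ → c₁ ≻≻ d → c₂ ≻≻ d
  NMGt-renameˡ {c₁} {c₂} {d} r (M , M′ , nm , nm′ , gt) = M , M′ , NM-rename⁻ r nm , nm′ , lower gt
    where
    lower : MulExt _≡_ (_≻TL_ ord) M M′ ⊎ _ → _
    lower (inj₁ g) = inj₁ g
    lower (inj₂ (e , inj₁ g)) = inj₂ (e , inj₁ (ClauseExt.≻≻-respˡ (RenamedFrom.inst-≅ r) g))
    lower (inj₂ (e , inj₂ (q , g))) = inj₂ (e , inj₂
      (≅-trans (≅-sym (RenamedFrom.inst-≅ r)) q , respects (RenamedFrom.closId r) ClosId-refl g))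

  NMGt-renameʳ : ∀ {c d₁ d₂} → RenamedFrom d₁ d₂ → c ≻≻ d₁ → c ≻≻ d₂
  NMGt-renameʳ {c} {d₁} {d₂} r (M , M′ , nm , nm′ , gt) = M , M′ , nm , NM-rename⁻ r nm′ , lower gt
    where
    lower : MulExt _≡_ (_≻TL_ ord) M M′ ⊎ _ → _
    lower (inj₁ g) = inj₁ g
    lower (inj₂ (e , inj₁ g)) = inj₂ (e , inj₁ (ClauseExt.≻≻-respʳ (RenamedFrom.inst-≅ r) g))
    lower (inj₂ (e , inj₂ (q , g))) = inj₂ (e , inj₂
      (≅-trans q (RenamedFrom.inst-≅ r) , respects ClosId-refl (RenamedFrom.closId r) g))

  -- Each comparison chooses its own multisets, and ties hold only up to permutation or `≅`. The
  -- lexicographic induction therefore fixes representatives `M` and `I` with their accessibility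
  -- proofs, and carries along that the current closure still has them as measure and instance.
  NMGt-wellFounded : WellFounded (flip _≻≻_)
  NMGt-wellFounded c with NM-exists c
  ... | M , nm = go nm (LabelExt.≻≻-wellFounded (λ { refl g → g }) ≻TL-wellFounded M)
                   ≅-refl (≻C-wellFounded (inst c)) (Clo-wellFounded c)
    where
    go : ∀ {c M I} → NM R c M → Acc (flip (MulExt _≡_ (_≻TL_ ord))) M →
      inst c ≅ I → Acc (flip (_≻C_ ord)) I → Acc (flip _≻Clo_) c → Acc (flip _≻≻_) c
    descend : ∀ {c d M I} → NM R c M → Acc (flip (MulExt _≡_ (_≻TL_ ord))) M →
      inst c ≅ I → Acc (flip (_≻C_ ord)) I → Acc (flip _≻Clo_) c → c ≻≻ d → Acc (flip _≻≻_) d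
    go nm aM e aI ac = acc (descend nm aM e aI ac)
    descend nm (acc rM) e _ _ (M₁ , M₂ , nm₁ , nm₂ , inj₁ g) =
      go nm₂ (rM (LabelExt.≻≻-respˡ (_ , NM-unique nm₁ nm , PW.refl refl) g)) ≅-refl
        (≻C-wellFounded _) (Clo-wellFounded _)
    descend nm aM e (acc rI) _ (M₁ , M₂ , nm₁ , nm₂ , inj₂ (q , inj₁ g)) =
      go (NM-resp-↭ (↭-trans (↭-sym (MEq-≡⇒↭ q)) (NM-unique nm₁ nm)) nm₂) aM ≅-refl
        (rI (ClauseExt.≻≻-respˡ e g)) (Clo-wellFounded _)
    descend nm aM e aI (acc rc) (M₁ , M₂ , nm₁ , nm₂ , inj₂ (q , inj₂ (s , g))) =
      go (NM-resp-↭ (↭-trans (↭-sym (MEq-≡⇒↭ q)) (NM-unique nm₁ nm)) nm₂) aM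
        (≅-trans (≅-sym s) e) aI (rc g)

  NMGt-asym : ∀ {c d} → c ≻≻ d → ¬ (d ≻≻ c)
  NMGt-asym g h = wf⇒asym NMGt-wellFounded g h

-- The candidate model

minimal-exists : ExcludedMiddle 0ℓ → ∀ {A : Set} {_>_ : A → A → Set} → WellFounded (flip _>_) →
  (P : A → Set) → ∀ {x} → P x → ∃ λ y → P y × (∀ z → P z → ¬ (y > z))
minimal-exists em {A} {_>_} wf P {x} = go (wf x)
  where
  go : ∀ {x} → Acc (flip _>_) x → P x → ∃ λ y → P y × (∀ z → P z → ¬ (y > z))
  go {x} (acc rs) p with em {P = ∃ λ z → P z × x > z}
  ... | yes (z , q , g) = go (rs g) q
  ... | no none = x , p , λ z q g → none (z , q , g)

module _ {sig : Signature} where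
  open Signature sig

  _⇔ᴿ_ : RSys sig → RSys sig → Set
  S ⇔ᴿ S′ = ∀ {u v} → (S u v → S′ u v) × (S′ u v → S u v)

  ⇔ᴿ-sym : ∀ {S S′} → S ⇔ᴿ S′ → S′ ⇔ᴿ S
  ⇔ᴿ-sym e = proj₂ e , proj₁ e

  module _ {S S′ : RSys sig} (e : S ⇔ᴿ S′) where
    open Locality {R = S} {S′} (λ _ → ⊤) (λ _ _ → tt) (λ _ _ → e)

    Irreducible-ext : ∀ {t} → Irreducible S t → Irreducible S′ t
    Irreducible-ext = Irreducible-local tt

    EqStep-ext : ∀ {a b} → EqClosure (Step S) a b → EqClosure (Step S′) a b
    EqStep-ext = EqC.map (Step-local tt)

    LssContrib-ext : ∀ {θ e M} → LssContrib S θ e M → LssContrib S′ θ e M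
    LssContrib-ext (c-var rm) = c-var (Rm-local tt rm)
    LssContrib-ext (c-fun nfs rm) = c-fun (VPW.map (NF-local tt) nfs) (Rm-local tt rm)

    LtsContrib-ext : ∀ {θ e n} → LtsContrib S θ e n → LtsContrib S′ θ e n
    LtsContrib-ext (c-lts nf) = c-lts (NF-local tt nf)

    NM-ext : ∀ {c M} → NM S c M → NM S′ c M
    NM-ext (ls , els , Ms , pls , ts , ets , ns , pts , p) =
      ls , els , Ms , PW.map LssContrib-ext pls , ts , ets , ns , PW.map LtsContrib-ext pts , p

    NMGt-ext : ∀ (ord : ReductionOrdering sig) (clo : ClosureOrdering sig) {c d} →
      NMGt ord clo S c d → NMGt ord clo S′ c d
    NMGt-ext ord clo (M , M′ , nm , nm′ , g) = M , M′ , NM-ext nm , NM-ext nm′ , g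

module Construction {sig : Signature} (em : ExcludedMiddle 0ℓ) (ord : ReductionOrdering sig)
  (clo : ClosureOrdering sig) (N : Clause sig → Set) where
  open Signature sig
  open ReductionOrdering ord renaming (trans to ≻-trans; irrefl to ≻-irrefl)
  open GroundOrder ord
  open Orders ord using (≻-asym)

  data RefutedBelow (S : RSys sig) (s : Term sig) : Lit sig → Set where
    refuted : ∀ {a b} → s ≻ a → s ≻ b → EqClosure (Step S) a b → RefutedBelow S s (neg a b)

  -- Separated from irreducibility of `s`, because the refutation of a positive literal needs these
  -- facts before it is known whether `s` is reducible. The clause is matched only up to `≅`, which
  -- makes the order of literals and of sides immaterial.
  record MaximalSide (S : RSys sig) (s s′ : Term sig) (c : Closure sig) : Set where
    field
      in-𝒢N  : 𝒢 N c
      {t t′} : Term sig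
      {D′}   : Clause sig
      shape  : proj₁ c ≅ (pos t t′ ∷ D′)
      lhs    : t ⟨ proj₂ c ⟩ ≡ s
      rhs    : t′ ⟨ proj₂ c ⟩ ≡ s′
      orient : s ≻ s′
      rest   : All (RefutedBelow S s) (D′ ⟪ proj₂ c ⟫)

    ground-shape : GroundCl ((pos t t′ ∷ D′) ⟪ proj₂ c ⟫)
    ground-shape = GroundCl-≅ (≅-sub (proj₂ c) shape) (proj₂ in-𝒢N)

    ground-lhs : Ground s
    ground-lhs with ground-shape
    ... | (g ∷ _) ∷ _ = subst Ground lhs g

    ground-rhs : Ground s′
    ground-rhs with ground-shape
    ... | (_ ∷ g ∷ []) ∷ _ = subst Ground rhs g

  -- For S = R< s these are the closures that may produce s → s′; Hornness is built in through
  -- RefutedBelow, which admits negative literals only.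
  record Candidate (S : RSys sig) (s s′ : Term sig) (c : Closure sig) : Set where
    field
      maximalSide : MaximalSide S s s′ c
      irreducible : Irreducible S s
    open MaximalSide maximalSide public

  Minimal : RSys sig → Term sig → Closure sig → Set
  Minimal S s c = ∀ c₂ s₂ → Candidate S s s₂ c₂ → ¬ NMGt ord clo S c c₂

  Producible : RSys sig → Term sig → Term sig → Set
  Producible S s s′ = ∃ λ c → Candidate S s s′ c × Minimal S s c

  -- Minimal candidates need not agree on the right-hand side; the ≻-least one is taken.
  Produces : RSys sig → Term sig → Term sig → Set
  Produces S s s′ = Producible S s s′ × (∀ s₂ → Producible S s s₂ → ¬ (s′ ≻ s₂))

  module _ {S S′ : RSys sig} (e : S ⇔ᴿ S′) where
    Candidate-ext : ∀ {s s′ c} → Candidate S s s′ c → Candidate S′ s s′ c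
    Candidate-ext cd = record
      { maximalSide = record
          { in-𝒢N = in-𝒢N ; shape = shape ; lhs = lhs ; rhs = rhs ; orient = orient
          ; rest = All′.map (λ { (refuted g h q) → refuted g h (EqStep-ext e q) }) rest }
      ; irreducible = Irreducible-ext e irreducible }
      where open Candidate cd

  Producible-ext : ∀ {S S′ : RSys sig} → S ⇔ᴿ S′ → ∀ {s s′} → Producible S s s′ → Producible S′ s s′
  Producible-ext {S} {S′} e (c , cd , min) = c , Candidate-ext e cd ,
    λ c₂ s₂ cd₂ g → min c₂ s₂ (Candidate-ext (⇔ᴿ-sym {S = S} {S′} e) cd₂)
      (NMGt-ext (⇔ᴿ-sym {S = S} {S′} e) ord clo g)

  Produces-ext : ∀ {S S′ : RSys sig} → S ⇔ᴿ S′ → ∀ {s s′} → Produces S s s′ → Produces S′ s s′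
  Produces-ext {S} {S′} e (prd , least) = Producible-ext {S} {S′} e prd ,
    λ s₂ prd₂ → least s₂ (Producible-ext {S′} {S} (⇔ᴿ-sym {S = S} {S′} e) prd₂)

  -- The system inside is `R< s`, written through the accessibility proof so that the recursion is
  -- structural.
  rulesFor : ∀ s → Acc (flip _≻_) s → Term sig → Set
  rulesFor s (acc rs) = Produces (λ u v → Σ (s ≻ u) λ g → rulesFor u (rs g) v) s

  -- Systems built from different accessibility proofs are only mutually included, not
  -- propositionally equal. Hence the preceding lemmas, by which production depends on a system only
  -- up to `⇔ᴿ`.
  rulesFor-irrelevant : ∀ {s s′} (a a′ : Acc (flip _≻_) s) → rulesFor s a s′ → rulesFor s a′ s′
  rulesFor-irrelevant (acc rs) (acc rs′) = Produces-ext
    ((λ { (g , r) → g , rulesFor-irrelevant (rs g) (rs′ g) r }) ,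
     (λ { (g , r) → g , rulesFor-irrelevant (rs′ g) (rs g) r }))

  R∞ : RSys sig
  R∞ u v = rulesFor u (wf u) v

  R< : Term sig → RSys sig
  R< s u v = s ≻ u × R∞ u v

  R∞⇒Produces : ∀ {s s′} → R∞ s s′ → Produces (R< s) s s′
  R∞⇒Produces {s} {s′} = go (wf s)
    where
    go : ∀ a → rulesFor s a s′ → Produces (R< s) s s′
    go (acc rs) = Produces-ext
      ((λ { (g , r) → g , rulesFor-irrelevant (rs g) (wf _) r }) ,
       (λ { (g , r) → g , rulesFor-irrelevant (wf _) (rs g) r }))

  Produces⇒R∞ : ∀ {s s′} → Produces (R< s) s s′ → R∞ s s′
  Produces⇒R∞ {s} {s′} = go (wf s)
    where
    go : ∀ a → Produces (R< s) s s′ → rulesFor s a s′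
    go (acc rs) = Produces-ext
      ((λ { (g , r) → g , rulesFor-irrelevant (wf _) (rs g) r }) ,
       (λ { (g , r) → g , rulesFor-irrelevant (rs g) (wf _) r }))

  R∞-candidate : ∀ {s s′} → R∞ s s′ → Producible (R< s) s s′
  R∞-candidate r = proj₁ (R∞⇒Produces r)

  -- Two rules with the same left-hand side agree by leastness of the right-hand side. A left-hand
  -- side strictly inside `u` is smaller than `u`, so its rule already belongs to `R< u`, under
  -- which `u` is irreducible.
  R∞-left-reduced : LeftReduced R∞
  R∞-left-reduced u v u′ v′ p r r′ a with R∞-candidate r | R∞-candidate r′
  R∞-left-reduced u v u′ v′ [] r r′ here | c , cd , _ | c′ , cd′ , _
    with total (Candidate.ground-rhs cd) (Candidate.ground-rhs cd′)
  ... | inj₁ g = ⊥-elim (proj₂ (R∞⇒Produces r) v′ (R∞-candidate r′) g)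
  ... | inj₂ (inj₁ e) = refl , sym e
  ... | inj₂ (inj₂ g) = ⊥-elim (proj₂ (R∞⇒Produces r′) v (R∞-candidate r) g)
  R∞-left-reduced u v u′ v′ (_ ∷ _) r r′ a | c , cd , _ | c′ , cd′ , _ =
    ⊥-elim (Candidate.irreducible cd _
      (_ , u′ , v′ , (subterm-≻ (λ ()) (Candidate.ground-lhs cd) a , r′) , a , proj₂ (Repl-exists a v′)))

  R∞-admissible : Admissible ord R∞
  R∞-admissible = R∞-left-reduced ,
    (λ u v r → Candidate.ground-lhs (proj₁ (proj₂ (R∞-candidate r))) , Candidate.ground-rhs (proj₁ (proj₂ (R∞-candidate r)))) ,
    (λ u v r → Candidate.orient (proj₁ (proj₂ (R∞-candidate r))))

  R<-admissible : ∀ s → Admissible ord (R< s)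
  R<-admissible s = (λ u v u′ v′ p r r′ → R∞-left-reduced u v u′ v′ p (proj₂ r) (proj₂ r′)) ,
    (λ u v r → proj₁ (proj₂ R∞-admissible) u v (proj₂ r)) ,
    (λ u v r → proj₂ (proj₂ R∞-admissible) u v (proj₂ r))

  R∞-produces : ∀ {s s₂ c} → Candidate (R< s) s s₂ c → ∃ λ s′ → R∞ s s′
  R∞-produces {s} {s₂} {c} cd
    with minimal-exists em (ClosureOrder.NMGt-wellFounded em ord clo (R<-admissible s))
           (λ c → ∃ λ s₂ → Candidate (R< s) s s₂ c) (s₂ , cd)
  ... | c₁ , (s₁ , cd₁) , min
    -- Being producible includes minimality of the closure, so this second minimization ranges over
    -- right-hand sides only.
    with minimal-exists em wf (Producible (R< s) s) (c₁ , cd₁ , λ c₂ s₂ cd₂ → min c₂ (s₂ , cd₂))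
  ...   | s′ , prd , least = s′ , Produces⇒R∞ (prd , least)

-- Measuring candidates in the partial and in the limit system

Pointwise-map-with : ∀ {A B : Set} {P : A → Set} {Q : B → Set} {R S : A → B → Set} →
  (∀ {x y} → P x → R x y → S x y × Q y) → ∀ {xs ys} → All P xs → Pointwise R xs ys → Pointwise S xs ys × All Q ys
Pointwise-map-with f [] [] = [] , []
Pointwise-map-with f (p ∷ ps) (r ∷ rs) with f p r | Pointwise-map-with f ps rs
... | s , q | ss , qs = s ∷ ss , q ∷ qs

module CandidateMeasure {sig : Signature} (em : ExcludedMiddle 0ℓ) (ord : ReductionOrdering sig)
  (clo : ClosureOrdering sig) (N : Clause sig → Set) where
  open Signature sig
  open ReductionOrdering ord renaming (trans to ≻-trans; irrefl to ≻-irrefl)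
  open GroundOrder ord
  open Orders ord
  open Construction em ord clo N
  open Rewriting em ord R∞-admissible
  open ClosureOrder em ord clo R∞-admissible

  Step-ground : ∀ {t t′} → Ground t → Step R∞ t t′ → Ground t′
  Step-ground g (_ , u , v , r , a , rp) = Ground-Repl g (proj₂ (proj₁ (proj₂ R∞-admissible) u v r)) rp

  Star-ground : ∀ {t t′} → Ground t → Star (Step R∞) t t′ → Ground t′
  Star-ground g ε = g
  Star-ground g (s ◅ ss) = Star-ground (Step-ground g s) ss

  GroundBelow : Term sig → Term sig → Set
  GroundBelow s t = Ground t × s ≻ t

  module Below (s : Term sig) where
    Step-GroundBelow : ∀ {t t′} → GroundBelow s t → Step R∞ t t′ → GroundBelow s t′
    Step-GroundBelow (g , h) st = Step-ground g st , ≻-trans h (Step-≻ st)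

    rules-agree : ∀ {t p u v} → GroundBelow s t → At t p u → (R∞ u v → R< s u v) × (R< s u v → R∞ u v)
    rules-agree (g , h) a = (λ r → ≻-≽ h (subterm-≽ g a) , r) , proj₂

    open Locality {R = R∞} {R< s} (GroundBelow s) Step-GroundBelow rules-agree public

    Star-GroundBelow : ∀ {t t′} → GroundBelow s t → Star (Step R∞) t t′ → GroundBelow s t′
    Star-GroundBelow (g , h) ss = Star-ground g ss , ≻-≽ h (Star-≽ ss)

    -- A conversion may climb above `s`, but it can be replaced by a join at the common normal form,
    -- and descending derivations from below `s` use rules of `R< s` only.
    EqStep-below : ∀ {a b} → GroundBelow s a → GroundBelow s b →
      EqClosure (Step R∞) a b → EqClosure (Step (R< s)) a b
    EqStep-below {a} {b} ga gb e with NF-exists a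
    ... | n , nf = St.map fwd (proj₁ (NF-local ga nf)) ◅◅
                   EqStep-sym (St.map fwd (proj₁ (NF-local gb (NF-EqStep e nf))))

  R<⇒R∞-EqStep : ∀ {s a b} → EqClosure (Step (R< s)) a b → EqClosure (Step R∞) a b
  R<⇒R∞-EqStep = EqC.map λ { (p , u , v , r , a , rp) → p , u , v , proj₂ r , a , rp }

  -- With irreducible proper subterms, normalizing the arguments changes nothing, so a variable and
  -- a function term with the same instance contribute alike. Competing candidates may present `s`
  -- in either form.
  LssContrib-top : ∀ {Q : RSys sig} {θ} t {m M} → (∀ {p w} → p ≢ [] → At (t ⟨ θ ⟩) p w → Irreducible Q w) →
    Rm Q (t ⟨ θ ⟩) m M → LssContrib Q θ (t , m) M
  LssContrib-top (var x) irr rm = c-var rm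
  LssContrib-top {Q} {θ} (fun f ts) irr rm =
    c-fun (args ts (λ i → irr (λ ()) (there i (subst (λ w → At w [] (lookup ts i ⟨ θ ⟩)) (sym (lookup-sub ts i θ)) here)))) rm
    where
    args : ∀ {n} (ts : Vec (Term sig) n) → (∀ i → Irreducible Q (lookup ts i ⟨ θ ⟩)) →
      VPW.Pointwise (λ s s′ → NF Q (s ⟨ θ ⟩) s′) ts (ts ⟨ θ ⟩*)
    args [] _ = VPW.[]
    args (t ∷ ts) irr = (ε , irr zero) VPW.∷ args ts (λ i → irr (suc i))

  module _ {s : Term sig} where
    open Below s

    LssContrib-below : ∀ {θ e M} → GroundBelow s (proj₁ e ⟨ θ ⟩) → LssContrib R∞ θ e M →
      LssContrib (R< s) θ e M × All (λ k → s ≻ proj₁ k) M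
    LssContrib-below (g , h) (c-var rm) = c-var (Rm-local (g , h) rm) , Rm-below g h rm
    LssContrib-below {θ} (g , h) (c-fun {f} {ts} {ts′} nfs rm) =
      c-fun (args ts (λ i → arg-below i) nfs) (Rm-local gb rm) , Rm-below (proj₁ gb) (proj₂ gb) rm
      where
      gb = Star-GroundBelow (g , h) (NF-args-Star nfs)
      arg-below : ∀ i → GroundBelow s (lookup ts i ⟨ θ ⟩)
      arg-below i = Ground-At g a , ≻-trans h (subterm-≻ (λ ()) g a)
        where
        a : At (fun f (ts ⟨ θ ⟩*)) (toℕ i ∷ []) (lookup ts i ⟨ θ ⟩)
        a = there i (subst (λ w → At w [] (lookup ts i ⟨ θ ⟩)) (sym (lookup-sub ts i θ)) here)
      args : ∀ {n} (ts : Vec (Term sig) n) {ts′ : Vec (Term sig) n} → (∀ i → GroundBelow s (lookup ts i ⟨ θ ⟩)) →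
        VPW.Pointwise (λ s s′ → NF R∞ (s ⟨ θ ⟩) s′) ts ts′ → VPW.Pointwise (λ s′ s″ → NF (R< s) (s′ ⟨ θ ⟩) s″) ts ts′
      args [] _ VPW.[] = VPW.[]
      args (t ∷ ts) gb (nf VPW.∷ nfs) = NF-local (gb zero) nf VPW.∷ args ts (λ i → gb (suc i)) nfs

    LtsContrib-below : ∀ {θ e k} → GroundBelow s (proj₁ e ⟨ θ ⟩) → LtsContrib R∞ θ e k →
      LtsContrib (R< s) θ e k × s ≻ proj₁ k
    LtsContrib-below (g , h) (c-lts nf) = c-lts (NF-local (g , h) nf) , ≻-≽ h (Star-≽ (proj₁ nf))

  module _ {S : RSys sig} {s s₂ : Term sig} {c : Closure sig} (ms : MaximalSide S s s₂ c) where
    open MaximalSide ms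
    private
      C = proj₁ c
      θ = proj₂ c

      rest-negative : ∀ {L a} → L ∈ D′ → NegSide L a → s ≻ (a ⟨ θ ⟩)
      rest-negative i sd with All′.lookup rest (∈-map⁺ (litSub θ) i) | sd
      ... | refuted g h _ | nl = g
      ... | refuted g h _ | nr = h

      rest-positive : ∀ {L a} → L ∈ D′ → ¬ PosSide L a
      rest-positive i sd with All′.lookup rest (∈-map⁺ (litSub θ) i) | sd
      ... | () | pl
      ... | () | pr

    neg-side-below : ∀ {a} → InTSneg C a → s ≻ (a ⟨ θ ⟩)
    neg-side-below i with InSide-≅ negSide shape i
    ... | _ , here refl , ()
    ... | _ , there j , sd = rest-negative j sd

    pos-side : ∀ {a} → InTSpos C a → a ≡ t ⊎ a ≡ t′
    pos-side i with InSide-≅ posSide shape i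
    ... | _ , here refl , pl = inj₁ refl
    ... | _ , here refl , pr = inj₂ refl
    ... | _ , there j , sd = ⊥-elim (rest-positive j sd)

    private
      s≻t′ : s ≻ (t′ ⟨ θ ⟩)
      s≻t′ = subst (s ≻_) (sym rhs) orient

    ssneg-below : ∀ {a} → InSSneg C a → s ≻ (a ⟨ θ ⟩)
    ssneg-below (L , i , b , sd , p , at) = ≻-≽ (neg-side-below (L , i , sd))
      (subterm-≽ (InSide-ground negSide (proj₂ in-𝒢N) (L , i , sd)) (At-sub θ at))

    sspos-below : ∀ {a} → InSSposProper C a → s ≻ (a ⟨ θ ⟩)
    sspos-below (L , i , b , sd , p , ne , at) with pos-side (L , i , sd)
    ... | inj₁ refl = subst (_≻ _) lhs (subterm-≻ ne (subst Ground (sym lhs) ground-lhs) (At-sub θ at))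
    ... | inj₂ refl = ≻-≽ s≻t′ (subterm-≽ (subst Ground (sym rhs) ground-rhs) (At-sub θ at))

    lss-below : ∀ {e} → InLss C e → e ≢ (t , 0) → s ≻ (proj₁ e ⟨ θ ⟩)
    lss-below (l2 a) _ = ssneg-below a
    lss-below (l1 a _) _ = sspos-below a
    lss-below (l0 a _ _) ne with pos-side a
    ... | inj₁ refl = ⊥-elim (ne refl)
    ... | inj₂ refl = s≻t′

    lts-below : ∀ {e} → InLts C e → e ≢ (t , 0) → s ≻ (proj₁ e ⟨ θ ⟩)
    lts-below (t2 a) _ = neg-side-below a
    lts-below (t0 a _) ne with pos-side a
    ... | inj₁ refl = ⊥-elim (ne refl)
    ... | inj₂ refl = s≻t′

    private
      not-below : ¬ (s ≻ (t ⟨ θ ⟩))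
      not-below g = ≻-irrefl (subst (s ≻_) lhs g)

      top-side : InTSpos C t
      top-side = InSide-≅ posSide (≅-sym shape) (_ , here refl , pl)

    -- Everything in negative literals or below the top has an instance smaller than `s`, so a term
    -- with instance `s` can carry label 0 only.
    lss-top : InLss C (t , 0)
    lss-top = l0 top-side (λ a → not-below (sspos-below a)) (λ a → not-below (ssneg-below a))

    lts-top : InLts C (t , 0)
    lts-top = t0 top-side (λ a → not-below (neg-side-below a))

  -- Replacing R< s by R∞ changes the multiset of a candidate only by turning the entry (s , 0)
  -- of the maximal side into a multiset that depends on the rule s → s′ alone.
  module _ {s s′ : Term sig} (r : R∞ s s′) where
    open Below s

    top-rm : ∃ λ M → Rm R∞ s 0 M
    top-rm = Rm-exists s 0

    top-nf : ∃ λ n → NF R∞ s n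
    top-nf = NF-exists s

    topEntries : List (Term sig × ℕ)
    topEntries = proj₁ top-rm ++ (proj₁ top-nf , 0) ∷ []

    candidate-NM : ∀ {s₂ c} → Candidate (R< s) s s₂ c → ∃ λ A →
      NM R∞ c (topEntries ++ A) × NM (R< s) c ((s , 0) ∷ A) × All (λ k → s ≻ proj₁ k) A
    candidate-NM {s₂} {c@(C , θ)} cd
      with Enumerates-exists em {P = λ e → InLss C e × e ≢ (Candidate.t cd , 0)} (proj₁ (InLss-enumerable em C))
             (λ e p → proj₂ (proj₂ (proj₂ (InLss-enumerable em C)) e) (proj₁ p))
         | Enumerates-exists em {P = λ e → InLts C e × e ≢ (Candidate.t cd , 0)} (proj₁ (InLts-enumerable em C))
             (λ e p → proj₂ (proj₂ (proj₂ (InLts-enumerable em C)) e) (proj₁ p))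
    ... | ls , els | ts , ets
      -- The enumerations omit `(t , 0)`, so their contributions involve only terms below `s`.
      -- Computed for `R∞`, they serve unchanged for `R< s`, where the two systems agree.
      with Pointwise-exists (LssContrib-exists θ) ls | Pointwise-exists (LtsContrib-exists θ) ts
    ... | Ms , pls | ns , pts
      with Pointwise-map-with LssContrib-below
             (All′.tabulate (λ {e} i → let l , ne = proj₁ (proj₂ els e) i in
               InLss-ground (proj₂ (Candidate.in-𝒢N cd)) l , lss-below (Candidate.maximalSide cd) l ne)) pls
         | Pointwise-map-with LtsContrib-below
             (All′.tabulate (λ {e} i → let l , ne = proj₁ (proj₂ ets e) i in
               side-ground (proj₂ (Candidate.in-𝒢N cd)) (InLts-side l) , lts-below (Candidate.maximalSide cd) l ne)) pts
    ... | pls< , Ms-below | pts< , ns-below =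
      concat Ms ++ ns ,
      ((t , 0) ∷ ls , Enumerates-∷ em (lss-top (Candidate.maximalSide cd)) els , _ ,
        LssContrib-top t top-irr∞ (subst (λ w → Rm R∞ w 0 _) (sym lhs) (proj₂ top-rm)) ∷ pls ,
        (t , 0) ∷ ts , Enumerates-∷ em (lts-top (Candidate.maximalSide cd)) ets , _ ,
        c-lts (subst (λ w → NF R∞ w _) (sym lhs) (proj₂ top-nf)) ∷ pts ,
        shuffle (proj₁ top-rm) (proj₁ top-nf , 0) (concat Ms) ns) ,
      ((t , 0) ∷ ls , Enumerates-∷ em (lss-top (Candidate.maximalSide cd)) els , _ ,
        LssContrib-top t top-irr< (rm-irr (subst (Irreducible (R< s)) (sym lhs) irreducible)) ∷ pls< ,
        (t , 0) ∷ ts , Enumerates-∷ em (lts-top (Candidate.maximalSide cd)) ets , _ ,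
        c-lts (subst (λ w → NF (R< s) w s) (sym lhs) (ε , irreducible)) ∷ pts< ,
        shuffle [] (s , 0) (concat Ms) ns) ,
      AllP.++⁺ (AllP.concat⁺ Ms-below) ns-below
      where
      open Candidate cd
      shuffle : ∀ {A : Set} (K : List A) k M n → (K ++ k ∷ []) ++ M ++ n ↭ (K ++ M) ++ k ∷ n
      shuffle K k M n = ↭-trans (↭-reflexive (++-assoc K (k ∷ []) (M ++ n)))
        (↭-trans (++⁺ˡ K (↭-sym (shift k M n))) (↭-reflexive (sym (++-assoc K M (k ∷ n)))))
      top-irr∞ : ∀ {p w} → p ≢ [] → At (t ⟨ θ ⟩) p w → Irreducible R∞ w
      top-irr∞ ne a = lhs-subterm-irreducible r ne (subst (λ w → At w _ _) lhs a)
      top-irr< : ∀ {p w} → p ≢ [] → At (t ⟨ θ ⟩) p w → Irreducible (R< s) w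
      top-irr< {p} {w} ne a w′ (q , u , v , r′ , b , rp) =
        irreducible _ (_ , u , v , r′ , subst (λ w → At w _ _) lhs (At-++ a b) ,
          proj₂ (Repl-exists (subst (λ w → At w _ _) lhs (At-++ a b)) v))

    -- Consequently a single entry `(s , suc m)` elsewhere outweighs the entire multiset of a
    -- candidate.
    candidate-NM-bound : ∀ {s₂ c M} → Candidate (R< s) s s₂ c → NM R∞ c M →
      All (λ k → s ≻ proj₁ k ⊎ k ≡ (s , 0)) M
    candidate-NM-bound cd nm with candidate-NM cd
    ... | A , nm′ , _ , bound = All-resp-↭ (NM-unique nm′ nm)
          (AllP.++⁺ (AllP.++⁺ (Rm-top (Candidate.ground-lhs cd) (inj₁ refl) (proj₂ top-rm)) (nf-bound ∷ []))
            (All′.map inj₁ bound))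
      where
      nf-bound : s ≻ proj₁ top-nf ⊎ (proj₁ top-nf , 0) ≡ (s , 0)
      nf-bound with Star-≽ (proj₁ (proj₂ top-nf))
      ... | inj₁ e = inj₂ (cong (_, 0) (sym e))
      ... | inj₂ g = inj₁ g

    -- Both multisets share `topEntries`, which cancels and is exchanged for the shared `(s , 0)`.
    -- The later components of the ordering do not mention the system.
    NMGt-transfer : ∀ {s₁ s₂ c₁ c₂} → Candidate (R< s) s s₁ c₁ → Candidate (R< s) s s₂ c₂ →
      NMGt ord clo R∞ c₁ c₂ → NMGt ord clo (R< s) c₁ c₂
    NMGt-transfer {c₁ = c₁} {c₂} cd₁ cd₂ (M₁ , M₂ , nm₁ , nm₂ , gt)
      with candidate-NM cd₁ | candidate-NM cd₂
    ... | A₁ , nm₁′ , nm₁< , _ | A₂ , nm₂′ , nm₂< , _ = _ , _ , nm₁< , nm₂< , transfer gt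
      where
      p₁ = NM-unique nm₁ nm₁′
      p₂ = NM-unique nm₂ nm₂′
      transfer : MulExt _≡_ (_≻TL_ ord) M₁ M₂ ⊎ (MEq _≡_ M₁ M₂ × _) →
        MulExt _≡_ (_≻TL_ ord) ((s , 0) ∷ A₁) ((s , 0) ∷ A₂) ⊎ (MEq _≡_ ((s , 0) ∷ A₁) ((s , 0) ∷ A₂) × _)
      transfer (inj₁ g) = inj₁ (MulExt-∷ (s , 0) (MulExt-cancel-++ ≻TL-irrefl ≻TL-trans topEntries
        (LabelExt.≻≻-respˡ (_ , p₁ , PW.refl refl) (LabelExt.≻≻-respʳ (_ , p₂ , PW.refl refl) g))))
      transfer (inj₂ (e , g)) = inj₂ ((_ , prep (s , 0) (↭-cancel-++ topEntries
        (↭-trans (↭-sym p₁) (↭-trans (MEq-≡⇒↭ e) p₂))) , PW.refl refl) , g)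

-- Renaming apart and reducible variables

module _ {sig : Signature} where
  open Signature sig

  mutual
    varBound : Term sig → ℕ
    varBound (var x) = suc x
    varBound (fun f ts) = varBound* ts

    varBound* : ∀ {n} → Vec (Term sig) n → ℕ
    varBound* [] = 0
    varBound* (t ∷ ts) = varBound t + varBound* ts

  varBound-lookup : ∀ {n} (ts : Vec (Term sig) n) i → varBound (lookup ts i) ≤ varBound* ts
  varBound-lookup (t ∷ ts) zero = ℕₚ.m≤m+n _ _
  varBound-lookup (t ∷ ts) (suc i) = ℕₚ.≤-trans (varBound-lookup ts i) (ℕₚ.m≤n+m _ _)

  occurs-varBound : ∀ {t : Term sig} {p x} → At t p (var x) → x < varBound t
  occurs-varBound here = ℕₚ.≤-refl
  occurs-varBound (there {ts = ts} i a) = ℕₚ.≤-trans (occurs-varBound a) (varBound-lookup ts i)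

  varBoundCl : Clause sig → ℕ
  varBoundCl [] = 0
  varBoundCl (pos s t ∷ C) = (varBound s + varBound t) + varBoundCl C
  varBoundCl (neg s t ∷ C) = (varBound s + varBound t) + varBoundCl C

  occurs-varBoundCl : ∀ C {x} → OccursCl x C → x < varBoundCl C
  occurs-varBoundCl C o with occurs-side o
  ... | s , (p , a) , sd = ℕₚ.≤-trans (occurs-varBound a) (side-bound C sd)
    where
    side-bound : ∀ C {s} → InTSneg C s ⊎ InTSpos C s → varBound s ≤ varBoundCl C
    side-bound (_ ∷ C) (inj₁ (_ , here refl , nl)) = ℕₚ.≤-trans (ℕₚ.m≤m+n _ _) (ℕₚ.m≤m+n _ _)
    side-bound (_ ∷ C) (inj₁ (_ , here refl , nr {s})) = ℕₚ.≤-trans (ℕₚ.m≤n+m _ (varBound s)) (ℕₚ.m≤m+n _ _)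
    side-bound (_ ∷ C) (inj₂ (_ , here refl , pl)) = ℕₚ.≤-trans (ℕₚ.m≤m+n _ _) (ℕₚ.m≤m+n _ _)
    side-bound (_ ∷ C) (inj₂ (_ , here refl , pr {s})) = ℕₚ.≤-trans (ℕₚ.m≤n+m _ (varBound s)) (ℕₚ.m≤m+n _ _)
    side-bound (pos s t ∷ C) (inj₁ (_ , there i , sd)) = ℕₚ.≤-trans (side-bound C (inj₁ (_ , i , sd))) (ℕₚ.m≤n+m _ (varBound s + varBound t))
    side-bound (neg s t ∷ C) (inj₁ (_ , there i , sd)) = ℕₚ.≤-trans (side-bound C (inj₁ (_ , i , sd))) (ℕₚ.m≤n+m _ (varBound s + varBound t))
    side-bound (pos s t ∷ C) (inj₂ (_ , there i , sd)) = ℕₚ.≤-trans (side-bound C (inj₂ (_ , i , sd))) (ℕₚ.m≤n+m _ (varBound s + varBound t))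
    side-bound (neg s t ∷ C) (inj₂ (_ , there i , sd)) = ℕₚ.≤-trans (side-bound C (inj₂ (_ , i , sd))) (ℕₚ.m≤n+m _ (varBound s + varBound t))

  -- Renamings must be bijective on all variables, so instead of shifting by `k` the blocks from 0
  -- to `k` and from `k` to `k + k` are exchanged. With `k` above all variables of both clauses,
  -- renamed variables land in the upper block.
  blockSwap : ℕ → ℕ → ℕ
  blockSwap k x with x <? k
  ... | yes _ = k + x
  ... | no _ with x <? k + k
  ...   | yes _ = x ∸ k
  ...   | no _ = x

  blockSwap-low : ∀ k {x} → x < k → blockSwap k x ≡ k + x
  blockSwap-low k {x} lt with x <? k
  ... | yes _ = refl
  ... | no ge = ⊥-elim (ge lt)

  blockSwap-mid : ∀ k {x} → x < k → blockSwap k (k + x) ≡ x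
  blockSwap-mid k {x} lt with k + x <? k
  ... | yes lt′ = ⊥-elim (ℕₚ.<-irrefl refl (ℕₚ.≤-<-trans (ℕₚ.m≤m+n k x) lt′))
  ... | no _ with k + x <? k + k
  ...   | yes _ = ℕₚ.m+n∸m≡n k x
  ...   | no ge = ⊥-elim (ge (ℕₚ.+-monoʳ-< k lt))

  blockSwap-involutive : ∀ k x → blockSwap k (blockSwap k x) ≡ x
  blockSwap-involutive k x with x <? k
  ... | yes lt = blockSwap-mid k lt
  ... | no ge with x <? k + k
  ...   | yes lt′ = trans (blockSwap-low k low) (ℕₚ.m+[n∸m]≡n (ℕₚ.≮⇒≥ ge))
    where
    low : x ∸ k < k
    low = ℕₚ.+-cancelˡ-< k _ _ (subst (_< k + k) (sym (ℕₚ.m+[n∸m]≡n (ℕₚ.≮⇒≥ ge))) lt′)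
  ...   | no ge′ with x <? k
  ...     | yes lt = ⊥-elim (ge lt)
  ...     | no _ with x <? k + k
  ...       | yes lt′ = ⊥-elim (ge′ lt′)
  ...       | no _ = refl

  OccursCl-rename⁻ : ∀ {ρ : Subst sig} (ren : IsRenaming ρ) C {y} → OccursCl y (C ⟪ ρ ⟫) →
    ∃ λ x → OccursCl x C × y ≡ proj₁ ren x
  OccursCl-rename⁻ {ρ} ren@(π , _ , e , _) C o with occurs-side o
  ... | s , (p , a) , sd with unrename sd
    where
    unrename : ∀ {s} → InTSneg (C ⟪ ρ ⟫) s ⊎ InTSpos (C ⟪ ρ ⟫) s →
      ∃ λ s₀ → s ≡ s₀ ⟨ ρ ⟩ × (InTSneg C s₀ ⊎ InTSpos C s₀)
    unrename (inj₁ i) with InSide-sub⁻ negSide C ρ i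
    ... | s₀ , e , j = s₀ , e , inj₁ j
    unrename (inj₂ i) with InSide-sub⁻ posSide C ρ i
    ... | s₀ , e , j = s₀ , e , inj₂ j
  ... | s₀ , refl , sd₀ with At-rename⁻ ren s₀ a
  ...   | var x , eq , b with trans eq (e x)
  ...     | refl = x , side-occurs sd₀ (_ , b) , refl

  -- The premises of a ground inference share one substitution, whereas the producer and the
  -- counterexample bring their own. `θ′` reproduces the values of both after renaming.
  record Apart (A B : Clause sig) (θ₁ θ : Subst sig) : Set where
    field
      ρ        : Subst sig
      renaming-ρ : IsRenaming ρ
      θ′       : Subst sig
      disjoint : Disjoint (A ⟪ ρ ⟫) B
      valuesˡ  : ∀ x → OccursCl x A → (ρ x) ⟨ θ′ ⟩ ≡ θ₁ x
      valuesʳ  : ∀ x → OccursCl x B → θ′ x ≡ θ x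

  rename-apart : ∀ A B θ₁ θ → Apart A B θ₁ θ
  rename-apart A B θ₁ θ = record
    { ρ = var ∘ π ; renaming-ρ = ren ; θ′ = θ′ ; disjoint = disj
    ; valuesˡ = λ x o → trans (cong θ′ (blockSwap-low k (lowA o)))
        (trans (θ′-high (ℕₚ.m≤m+n k x)) (cong θ₁ (blockSwap-mid k (lowA o))))
    ; valuesʳ = λ x o → θ′-low (lowB o) }
    where
    k = varBoundCl A + varBoundCl B
    π = blockSwap k
    lowA : ∀ {x} → OccursCl x A → x < k
    lowA o = ℕₚ.≤-trans (occurs-varBoundCl A o) (ℕₚ.m≤m+n _ _)
    lowB : ∀ {x} → OccursCl x B → x < k
    lowB o = ℕₚ.≤-trans (occurs-varBoundCl B o) (ℕₚ.m≤n+m _ (varBoundCl A))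
    ren : IsRenaming (var ∘ π)
    ren = π , π , (λ _ → refl) , blockSwap-involutive k , blockSwap-involutive k
    pick : ∀ {y} → Dec (y < k) → Term sig
    pick {y} (yes _) = θ y
    pick {y} (no _) = θ₁ (π y)
    θ′ : Subst sig
    θ′ y = pick (y <? k)
    pick-low : ∀ {y} (d : Dec (y < k)) → y < k → pick d ≡ θ y
    pick-low (yes _) lt = refl
    pick-low (no ge) lt = ⊥-elim (ge lt)
    pick-high : ∀ {y} (d : Dec (y < k)) → k ≤ y → pick d ≡ θ₁ (π y)
    pick-high (yes lt) ge = ⊥-elim (ℕₚ.<-irrefl refl (ℕₚ.≤-<-trans ge lt))
    pick-high (no _) ge = refl
    θ′-low : ∀ {y} → y < k → θ′ y ≡ θ y
    θ′-low {y} = pick-low (y <? k)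
    θ′-high : ∀ {y} → k ≤ y → θ′ y ≡ θ₁ (π y)
    θ′-high {y} = pick-high (y <? k)
    disj : Disjoint (A ⟪ var ∘ π ⟫) B
    disj y oA oB with OccursCl-rename⁻ ren A oA
    ... | x , o , refl = ℕₚ.<-irrefl refl (ℕₚ.≤-<-trans (ℕₚ.m≤m+n k x) (subst (_< k) (blockSwap-low k (lowA o)) (lowB oB)))

  mutual
    sub-Star : ∀ {R : RSys sig} {θ θ′} → (∀ x → Star (Step R) (θ x) (θ′ x)) → ∀ t → Star (Step R) (t ⟨ θ ⟩) (t ⟨ θ′ ⟩)
    sub-Star h (var x) = h x
    sub-Star h (fun f ts) = St.gmap (fun f) Step-vec (Star-vec (sub-Star* h ts))

    sub-Star* : ∀ {R : RSys sig} {θ θ′} → (∀ x → Star (Step R) (θ x) (θ′ x)) → ∀ {n} (ts : Vec (Term sig) n) →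
      VPW.Pointwise (Star (Step R)) (ts ⟨ θ ⟩*) (ts ⟨ θ′ ⟩*)
    sub-Star* h [] = VPW.[]
    sub-Star* h (t ∷ ts) = sub-Star h t VPW.∷ sub-Star* h ts

  GroundCl-map : ∀ C {θ θ′ : Subst sig} → (∀ t → Ground (t ⟨ θ ⟩) → Ground (t ⟨ θ′ ⟩)) →
    GroundCl (C ⟪ θ ⟫) → GroundCl (C ⟪ θ′ ⟫)
  GroundCl-map [] h [] = []
  GroundCl-map (pos s t ∷ C) h ((g ∷ g′ ∷ []) ∷ gs) = (h s g ∷ h t g′ ∷ []) ∷ GroundCl-map C h gs
  GroundCl-map (neg s t ∷ C) h ((g ∷ _ ∷ g′ ∷ _ ∷ []) ∷ gs) =
    (h s g ∷ h s g ∷ h t g′ ∷ h t g′ ∷ []) ∷ GroundCl-map C h gs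

  true-EqStep : ∀ {R : RSys sig} {θ θ′} → (∀ t → EqClosure (Step R) (t ⟨ θ ⟩) (t ⟨ θ′ ⟩)) → ∀ C →
    Any (TrueLit R) (C ⟪ θ′ ⟫) → Any (TrueLit R) (C ⟪ θ ⟫)
  true-EqStep h (pos s t ∷ C) (here e) = here (h s ◅◅ e ◅◅ EqStep-sym (h t))
  true-EqStep h (neg s t ∷ C) (here n) = here λ e → n (EqStep-sym (h s) ◅◅ e ◅◅ h t)
  true-EqStep h (_ ∷ C) (there a) = there (true-EqStep h C a)

module ReducibleVariable {sig : Signature} (em : ExcludedMiddle 0ℓ) (ord : ReductionOrdering sig)
  (clo : ClosureOrdering sig) {R : RSys sig} (adm : Admissible ord R) where
  open Signature sig
  open Rewriting em ord adm
  open ClosureOrder em ord clo adm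
  open Orders ord

  module _ {C : Clause sig} {θ : Subst sig} {x : ℕ} {p : List ℕ} {u v w : Term sig}
    (occ : OccursCl x C) (r : R u v) (a : At (θ x) p u) (rp : Repl (θ x) p v w) where
    private
      θ′ = θ [ x ↦ w ]
      θ′-x = ↦-hit θ x w

    reduced-Star : ∀ y → Star (Step R) (θ y) (θ′ y)
    reduced-Star y with em {P = y ≡ x}
    ... | yes refl = subst (Star (Step R) (θ x)) (sym θ′-x) ((p , u , v , r , a , rp) ◅ ε)
    ... | no ne = subst (Star (Step R) (θ y)) (sym (↦-miss θ w ne)) ε

    private
      contrib : ∀ {e M} → LssContrib R θ′ e M → ∃ λ X → LssContrib R θ e (X ++ M) × (proj₁ e ≡ var x → X ≢ [])
      contrib {var y , m} (c-var rm) with em {P = y ≡ x}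
      ... | yes refl = _ ∷ [] , c-var (rm-step r a rp (subst (λ z → Rm R z _ _) θ′-x rm)) , λ _ ()
      ... | no ne = [] , c-var (subst (λ z → Rm R z _ _) (↦-miss θ w ne) rm) , λ { refl → ⊥-elim (ne refl) }
      contrib {fun f ts , m} (c-fun nfs rm) = [] , c-fun (args ts nfs) rm , λ ()
        where
        args : ∀ {n} (ts : Vec (Term sig) n) {ts′ : Vec (Term sig) n} →
          VPW.Pointwise (λ s s′ → NF R (s ⟨ θ′ ⟩) s′) ts ts′ → VPW.Pointwise (λ s s′ → NF R (s ⟨ θ ⟩) s′) ts ts′
        args [] VPW.[] = VPW.[]
        args (t ∷ ts) ((ss , irr) VPW.∷ nfs) = (sub-Star reduced-Star t ◅◅ ss , irr) VPW.∷ args ts nfs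

      contribs : ∀ {ls Ms} → Pointwise (LssContrib R θ′) ls Ms → ∃₂ λ X Ms′ →
        Pointwise (LssContrib R θ) ls Ms′ × concat Ms′ ↭ X ++ concat Ms × (∀ m → (var x , m) ∈ ls → X ≢ [])
      contribs [] = [] , [] , [] , refl , λ _ ()
      contribs {Ms = M ∷ Ms} (c ∷ cs) with contrib c | contribs cs
      ... | X₁ , c′ , ne₁ | X₂ , Ms′ , cs′ , e , ne₂ = X₁ ++ X₂ , (X₁ ++ M) ∷ Ms′ , c′ ∷ cs′ ,
            ↭-trans (++⁺ˡ (X₁ ++ M) e) (↭-trans (↭-reflexive (++-assoc X₁ M _))
              (↭-trans (++⁺ˡ X₁ (shifts M X₂)) (↭-reflexive (sym (++-assoc X₁ X₂ _))))) ,
            λ { m (here e) → nonemptyˡ X₁ (ne₁ (cong proj₁ (sym e))) ; m (there i) → nonemptyʳ X₁ (ne₂ m i) }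
        where
        nonemptyˡ : ∀ {A : Set} (X : List A) {Y} → X ≢ [] → X ++ Y ≢ []
        nonemptyˡ [] ne = ⊥-elim (ne refl)
        nonemptyˡ (_ ∷ _) _ ()
        nonemptyʳ : ∀ {A : Set} (X : List A) {Y} → Y ≢ [] → X ++ Y ≢ []
        nonemptyʳ [] ne = ne
        nonemptyʳ (_ ∷ _) _ ()

    -- The multiset for `θ` is the one for `θ′` plus a nonempty block: the labelled variable `x`
    -- records the extra redex `u`. Function terms contribute only after their arguments are
    -- normalized, and sides contribute only their normal forms, so nothing else changes.
    reduced-NMGt : NMGt ord clo R (C , θ) (C , θ′)
    reduced-NMGt with NM-exists (C , θ′) | occurs-InLss em occ
    ... | M , nm@(ls , els , Ms , pls , ts , ets , ns , pts , e) | m , l with contribs pls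
    ... | X , Ms′ , pls′ , e′ , ne = concat Ms′ ++ ns , M ,
          (ls , els , Ms′ , pls′ , ts , ets , ns , PW.map lts pts , refl) , nm ,
          inj₁ (M , X , [] , (_ , ↭-trans (++⁺ʳ ns e′) (↭-trans (↭-reflexive (++-assoc X (concat Ms) ns))
                  (↭-trans (++⁺ˡ X (↭-sym e)) (++-comm X M))) , PW.refl refl) ,
                (_ , ↭-reflexive (sym (++-identityʳ M)) , PW.refl refl) , ne m (proj₂ (proj₂ els _) l) , [])
      where
      lts : ∀ {e k} → LtsContrib R θ′ e k → LtsContrib R θ e k
      lts (c-lts {t = t} (ss , irr)) = c-lts (sub-Star reduced-Star t ◅◅ ss , irr)

-- The minimal counterexample

-- Restrictions on the ground inference lift to the general one: a violation at `σ` would survive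
-- instantiation by `θ`, and `θ` after `σ` is again `θ`.
module Lifting {sig : Signature} (ord : ReductionOrdering sig) {σ θ : Subst sig} (ab : Absorbs σ θ) where
  open ReductionOrdering ord renaming (trans to ≻-trans; irrefl to ≻-irrefl)
  open Orders ord

  litSub-absorb : ∀ L → litSub θ (litSub σ L) ≡ litSub θ L
  litSub-absorb (pos s t) = cong₂ pos (absorb s ab) (absorb t ab)
  litSub-absorb (neg s t) = cong₂ neg (absorb s ab) (absorb t ab)

  ≻L-ground : ∀ K L → _≻L_ ord (litSub σ K) (litSub σ L) → _≻L_ ord (litSub θ K) (litSub θ L)
  ≻L-ground K L g = subst₂ (_≻L_ ord) (litSub-absorb K) (litSub-absorb L)
    (≻L-sub {L = litSub σ K} {litSub σ L} θ g)

  LitEq-ground : ∀ K L → LitEq (litSub σ K) (litSub σ L) → LitEq (litSub θ K) (litSub θ L)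
  LitEq-ground K L e = subst₂ LitEq (litSub-absorb K) (litSub-absorb L)
    (LitEq-sub {L = litSub σ K} {litSub σ L} θ e)

  NotPrecEq-lift : ∀ s t → (s ⟨ θ ⟩) ≻ (t ⟨ θ ⟩) → NotPrecEq ord (s ⟨ σ ⟩) (t ⟨ σ ⟩)
  NotPrecEq-lift s t g (inj₁ h) = ≻-asym g (subst₂ _≻_ (absorb t ab) (absorb s ab) (stable θ h))
  NotPrecEq-lift s t g (inj₂ e) =
    ≻-irrefl (subst (_≻ _) (trans (sym (absorb s ab)) (trans (cong (_⟨ θ ⟩) e) (absorb t ab))) g)

  NotPrecEqC-lift : ∀ C D → _≻C_ ord (C ⟪ θ ⟫) (D ⟪ θ ⟫) → NotPrecEqC ord (C ⟪ σ ⟫) (D ⟪ σ ⟫)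
  NotPrecEqC-lift C D g (inj₁ h) =
    ≻C-asym g (subst₂ (_≻C_ ord) (clauseSub-absorb D ab) (clauseSub-absorb C ab) (≻C-sub θ h))
  NotPrecEqC-lift C D g (inj₂ e) = ≻C-asym g′ g′
    where
    g′ = ClauseExt.≻≻-respʳ (≅-sym (subst₂ _≅_ (clauseSub-absorb C ab) (clauseSub-absorb D ab) (≅-sub θ e))) g

  Maximal-lift : ∀ L D → Maximal ord (litSub θ L) (D ⟪ θ ⟫) → Maximal ord (litSub σ L) (D ⟪ σ ⟫)
  Maximal-lift L D m = AllP.map⁺ (All′.map (λ {K} n g → n (≻L-ground K L g)) (AllP.map⁻ {xs = D} m))

  StrictlyMaximal-lift : ∀ L D → StrictlyMaximal ord (litSub θ L) (D ⟪ θ ⟫) →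
    StrictlyMaximal ord (litSub σ L) (D ⟪ σ ⟫)
  StrictlyMaximal-lift L D m = AllP.map⁺ (All′.map
    (λ { {K} n (inj₁ g) → n (inj₁ (≻L-ground K L g)) ; {K} n (inj₂ e) → n (inj₂ (LitEq-ground K L e)) })
    (AllP.map⁻ {xs = D} m))

OccursCl-≅ : ∀ {sig} {C D : Clause sig} {x} → C ≅ D → OccursCl x C → OccursCl x D
OccursCl-≅ e o with occurs-side o
... | s , o′ , inj₁ i = side-occurs (inj₁ (InSide-≅ negSide e i)) o′
... | s , o′ , inj₂ i = side-occurs (inj₂ (InSide-≅ posSide e i)) o′

reordered : ∀ {sig} {C D : Clause sig} {θ θ′} → C ≅ D → (∀ x → OccursCl x C → θ′ x ≡ θ x) →
  RenamedFrom (D , θ′) (C , θ)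
reordered e v = record { ρ = var ; renaming-ρ = id-renaming ; clause-≅ = ≅-id (≅-sym e) ; values = v }

pos-injective : ∀ {sig} {a b c d : Term sig} → pos a b ≡ pos c d → a ≡ c × b ≡ d
pos-injective refl = refl , refl

Pointwise-∈ : ∀ {A B : Set} {P : A → B → Set} {x xs ys} → Pointwise P xs ys → x ∈ xs →
  ∃ λ y → y ∈ ys × P x y
Pointwise-∈ (p ∷ ps) (here refl) = _ , here refl , p
Pointwise-∈ (p ∷ ps) (there i) with Pointwise-∈ ps i
... | y , j , q = y , there j , q

-- Whether the label is 1 or 2 is immaterial later; the form `suc m` records that it exceeds 0.
deep-label : ExcludedMiddle 0ℓ → ∀ {sig} {u} {D : Clause sig} → DeepOcc u D → ∃ λ m → InLss D (u , suc m)
deep-label em {u = u} {D} d with em {P = InSSneg D u}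
... | yes a = 1 , l2 a
deep-label em (inj₁ a) | no n = ⊥-elim (n a)
deep-label em (inj₂ a) | no n = 0 , l1 a n

finite-maximal : ExcludedMiddle 0ℓ → ∀ {A : Set} {_>_ : A → A → Set} → WellFounded (flip _>_) →
  ∀ x xs → ∃ λ m → m ∈ x ∷ xs × (∀ y → y ∈ x ∷ xs → ¬ (y > m))
finite-maximal em {A} {_>_} wf x xs with go x xs
  where
  -- _>_ need not be transitive, so maxima are taken for its transitive closure.
  _<⁺_ : A → A → Set
  _<⁺_ = TransClosure (flip _>_)
  irr : ∀ {x} → ¬ (x <⁺ x)
  irr g = wf⇒asym (TC.wellFounded (flip _>_) wf) g g
  go : ∀ x xs → ∃ λ m → m ∈ x ∷ xs × (∀ y → y ∈ x ∷ xs → ¬ (m <⁺ y))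
  go x [] = x , here refl , λ { y (here refl) → irr }
  go x (x′ ∷ xs) with go x′ xs
  ... | m , i , max with em {P = m <⁺ x}
  ...   | yes g = x , here refl , λ { y (here refl) → irr ; y (there j) h → max y j (TC._++_ g h) }
  ...   | no n = m , there i , λ { y (here refl) → n ; y (there j) → max y j }
... | m , i , max = m , i , λ y j g → max y j TC.[ g ]

module MinimalCounterexample {sig : Signature} (em : ExcludedMiddle 0ℓ) (ord : ReductionOrdering sig)
  (clo : ClosureOrdering sig) (N : Clause sig → Set) (saturated : Saturated ord clo N)
  {C : Clause sig} {θ : Subst sig} (in-𝒢N : 𝒢 N (C , θ)) (false : ¬ (Construction.R∞ em ord clo N ⊨ (C , θ)))
  (minimal : ∀ d → 𝒢 N d × ¬ (Construction.R∞ em ord clo N ⊨ d) →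
    ¬ NMGt ord clo (Construction.R∞ em ord clo N) (C , θ) d) where
  open Signature sig
  open ReductionOrdering ord renaming (trans to ≻-trans; irrefl to ≻-irrefl)
  open GroundOrder ord
  open Orders ord
  open Construction em ord clo N
  open CandidateMeasure em ord clo N
  open Rewriting em ord R∞-admissible
  open ClosureOrder em ord clo R∞-admissible

  variable-irreducible : ∀ {x p u v} → OccursCl x C → R∞ u v → ¬ At (θ x) p u
  variable-irreducible {x} {p} {u} {v} o r a =
    minimal (C , θ [ x ↦ w ])
      ((proj₁ in-𝒢N , GroundCl-map C (λ t g → Star-ground g (ss t)) (proj₂ in-𝒢N)) ,
       λ tr → false (true-EqStep (λ t → Star⇒EqStep (ss t)) C tr))
      (reduced-NMGt o r a rp)
    where
    open ReducibleVariable em ord clo R∞-admissible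
    w = proj₁ (Repl-exists a v)
    rp = proj₂ (Repl-exists a v)
    ss = sub-Star (reduced-Star o r a rp)

  -- Covers every literal that a producer of a rule for `u₀` can have, so the single literal `K`
  -- makes its clause larger than the producer.
  record Dominates (K : Lit sig) (u₀ : Term sig) : Set where
    field
      dom-pos : ∀ {v} → u₀ ≻ v → _≻L_ ord K (pos u₀ v)
      dom-neg : ∀ {a b} → u₀ ≻ a → u₀ ≻ b → _≻L_ ord K (neg a b)

  -- Proper subterms of a left-hand side are irreducible, so normalizing the arguments leaves
  -- `u ⟨ θ ⟩` intact, and the first recorded redex is the term itself with its full label.
  deep-entry : ∀ {u v m} → ¬ IsVar u → R∞ (u ⟨ θ ⟩) v → InLss C (u , m) →
    ∃ λ M → NM R∞ (C , θ) M × (u ⟨ θ ⟩ , m) ∈ M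
  deep-entry {u} {v} {m} nv r l with NM-exists (C , θ)
  ... | M , nm@(ls , els , Ms , pls , ts , ets , ns , pts , e)
    with Pointwise-∈ pls (proj₂ (proj₂ els _) l)
  ...   | M₀ , M₀∈ , ct = M , nm , ∈-resp-↭ (↭-sym e) (∈-++⁺ˡ (AnyP.concat⁺ (Any′.map (λ { refl → entry nv r ct }) M₀∈)))
    where
    entry : ∀ {u v M₀} → ¬ IsVar u → R∞ (u ⟨ θ ⟩) v → LssContrib R∞ θ (u , m) M₀ → (u ⟨ θ ⟩ , m) ∈ M₀
    entry nv r (c-var _) = ⊥-elim (nv (_ , refl))
    entry nv r (c-fun {f} {ts} nfs rm)
      with NF-args-irreducible {ts = ts} (λ i → lhs-subterm-irreducible r (λ ())
             (there i (subst (λ w → At w [] (lookup ts i ⟨ θ ⟩)) (sym (lookup-sub ts i θ)) here))) nfs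
    ... | refl with Rm-lhs r rm
    ...   | _ , refl = here refl

  -- `deep` supplies the ordering condition on the premises, and `shallow` makes `(C , θ)` a
  -- competitor of the producer. The conclusion is false because the producer's other literals are
  -- refuted and the replacement preserves truth values in `R∞`.
  superpose : ∀ {L D s s′ u v p} → C ≅ (L ∷ D) → At s p u → ¬ IsVar u → R∞ (u ⟨ θ ⟩) v →
    (s ⟨ θ ⟩) ≻ (s′ ⟨ θ ⟩) →
    (L ≡ pos s s′ × StrictlyMaximal ord (litSub θ L) (D ⟪ θ ⟫)) ⊎
    (L ≡ neg s s′ × Maximal ord (litSub θ L) (D ⟪ θ ⟫)) →
    (DeepOcc u (L ∷ D) → Dominates (litSub θ L) (u ⟨ θ ⟩)) →
    (¬ DeepOcc u (L ∷ D) → ∃ λ s₂ → Candidate (R< (u ⟨ θ ⟩)) (u ⟨ θ ⟩) s₂ (C , θ)) → ⊥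
  superpose {L} {D} {s} {s′} {u} {v} {p} C≅ at nonvar r s≻s′ maximal deep shallow
    with R∞-candidate r
  ... | c₁@(C₁ , θ₁) , cd , min₁ = refute (saturated general premises ground (θ′ , refl , ClosId-refl) R∞ R∞-admissible)
    where
    u₀ = u ⟨ θ ⟩
    Right = L ∷ D
    open Candidate cd using (t; t′; D′; shape; lhs; rhs; orient; rest)
    open Apart (rename-apart (pos t t′ ∷ D′) Right θ₁ θ)
    Left = (pos t t′ ∷ D′) ⟪ ρ ⟫

    side : (L ≡ pos s s′ × StrictlyMaximal ord (litSub θ L) (D ⟪ θ ⟫)) ⊎ (L ≡ neg s s′ × Maximal ord (litSub θ L) (D ⟪ θ ⟫)) →
      (InTSneg Right s ⊎ InTSpos Right s) × (InTSneg Right s′ ⊎ InTSpos Right s′)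
    side (inj₁ (refl , _)) = inj₂ (_ , here refl , pl) , inj₂ (_ , here refl , pr)
    side (inj₂ (refl , _)) = inj₁ (_ , here refl , nl) , inj₁ (_ , here refl , nr)
    s-eq : s ⟨ θ′ ⟩ ≡ s ⟨ θ ⟩
    s-eq = sub-cong s λ x o → valuesʳ x (side-occurs (proj₁ (side maximal)) o)
    s′-eq : s′ ⟨ θ′ ⟩ ≡ s′ ⟨ θ ⟩
    s′-eq = sub-cong s′ λ x o → valuesʳ x (side-occurs (proj₂ (side maximal)) o)
    u-eq : u ⟨ θ′ ⟩ ≡ u₀
    u-eq = sub-cong u λ { x (q , o) → valuesʳ x (side-occurs (proj₁ (side maximal)) (_ , At-++ at o)) }
    Right-eq : Right ⟪ θ′ ⟫ ≡ Right ⟪ θ ⟫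
    Right-eq = clauseSub-cong Right valuesʳ
    Left-eq : Left ⟪ θ′ ⟫ ≡ (pos t t′ ∷ D′) ⟪ θ₁ ⟫
    Left-eq = trans (clauseSub-∘ (pos t t′ ∷ D′) ρ θ′) (clauseSub-cong (pos t t′ ∷ D′) valuesˡ)
    t-eq : t ⟨ ρ ⟩ ⟨ θ′ ⟩ ≡ u₀
    t-eq = trans (proj₁ (pos-injective (∷-injectiveˡ Left-eq))) lhs
    t′-eq : t′ ⟨ ρ ⟩ ⟨ θ′ ⟩ ≡ v
    t′-eq = trans (proj₂ (pos-injective (∷-injectiveˡ Left-eq))) rhs
    D′-eq : D′ ⟪ ρ ⟫ ⟪ θ′ ⟫ ≡ D′ ⟪ θ₁ ⟫
    D′-eq = ∷-injectiveʳ Left-eq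
    L-eq : litSub θ′ L ≡ litSub θ L
    L-eq = ∷-injectiveˡ Right-eq
    D-eq : D ⟪ θ′ ⟫ ≡ D ⟪ θ ⟫
    D-eq = ∷-injectiveʳ Right-eq

    rest′ : All (RefutedBelow (R< u₀) u₀) (D′ ⟪ ρ ⟫ ⟪ θ′ ⟫)
    rest′ = subst (All _) (sym D′-eq) rest
    t≻t′ : (t ⟨ ρ ⟩ ⟨ θ′ ⟩) ≻ (t′ ⟨ ρ ⟩ ⟨ θ′ ⟩)
    t≻t′ = subst₂ _≻_ (sym t-eq) (sym t′-eq) orient

    mgu = mgu-exists (t ⟨ ρ ⟩) u θ′ (trans t-eq (sym u-eq))
    σ = proj₁ mgu
    isMGU = proj₁ (proj₂ mgu)
    ab = proj₂ (proj₂ mgu)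
    open Lifting ord {σ} {θ′} ab

    C′ = proj₁ (ReplAllCl-exists em u (t′ ⟨ ρ ⟩) Right)
    repl = proj₂ (ReplAllCl-exists em u (t′ ⟨ ρ ⟩) Right)

    strict : StrictlyMaximal ord (litSub θ′ (pos (t ⟨ ρ ⟩) (t′ ⟨ ρ ⟩))) (D′ ⟪ ρ ⟫ ⟪ θ′ ⟫)
    strict = All′.map (λ
      { {K} (refuted g h _) (inj₁ gt) → ¬≻L-of-smaller {K} {pos (t ⟨ ρ ⟩ ⟨ θ′ ⟩) (t′ ⟨ ρ ⟩ ⟨ θ′ ⟩)} (here (sym t-eq)) (g ∷ g ∷ h ∷ h ∷ []) gt
      ; {K} (refuted g h _) (inj₂ e) → ¬LitEq-of-smaller {K} {pos (t ⟨ ρ ⟩ ⟨ θ′ ⟩) (t′ ⟨ ρ ⟩ ⟨ θ′ ⟩)} (here (sym t-eq)) (g ∷ g ∷ h ∷ h ∷ []) e }) rest′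

    larger : DeepOcc u Right → _≻C_ ord (Right ⟪ θ′ ⟫) (Left ⟪ θ′ ⟫)
    larger d = ClauseExt.≻≻-dominate (here refl)
      (here (subst₂ (_≻L_ ord) (sym L-eq) (cong₂ pos (sym t-eq) (sym t′-eq)) (Dominates.dom-pos (deep d) orient)) ∷
       All′.map (λ { (refuted {a} {b} g h _) → here (subst (λ K → _≻L_ ord K (neg a b)) (sym L-eq) (Dominates.dom-neg (deep d) g h)) }) rest′)

    maximal-σ :
      (L ≡ pos s s′ × StrictlyMaximal ord (litSub θ L) (D ⟪ θ ⟫)) ⊎ (L ≡ neg s s′ × Maximal ord (litSub θ L) (D ⟪ θ ⟫)) →
      (L ≡ pos s s′ × StrictlyMaximal ord (litSub σ L) (D ⟪ σ ⟫)) ⊎ (L ≡ neg s s′ × Maximal ord (litSub σ L) (D ⟪ σ ⟫))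
    maximal-σ (inj₁ (e , m)) = inj₁ (e , StrictlyMaximal-lift L D (subst₂ (StrictlyMaximal ord) (sym L-eq) (sym D-eq) m))
    maximal-σ (inj₂ (e , m)) = inj₂ (e , Maximal-lift L D (subst₂ (Maximal ord) (sym L-eq) (sym D-eq) m))

    s≻s′′ : (s ⟨ θ′ ⟩) ≻ (s′ ⟨ θ′ ⟩)
    s≻s′′ = subst₂ _≻_ (sym s-eq) (sym s′-eq) s≻s′

    general : GenInf ord (Left ∷ Right ∷ []) ((D′ ⟪ ρ ⟫ ++ C′) ⟪ σ ⟫)
    general = psup disjoint nonvar isMGU repl
      (λ d → NotPrecEqC-lift Right Left (larger d))
      (StrictlyMaximal-lift (pos (t ⟨ ρ ⟩) (t′ ⟨ ρ ⟩)) (D′ ⟪ ρ ⟫) strict)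
      (s , s′ , (p , at) , NotPrecEq-lift s s′ s≻s′′ , maximal-σ maximal)
      (NotPrecEq-lift (t ⟨ ρ ⟩) (t′ ⟨ ρ ⟩) t≻t′)

    premises : All (λ E → ∃ λ F → N F × Variant E F) (Left ∷ Right ∷ [])
    premises = (C₁ , proj₁ (Candidate.in-𝒢N cd) , ρ , renaming-ρ , ≅-sub ρ (≅-sym shape)) ∷
               (C , proj₁ in-𝒢N , var , id-renaming , ≅-id (≅-sym C≅)) ∷ []

    ground : GInf ord ((Left , θ′) ∷ (Right , θ′) ∷ []) ((D′ ⟪ ρ ⟫ ++ C′) ⟪ σ ⟫ , θ′)
    ground = psupI (subst GroundCl (sym Left-eq) (Candidate.ground-shape cd))
      (subst GroundCl (sym Right-eq) (GroundCl-≅ (≅-sub θ C≅) (proj₂ in-𝒢N)))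
      disjoint nonvar (trans t-eq (sym u-eq)) isMGU repl larger
      (s , s′ , (p , at) , s≻s′′ ,
        [ (λ { (e , m) → inj₁ (e , subst₂ (StrictlyMaximal ord) (sym L-eq) (sym D-eq) m) })
        , (λ { (e , m) → inj₂ (e , subst₂ (Maximal ord) (sym L-eq) (sym D-eq) m) }) ]′ maximal)
      strict t≻t′

    rightFrom : RenamedFrom (Right , θ′) (C , θ)
    rightFrom = reordered C≅ λ x o → valuesʳ x (OccursCl-≅ C≅ o)

    leftFrom : RenamedFrom (Left , θ′) c₁
    leftFrom = record { ρ = ρ ; renaming-ρ = renaming-ρ ; clause-≅ = ≅-sub ρ (≅-sym shape)
                      ; values = λ x o → valuesˡ x (OccursCl-≅ shape o) }

    ¬left≻≻right : ¬ NMGt ord clo R∞ c₁ (C , θ)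
    ¬left≻≻right g with em {P = DeepOcc u Right}
    ... | no n = min₁ _ _ (proj₂ (shallow n)) (NMGt-transfer r cd (proj₂ (shallow n)) g)
    ... | yes d with deep-label em d
    -- Treating `≅` as the identity renaming carries the label from `Right` over to `C`.
    ...   | m , l with InLss-rename⁻ id-renaming (≅-id (≅-sym C≅)) l
    ...     | (u₁ , _) , eq , l′ with trans (cong proj₁ eq) (sub-id u₁) | cong proj₂ eq
    ...       | refl | refl with deep-entry nonvar r l′ | NM-exists c₁
    -- The entry `(u₀ , suc m)` of the counterexample dominates all entries of the producer, which
    -- are below `u₀` or equal to `(u₀ , 0)`.
    ...         | M , nm , i | M₁ , nm₁ = NMGt-asym g (M , M₁ , nm , nm₁ , inj₁ (LabelExt.≻≻-dominate i
                  (All′.map (λ { (inj₁ h) → lose i (inj₁ h) ; (inj₂ refl) → lose i (inj₂ (refl , s≤s z≤n)) })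
                    (candidate-NM-bound r cd nm₁))))

    ¬true-rest : ∀ {E} → All (RefutedBelow (R< u₀) u₀) E → ¬ Any (TrueLit R∞) E
    ¬true-rest (refuted _ _ e ∷ _) (here n) = n (R<⇒R∞-EqStep e)
    ¬true-rest (_ ∷ es) (there a) = ¬true-rest es a

    ¬conclusion : ¬ (R∞ ⊨ ((D′ ⟪ ρ ⟫ ++ C′) ⟪ σ ⟫ , θ′))
    ¬conclusion tr with AnyP.++⁻ (D′ ⟪ ρ ⟫ ⟪ θ′ ⟫)
      (subst (Any (TrueLit R∞)) (trans (clauseSub-absorb (D′ ⟪ ρ ⟫ ++ C′) ab) (map-++ (litSub θ′) (D′ ⟪ ρ ⟫) C′)) tr)
    ... | inj₁ a = ¬true-rest rest′ a
    ... | inj₂ a = false (true-≅ {R = R∞} (≅-sym (≅-sub θ C≅)) (subst (Any (TrueLit R∞)) Right-eq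
          (ReplAllCl-true (fwd ([] , u₀ , v , r , subst (λ w → At w [] u₀) (sym u-eq) here ,
            subst₂ (λ w w′ → Repl w [] v w′) (sym u-eq) (sym t′-eq) here) ◅ ε) repl a)))

    refute : (R∞ ⊨ ((D′ ⟪ ρ ⟫ ++ C′) ⟪ σ ⟫ , θ′)) ⊎
      (∃ λ d → 𝒢 N d × NMGt ord clo R∞ (Right , θ′) d × ¬ (R∞ ⊨ d)) ⊎
      (((t ⟨ ρ ⟩ ⟨ θ′ ⟩) ≻ (t′ ⟨ ρ ⟩ ⟨ θ′ ⟩)) × ¬ R∞ (t ⟨ ρ ⟩ ⟨ θ′ ⟩) (t′ ⟨ ρ ⟩ ⟨ θ′ ⟩)) ⊎
      NMGt ord clo R∞ (Left , θ′) (Right , θ′) → ⊥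
    refute (inj₁ tr) = ¬conclusion tr
    refute (inj₂ (inj₁ (d , in-N , g , nt))) = minimal d (in-N , nt) (NMGt-renameˡ rightFrom g)
    refute (inj₂ (inj₂ (inj₁ (_ , ¬r)))) = ¬r (subst₂ R∞ (sym t-eq) (sym t′-eq) r)
    refute (inj₂ (inj₂ (inj₂ g))) = ¬left≻≻right (NMGt-renameʳ rightFrom (NMGt-renameˡ leftFrom g))

  resolve : ∀ {a b D} → C ≅ (neg a b ∷ D) → a ⟨ θ ⟩ ≡ b ⟨ θ ⟩ →
    Maximal ord (litSub θ (neg a b)) (D ⟪ θ ⟫) → ⊥
  resolve {a} {b} {D} C≅ e m = refute (saturated general premises ground (θ , refl , ClosId-refl) R∞ R∞-admissible)
    where
    mgu = mgu-exists a b θ e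
    σ = proj₁ mgu
    ab = proj₂ (proj₂ mgu)
    open Lifting ord {σ} {θ} ab
    general : GenInf ord ((neg a b ∷ D) ∷ []) (D ⟪ σ ⟫)
    general = eres (proj₁ (proj₂ mgu)) (Maximal-lift (neg a b) D m)
    premises : All (λ E → ∃ λ F → N F × Variant E F) ((neg a b ∷ D) ∷ [])
    premises = (C , proj₁ in-𝒢N , var , id-renaming , ≅-id (≅-sym C≅)) ∷ []
    ground : GInf ord ((neg a b ∷ D , θ) ∷ []) (D ⟪ σ ⟫ , θ)
    ground = eresG (GroundCl-≅ (≅-sub θ C≅) (proj₂ in-𝒢N)) e (proj₁ (proj₂ mgu)) m
    refute : (R∞ ⊨ (D ⟪ σ ⟫ , θ)) ⊎
      (∃ λ d → 𝒢 N d × NMGt ord clo R∞ (neg a b ∷ D , θ) d × ¬ (R∞ ⊨ d)) ⊎ ⊥ ⊎ ⊥ → ⊥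
    refute (inj₁ tr) = false (true-≅ {R = R∞} (≅-sym (≅-sub θ C≅))
      (there (subst (Any (TrueLit R∞)) (clauseSub-absorb D ab) tr)))
    refute (inj₂ (inj₁ (d , in-N , g , nt))) =
      minimal d (in-N , nt) (NMGt-renameˡ (reordered C≅ (λ _ _ → refl)) g)
    refute (inj₂ (inj₂ (inj₁ ())))
    refute (inj₂ (inj₂ (inj₂ ())))

  neg-dominates : ∀ {a b u₀} → a ≽ u₀ → Dominates (neg a b) u₀
  neg-dominates {a} {b} {u₀} g = record { dom-pos = at-pos g ; dom-neg = at-neg }
    where
    at-pos : ∀ {v} → a ≽ u₀ → u₀ ≻ v → _≻L_ ord (neg a b) (pos u₀ v)
    -- Negative literals count each side twice: one copy of `u₀` cancels and the other dominates
    -- `v`.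
    at-pos {v} (inj₁ refl) h = u₀ ∷ [] , u₀ ∷ b ∷ b ∷ [] , v ∷ [] , TermMEq.≋-refl , TermMEq.≋-refl ,
      (λ ()) , here h ∷ []
    at-pos {v} (inj₂ g) h = ≻L-dominate {neg a b} {pos u₀ v} (here refl) (g ∷ ≻-trans g h ∷ [])
    at-neg : ∀ {c d} → u₀ ≻ c → u₀ ≻ d → _≻L_ ord (neg a b) (neg c d)
    at-neg {c} {d} h k = ≻L-dominate {neg a b} {neg c d} (here refl)
      (≽-≻ g h ∷ ≽-≻ g h ∷ ≽-≻ g k ∷ ≽-≻ g k ∷ [])

  pos-dominates : ∀ {a b u₀} → a ≻ u₀ → Dominates (pos a b) u₀
  pos-dominates {a} {b} {u₀} g = record
    { dom-pos = λ {v} h → ≻L-dominate {pos a b} {pos u₀ v} (here refl) (g ∷ ≻-trans g h ∷ [])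
    ; dom-neg = λ {c} {d} h k → ≻L-dominate {pos a b} {neg c d} (here refl)
        (≻-trans g h ∷ ≻-trans g h ∷ ≻-trans g k ∷ ≻-trans g k ∷ []) }

  refute-negative : ∀ {a b D} → C ≅ (neg a b ∷ D) → (a ⟨ θ ⟩) ≻ (b ⟨ θ ⟩) →
    Maximal ord (litSub θ (neg a b)) (D ⟪ θ ⟫) → ⊥
  refute-negative {a} {b} {D} C≅ g m with em {P = EqClosure (Step R∞) (a ⟨ θ ⟩) (b ⟨ θ ⟩)}
  ... | no n = false (true-≅ {R = R∞} (≅-sym (≅-sub θ C≅)) (here n))
  ... | yes e with reducible? (a ⟨ θ ⟩)
  -- An irreducible larger side would be the normal form of the smaller one.
  ...   | inj₂ irr = ≻-irrefl (≻-≽ g (Star-≽ (proj₁ (NF-EqStep e (ε , irr)))))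
  ...   | inj₁ (_ , q , u₀ , v , r , at , _) with At-sub⁻ a at
  ...     | inj₂ (x , _ , o , at′) = variable-irreducible
              (OccursCl-≅ (≅-sym C≅) (side-occurs (inj₁ (_ , here refl , nl)) o)) r at′
  ...     | inj₁ (u , at′ , nv , refl) = superpose C≅ at′ nv r g (inj₂ (refl , m))
              (λ _ → neg-dominates (subterm-≽ ground-a at))
              (λ n → ⊥-elim (n (inj₁ (_ , here refl , a , nl , _ , at′))))
    where
    ground-a : Ground (a ⟨ θ ⟩)
    ground-a with GroundCl-≅ (≅-sub θ C≅) (proj₂ in-𝒢N)
    ... | (h ∷ _) ∷ _ = h

  refute-positive : ∀ {a b D} → C ≅ (pos a b ∷ D) → All (λ K → ∃₂ λ c d → K ≡ neg c d) D →
    (a ⟨ θ ⟩) ≻ (b ⟨ θ ⟩) → Maximal ord (litSub θ (pos a b)) (D ⟪ θ ⟫) → ⊥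
  refute-positive {a} {b} {D} C≅ horn g m = cases (reducible? s)
    where
    s = a ⟨ θ ⟩
    ground-C : GroundCl ((pos a b ∷ D) ⟪ θ ⟫)
    ground-C = GroundCl-≅ (≅-sub θ C≅) (proj₂ in-𝒢N)
    ground-s : Ground s
    ground-s with ground-C
    ... | (h ∷ _) ∷ _ = h
    false-D : ¬ Any (TrueLit R∞) (D ⟪ θ ⟫)
    false-D tr = false (true-≅ {R = R∞} (≅-sym (≅-sub θ C≅)) (there tr))

    side-below : ∀ {c d} → Ground c → ¬ (_≻L_ ord (neg c d) (litSub θ (pos a b))) → s ≻ c
    side-below {c} {d} gc n with total ground-s gc
    ... | inj₁ h = h
    ... | inj₂ (inj₁ e) = ⊥-elim (n (Dominates.dom-pos (neg-dominates (inj₁ (sym e))) g))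
    ... | inj₂ (inj₂ h) = ⊥-elim (n (Dominates.dom-pos (neg-dominates (inj₂ h)) g))

    -- Falsity in `R∞` only gives a conversion in `R∞`; maximality of the positive literal puts both
    -- sides below `s`, where `R< s` already converts them.
    refuted-lit : ∀ {c d} → GroundLit (neg c d) → ¬ (_≻L_ ord (neg c d) (litSub θ (pos a b))) →
      ¬ TrueLit R∞ (neg c d) → RefutedBelow (R< s) s (neg c d)
    refuted-lit {c} {d} (gc ∷ _ ∷ gd ∷ _ ∷ []) n f = refuted s≻c s≻d (Below.EqStep-below s (gc , s≻c) (gd , s≻d) e)
      where
      s≻c = side-below gc n
      s≻d = side-below gd λ k → n (≻L-respˡ {neg d c} {neg c d} {litSub θ (pos a b)} (LitEq-swapLit (neg d c)) k)
      e : EqClosure (Step R∞) c d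
      e with em {P = EqClosure (Step R∞) c d}
      ... | yes q = q
      ... | no ne = ⊥-elim (f ne)

    refute-rest : ∀ E → All (λ K → ∃₂ λ c d → K ≡ neg c d) E → GroundCl (E ⟪ θ ⟫) →
      Maximal ord (litSub θ (pos a b)) (E ⟪ θ ⟫) → ¬ Any (TrueLit R∞) (E ⟪ θ ⟫) →
      All (RefutedBelow (R< s) s) (E ⟪ θ ⟫)
    refute-rest [] _ _ _ _ = []
    refute-rest (_ ∷ E) ((_ , _ , refl) ∷ ns) (gl ∷ gs) (n ∷ m) f =
      refuted-lit gl n (λ tr → f (here tr)) ∷ refute-rest E ns gs m (λ tr → f (there tr))

    maxSide : MaximalSide (R< s) s (b ⟨ θ ⟩) (C , θ)
    maxSide = record { in-𝒢N = in-𝒢N ; shape = C≅ ; lhs = refl ; rhs = refl ; orient = g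
                     ; rest = refute-rest D horn (All′.tail ground-C) m false-D }

    strict : StrictlyMaximal ord (litSub θ (pos a b)) (D ⟪ θ ⟫)
    -- Maximality becomes strict because the other literals have all their sides below `s`.
    strict = All′.map (λ
      { {K} (refuted h k _) (inj₁ gt) → ¬≻L-of-smaller {K} {litSub θ (pos a b)} (here refl) (h ∷ h ∷ k ∷ k ∷ []) gt
      ; {K} (refuted h k _) (inj₂ e) → ¬LitEq-of-smaller {K} {litSub θ (pos a b)} (here refl) (h ∷ h ∷ k ∷ k ∷ []) e })
      (MaximalSide.rest maxSide)

    deep-below : ∀ {u} → DeepOcc u (pos a b ∷ D) → s ≻ (u ⟨ θ ⟩)
    deep-below d with deep-label em d
    ... | m , l with InLss-rename⁻ id-renaming (≅-id (≅-sym C≅)) l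
    ...   | (u₁ , _) , refl , l′ = subst (λ w → s ≻ (w ⟨ θ ⟩)) (sym (sub-id u₁))
              (lss-below maxSide l′ λ ())

    cases : (∃ λ t′ → Step R∞ s t′) ⊎ Irreducible R∞ s → ⊥
    -- If `s` were irreducible, the counterexample itself would be a candidate, so some rule for `s`
    -- would have been produced.
    cases (inj₂ irr) = irr _ ([] , s , _ , proj₂ (R∞-produces cand) , here , here)
      where
      cand : Candidate (R< s) s (b ⟨ θ ⟩) (C , θ)
      cand = record { maximalSide = maxSide
                    ; irreducible = λ { t′ (p , u , v , (_ , r) , at , rp) → irr t′ (p , u , v , r , at , rp) } }
    cases (inj₁ (_ , q , u₀ , v , r , at , _)) with At-sub⁻ a at
    ... | inj₂ (x , _ , o , at′) = variable-irreducible
            (OccursCl-≅ (≅-sym C≅) (side-occurs (inj₂ (_ , here refl , pl)) o)) r at′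
    ... | inj₁ (u , at′ , nv , refl) = superpose C≅ at′ nv r g (inj₁ (refl , strict))
            (λ d → pos-dominates (deep-below d)) (shallow q at′ r)
      where
      shallow : ∀ q {u} → At a q u → R∞ (u ⟨ θ ⟩) v → ¬ DeepOcc u (pos a b ∷ D) →
        ∃ λ s₂ → Candidate (R< (u ⟨ θ ⟩)) (u ⟨ θ ⟩) s₂ (C , θ)
      shallow (_ ∷ _) at r n = ⊥-elim (n (inj₂ (_ , here refl , a , pl , _ , (λ ()) , at)))
      shallow [] here r n = b ⟨ θ ⟩ , record { maximalSide = maxSide ; irreducible = irr }
        where
        irr : Irreducible (R< s) s
        -- Since `s` is a left-hand side of `R∞`, the only redex in it is `s` itself, and that rule
        -- does not belong to `R< s`.
        irr t′ (p , u , v , (h , r′) , at , rp) with left-reduced _ _ _ _ p r r′ at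
        ... | refl , _ = ≻-irrefl h

  contradiction-Horn : Horn C → C ≢ [] → ⊥
  contradiction-Horn horn nonempty = choose C refl
    where
    posCount-↭ : ∀ {D E : Clause sig} → D ↭ E → posCount D ≡ posCount E
    posCount-↭ refl = refl
    posCount-↭ (prep (pos _ _) p) = cong suc (posCount-↭ p)
    posCount-↭ (prep (neg _ _) p) = posCount-↭ p
    posCount-↭ (swap (pos _ _) (pos _ _) p) = cong (λ n → suc (suc n)) (posCount-↭ p)
    posCount-↭ (swap (pos _ _) (neg _ _) p) = cong suc (posCount-↭ p)
    posCount-↭ (swap (neg _ _) (pos _ _) p) = cong suc (posCount-↭ p)
    posCount-↭ (swap (neg _ _) (neg _ _) p) = posCount-↭ p
    posCount-↭ (↭-step p q) = trans (posCount-↭ p) (posCount-↭ q)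

    negative : ∀ D → posCount D ≤ 0 → All (λ K → ∃₂ λ c d → K ≡ neg c d) D
    negative [] _ = []
    negative (neg c d ∷ D) le = (c , d , refl) ∷ negative D le

    lits : ∀ L {D} → C ↭ L ∷ D → Maximal ord (litSub θ L) (D ⟪ θ ⟫) → ⊥
    lits (neg a b) {D} p m with GroundCl-≅ (≅-sub θ (↭⇒≅ p)) (proj₂ in-𝒢N)
    ... | (ga ∷ _ ∷ gb ∷ _) ∷ _ with total ga gb
    ...   | inj₁ g = refute-negative (↭⇒≅ p) g m
    ...   | inj₂ (inj₁ e) = resolve (↭⇒≅ p) e m
    ...   | inj₂ (inj₂ g) = refute-negative (≅-trans (↭⇒≅ p) (ClauseMEq.≋-∷ (LitEq-swapLit (neg a b)) ≅-refl)) g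
              (All′.map (λ {K} n h → n (≻L-respʳ {K} {litSub θ (neg b a)} {litSub θ (neg a b)} (LitEq-swapLit (litSub θ (neg b a))) h)) m)
    lits (pos a b) {D} p m with GroundCl-≅ (≅-sub θ (↭⇒≅ p)) (proj₂ in-𝒢N)
    ... | (ga ∷ gb ∷ _) ∷ _ with total ga gb
    ...   | inj₁ g = refute-positive (↭⇒≅ p) negs g m
      where negs = negative D (ℕₚ.≤-pred (subst (_≤ 1) (posCount-↭ p) horn))
    ...   | inj₂ (inj₁ e) = false (true-≅ {R = R∞} (≅-sym (≅-sub θ (↭⇒≅ p))) (here (subst (EqClosure (Step R∞) _) e ε)))
    ...   | inj₂ (inj₂ g) = refute-positive (≅-trans (↭⇒≅ p) (ClauseMEq.≋-∷ (LitEq-swapLit (pos a b)) ≅-refl)) negs g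
              (All′.map (λ {K} n h → n (≻L-respʳ {K} {litSub θ (pos b a)} {litSub θ (pos a b)} (LitEq-swapLit (litSub θ (pos b a))) h)) m)
      where negs = negative D (ℕₚ.≤-pred (subst (_≤ 1) (posCount-↭ p) horn))

    choose : ∀ E → C ≡ E → ⊥
    choose [] e = nonempty e
    -- Literals of `C` are compared by their ground instances, so that the general literal to be
    -- overlapped or resolved is at hand.
    choose (K ∷ E) refl with finite-maximal em {_>_ = λ K L → _≻L_ ord (litSub θ K) (litSub θ L)}
      (On.wellFounded (litSub θ) ≻L-wellFounded) K E
    ... | L , i , m with ∈-∃++ i
    ...   | E₁ , E₂ , eq = lits L (↭-trans (↭-reflexive eq) (shift L E₁ E₂))
            (AllP.map⁺ (All′.tabulate λ j → m _ (∈-resp-↭ (↭-trans (↭-sym (shift L E₁ E₂)) (↭-reflexive (sym eq))) (there j))))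

-- Refutational completeness

-- Terms with variables stay in the carrier, so valuations are substitutions, and these leave ground
-- terms fixed.
module TermModel {sig : Signature} (R : RSys sig) where
  open Signature sig

  termModel : Model sig
  termModel = record
    { Carrier = Term sig
    ; _≈_ = EqClosure (Step R)
    ; refl = ε
    ; sym = EqStep-sym
    ; trans = _◅◅_
    ; op = fun
    ; op-cong = λ f → EqStep-vec }

  mutual
    eval-sub : ∀ v t → eval termModel v t ≡ t ⟨ v ⟩
    eval-sub v (var x) = refl
    eval-sub v (fun f ts) = cong (fun f) (eval-sub* v ts)

    eval-sub* : ∀ {n} v (ts : Vec (Term sig) n) → eval* termModel v ts ≡ ts ⟨ v ⟩*
    eval-sub* v [] = refl
    eval-sub* v (t ∷ ts) = cong₂ _∷_ (eval-sub v t) (eval-sub* v ts)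

  eval-ground : ∀ v t → Ground t → eval termModel v t ≡ t
  eval-ground v t g = trans (eval-sub v t) (ground-sub t v g)

  true-in-termModel : ∀ v C → GroundCl C → Any (TrueLit R) C → Any (TrueLitM termModel v) C
  true-in-termModel v (pos s t ∷ C) ((gs ∷ gt ∷ []) ∷ g) (here e) =
    here (subst₂ (EqClosure (Step R)) (sym (eval-ground v s gs)) (sym (eval-ground v t gt)) e)
  true-in-termModel v (neg s t ∷ C) ((gs ∷ _ ∷ gt ∷ _ ∷ []) ∷ g) (here n) =
    here λ e → n (subst₂ (EqClosure (Step R)) (eval-ground v s gs) (eval-ground v t gt) e)
  true-in-termModel v (_ ∷ C) (_ ∷ g) (there a) = there (true-in-termModel v C g a)

theorem2 : ({ℓ : Level} → ExcludedMiddle ℓ) →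
    (sig : Signature) (ord : ReductionOrdering sig) (clo : ClosureOrdering sig)
    (N : Clause sig → Set) →
    (∀ C → N C → Horn C) →
    Saturated ord clo N →
    Unsatisfiable (𝒢 N) →
    N []
theorem2 em sig ord clo N horn saturated unsat with em {P = N []}
... | yes ⊥∈N = ⊥∈N
... | no ⊥∉N = ⊥-elim (unsat (termModel , λ c g v → true-in-termModel v (inst c) (proj₂ g) (all-true c g)))
  where
  open Construction em ord clo N
  open TermModel R∞

  no-false : ∀ c → ¬ (𝒢 N c × ¬ (R∞ ⊨ c))
  no-false c p
    with minimal-exists em (ClosureOrder.NMGt-wellFounded em ord clo R∞-admissible) (λ d → 𝒢 N d × ¬ (R∞ ⊨ d)) p
  ... | (C , θ) , (g , false) , minimal =
        MinimalCounterexample.contradiction-Horn em ord clo N saturated g false minimal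
          (horn C (proj₁ g)) (λ { refl → ⊥∉N (proj₁ g) })

  all-true : ∀ c → 𝒢 N c → R∞ ⊨ c
  all-true c g with em {P = R∞ ⊨ c}
  ... | yes t = t
  ... | no f = ⊥-elim (no-false c (g , f))
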